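{- Let $d\ge1$ be an integer and let $B(d)$ be the Birkhoff polytope of $d\times d$ doubly stochastic matrices. Let $H_d(k)$ denote the number of $d\times d$ magic squares with linear sums equal to $k$. Then $$\mathrm{vol}(B(d))=\frac{1}{((d-1)^2)!\;d^{(d-1)^2}}\sum_{m=0}^{n}(-1)^{n+m}\left(\binom{(d-1)^2}{n-m}+(-1)^d\binom{(d-1)^2}{n+m+1}\right)H_d(md),$$ where $n:=\lfloor (d-1)^2/2\rfloor$.
   Context: $B(d)\subset\mathbb{R}^{d^2}$ is the set of real $d\times d$ matrices $(x_{i,j})$ with $x_{i,j}\ge0$ and all row sums and all column sums equal to $1$; it has dimension $(d-1)^2$. A magic square with linear sums $k$ is a $d\times d$ matrix of non-negative integers all of whose row sums and column sums equal $k$. The volume $\mathrm{vol}(B(d))$ is the $(d-1)^2$-dimensional volume in the affine hull of $B(d)$, normalised with respect to the lattice $\mathrm{aff}(B(d))\cap\mathbb{Z}^{d^2}$, so that a fundamental parallelepiped of this lattice has volume $1$ (a single point, in dimension $0$, has volume $1$). -}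

module Defs where

open import Algebra.Bundles.Raw using (RawMonoid)
open import Algebra.Definitions.RawMonoid using () renaming (sum to fold)
open import Data.Fin.Base using (Fin; toℕ)
open import Data.Integer.Base as ℤ using (ℤ)
open import Data.List.Base using (List; []; _∷_; foldr; map; filter; length; upTo; cartesianProductWith)
open import Data.List.Membership.Propositional using (_∈_)
open import Data.List.Membership.Propositional.Properties
  using (∈-cartesianProductWith⁺; ∈-upTo⁺; ∈-filter⁺; ∈-filter⁻)
open import Data.List.Relation.Unary.All as List using ()
open import Data.List.Relation.Unary.AllPairs using (AllPairs; []; _∷_)
open import Data.List.Relation.Unary.Any using (Any; here)
open import Data.List.Relation.Unary.Unique.Propositional using (Unique)
import Data.List.Relation.Unary.Unique.Propositional.Properties as Unique
open import Data.Nat.Base as ℕ using (ℕ; zero; suc; NonZero)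
import Data.Nat.Properties as ℕₚ
open import Data.Product.Base using (Σ-syntax; ∃-syntax; _×_; _,_; proj₂)
open import Data.Rational.Base as ℚ using (ℚ; 0ℚ; 1ℚ; ½; ∣_∣)
import Data.Rational.Properties as ℚₚ
open import Data.Rational.Solver using (module +-*-Solver)
open import Data.Vec.Base as Vec using (Vec; []; _∷_; transpose)
open import Data.Vec.Functional using (Vector)
open import Data.Vec.Properties using (∷-injective)
open import Data.Vec.Relation.Unary.All as All using (All; []; _∷_; all?)
open import Level using (0ℓ)
open import Relation.Binary.PropositionalEquality using (_≡_; refl; sym; trans; cong; cong₂; subst)
open import Relation.Nullary using (¬_)
open import Relation.Nullary.Decidable using (_×-dec_)
open import Relation.Unary using (Pred; Decidable; _⊆_)

-- Real numbers, as Cauchy sequences of rationals up to _≃_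

Eventually : (ℕ → Set) → Set
Eventually P = ∃[ N ] (∀ n → N ℕ.≤ n → P n)

record ℝ : Set where
  constructor mkℝ
  field
    seq    : ℕ → ℚ
    cauchy : ∀ ε → 0ℚ ℚ.< ε →
             ∃[ N ] (∀ m n → N ℕ.≤ m → N ℕ.≤ n → ∣ seq m ℚ.- seq n ∣ ℚ.< ε)

open ℝ

infix  4 _≃_ _≤_ _<_
infixl 6 _+_
infixl 7 _*_

_≃_ : ℝ → ℝ → Set
x ≃ y = ∀ ε → 0ℚ ℚ.< ε → Eventually (λ n → ∣ seq x n ℚ.- seq y n ∣ ℚ.< ε)

_≤_ : ℝ → ℝ → Set
x ≤ y = ∀ ε → 0ℚ ℚ.< ε → Eventually (λ n → seq x n ℚ.< seq y n ℚ.+ ε)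

_<_ : ℝ → ℝ → Set
x < y = ∃[ ε ] 0ℚ ℚ.< ε × Eventually (λ n → seq x n ℚ.+ ε ℚ.< seq y n)

fromℚ : ℚ → ℝ
fromℚ q = mkℝ (λ _ → q) λ ε 0<ε → 0 , λ _ _ _ _ →
  subst (λ r → ∣ r ∣ ℚ.< ε) (sym (ℚₚ.+-inverseʳ q)) 0<ε

fromℤ : ℤ → ℝ
fromℤ z = fromℚ (z ℚ./ 1)

0ℝ 1ℝ : ℝ
0ℝ = fromℚ 0ℚ
1ℝ = fromℚ 1ℚ

module _ where
  open +-*-Solver

  +-rearrange : ∀ a b c d → (a ℚ.+ b) ℚ.- (c ℚ.+ d) ≡ (a ℚ.- c) ℚ.+ (b ℚ.- d)
  +-rearrange = solve 4 (λ a b c d → (a :+ b) :- (c :+ d) := (a :- c) :+ (b :- d)) refl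

  *-rearrange : ∀ a b c d → a ℚ.* b ℚ.- c ℚ.* d ≡ a ℚ.* (b ℚ.- d) ℚ.+ d ℚ.* (a ℚ.- c)
  *-rearrange = solve 4 (λ a b c d → a :* b :- c :* d := a :* (b :- d) :+ d :* (a :- c)) refl

  minus-plus : ∀ a b → b ≡ (b ℚ.- a) ℚ.+ a
  minus-plus = solve 2 (λ a b → b := (b :- a) :+ a) refl

scale-pos : ∀ p {q} → .{{ℚ.Positive p}} → 0ℚ ℚ.< q → 0ℚ ℚ.< p ℚ.* q
scale-pos p {q} 0<q = subst (ℚ._< p ℚ.* q) (ℚₚ.*-zeroʳ p) (ℚₚ.*-monoʳ-<-pos p {0ℚ} {q} 0<q)

abstract
  halve : ∀ ε → 0ℚ ℚ.< ε → ∃[ δ ] 0ℚ ℚ.< δ × δ ℚ.+ δ ≡ ε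
  halve ε 0<ε = ½ ℚ.* ε , scale-pos ½ {ε} 0<ε
    , trans (sym (ℚₚ.*-distribʳ-+ ε ½ ½)) (ℚₚ.*-identityˡ ε)

  divide : ∀ B ε → 0ℚ ℚ.< B → 0ℚ ℚ.< ε → ∃[ δ ] 0ℚ ℚ.< δ × B ℚ.* δ ≡ ε
  divide B ε 0<B 0<ε = ℚ.1/ B ℚ.* ε , scale-pos (ℚ.1/ B) {ε} 0<ε
    , trans (sym (ℚₚ.*-assoc B (ℚ.1/ B) ε))
        (trans (cong (ℚ._* ε) (ℚₚ.*-inverseʳ B)) (ℚₚ.*-identityˡ ε))
    where
    instance
      B⁺ : ℚ.Positive B
      B⁺ = ℚ.positive 0<B
      B≢0 : ℚ.NonZero B
      B≢0 = ℚₚ.pos⇒nonZero B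
      1/B⁺ : ℚ.Positive (ℚ.1/ B)
      1/B⁺ = ℚₚ.1/pos⇒pos B

  +-cauchy : ∀ x y ε → 0ℚ ℚ.< ε → ∃[ N ] (∀ m n → N ℕ.≤ m → N ℕ.≤ n →
    ∣ (seq x m ℚ.+ seq y m) ℚ.- (seq x n ℚ.+ seq y n) ∣ ℚ.< ε)
  +-cauchy x y ε 0<ε =
    let (δ , 0<δ , δ+δ≡ε) = halve ε 0<ε
        (M , x-close) = cauchy x δ 0<δ
        (N , y-close) = cauchy y δ 0<δ
    in M ℕ.⊔ N , λ m n le₁ le₂ → begin-strict
      ∣ (seq x m ℚ.+ seq y m) ℚ.- (seq x n ℚ.+ seq y n) ∣
        ≡⟨ cong ∣_∣ (+-rearrange (seq x m) (seq y m) (seq x n) (seq y n)) ⟩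
      ∣ (seq x m ℚ.- seq x n) ℚ.+ (seq y m ℚ.- seq y n) ∣
        ≤⟨ ℚₚ.∣p+q∣≤∣p∣+∣q∣ (seq x m ℚ.- seq x n) (seq y m ℚ.- seq y n) ⟩
      ∣ seq x m ℚ.- seq x n ∣ ℚ.+ ∣ seq y m ℚ.- seq y n ∣
        <⟨ ℚₚ.+-mono-<
             (x-close m n (ℕₚ.m⊔n≤o⇒m≤o M N le₁) (ℕₚ.m⊔n≤o⇒m≤o M N le₂))
             (y-close m n (ℕₚ.m⊔n≤o⇒n≤o M N le₁) (ℕₚ.m⊔n≤o⇒n≤o M N le₂)) ⟩
      δ ℚ.+ δ
        ≡⟨ δ+δ≡ε ⟩
      ε ∎
    where open ℚₚ.≤-Reasoning

  bounded : ∀ x → ∃[ B ] 0ℚ ℚ.< B × Eventually (λ n → ∣ seq x n ∣ ℚ.≤ B)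
  bounded x =
    let (N , close) = cauchy x 1ℚ (ℚₚ.positive⁻¹ 1ℚ)
        a = seq x N
    in 1ℚ ℚ.+ ∣ a ∣
     , ℚₚ.+-mono-<-≤ (ℚₚ.positive⁻¹ 1ℚ) (ℚₚ.0≤∣p∣ a)
     , N , λ n N≤n → begin
         ∣ seq x n ∣
           ≡⟨ cong ∣_∣ (minus-plus a (seq x n)) ⟩
         ∣ (seq x n ℚ.- a) ℚ.+ a ∣
           ≤⟨ ℚₚ.∣p+q∣≤∣p∣+∣q∣ (seq x n ℚ.- a) a ⟩
         ∣ seq x n ℚ.- a ∣ ℚ.+ ∣ a ∣
           ≤⟨ ℚₚ.+-monoˡ-≤ ∣ a ∣ (ℚₚ.<⇒≤ (close n N N≤n ℕₚ.≤-refl)) ⟩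
         1ℚ ℚ.+ ∣ a ∣ ∎
    where open ℚₚ.≤-Reasoning

  product-< : ∀ {B δ} a b → 0ℚ ℚ.< B → ∣ a ∣ ℚ.≤ B → ∣ b ∣ ℚ.< δ → ∣ a ℚ.* b ∣ ℚ.< B ℚ.* δ
  product-< {B} {δ} a b 0<B a≤B b<δ = begin-strict
    ∣ a ℚ.* b ∣     ≡⟨ ℚₚ.∣p*q∣≡∣p∣*∣q∣ a b ⟩
    ∣ a ∣ ℚ.* ∣ b ∣ ≤⟨ ℚₚ.*-monoʳ-≤-nonNeg ∣ b ∣ {{ℚ.nonNegative (ℚₚ.0≤∣p∣ b)}} a≤B ⟩
    B ℚ.* ∣ b ∣     <⟨ ℚₚ.*-monoʳ-<-pos B {{ℚ.positive 0<B}} b<δ ⟩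
    B ℚ.* δ         ∎
    where open ℚₚ.≤-Reasoning

  *-cauchy : ∀ x y ε → 0ℚ ℚ.< ε → ∃[ N ] (∀ m n → N ℕ.≤ m → N ℕ.≤ n →
    ∣ (seq x m ℚ.* seq y m) ℚ.- (seq x n ℚ.* seq y n) ∣ ℚ.< ε)
  *-cauchy x y ε 0<ε =
    let (δ , 0<δ , δ+δ≡ε) = halve ε 0<ε
        (A , 0<A , K , x≤A) = bounded x
        (B , 0<B , L , y≤B) = bounded y
        (α , 0<α , Aα≡) = divide A δ 0<A 0<δ
        (β , 0<β , Bβ≡) = divide B δ 0<B 0<δ
        (M , x-close) = cauchy x β 0<β
        (N , y-close) = cauchy y α 0<α
        J = (K ℕ.⊔ L) ℕ.⊔ (M ℕ.⊔ N)
        KL≤ : ∀ {i} → J ℕ.≤ i → K ℕ.⊔ L ℕ.≤ i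
        KL≤ = ℕₚ.m⊔n≤o⇒m≤o (K ℕ.⊔ L) (M ℕ.⊔ N)
        MN≤ : ∀ {i} → J ℕ.≤ i → M ℕ.⊔ N ℕ.≤ i
        MN≤ = ℕₚ.m⊔n≤o⇒n≤o (K ℕ.⊔ L) (M ℕ.⊔ N)
    in J , λ m n le₁ le₂ → begin-strict
      ∣ seq x m ℚ.* seq y m ℚ.- seq x n ℚ.* seq y n ∣
        ≡⟨ cong ∣_∣ (*-rearrange (seq x m) (seq y m) (seq x n) (seq y n)) ⟩
      ∣ seq x m ℚ.* (seq y m ℚ.- seq y n) ℚ.+ seq y n ℚ.* (seq x m ℚ.- seq x n) ∣
        ≤⟨ ℚₚ.∣p+q∣≤∣p∣+∣q∣ (seq x m ℚ.* (seq y m ℚ.- seq y n)) (seq y n ℚ.* (seq x m ℚ.- seq x n)) ⟩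
      ∣ seq x m ℚ.* (seq y m ℚ.- seq y n) ∣ ℚ.+ ∣ seq y n ℚ.* (seq x m ℚ.- seq x n) ∣
        <⟨ ℚₚ.+-mono-<
             (product-< (seq x m) (seq y m ℚ.- seq y n) 0<A
               (x≤A m (ℕₚ.m⊔n≤o⇒m≤o K L (KL≤ le₁)))
               (y-close m n (ℕₚ.m⊔n≤o⇒n≤o M N (MN≤ le₁)) (ℕₚ.m⊔n≤o⇒n≤o M N (MN≤ le₂))))
             (product-< (seq y n) (seq x m ℚ.- seq x n) 0<B
               (y≤B n (ℕₚ.m⊔n≤o⇒n≤o K L (KL≤ le₂)))
               (x-close m n (ℕₚ.m⊔n≤o⇒m≤o M N (MN≤ le₁)) (ℕₚ.m⊔n≤o⇒m≤o M N (MN≤ le₂)))) ⟩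
      A ℚ.* α ℚ.+ B ℚ.* β
        ≡⟨ cong₂ ℚ._+_ Aα≡ Bβ≡ ⟩
      δ ℚ.+ δ
        ≡⟨ δ+δ≡ε ⟩
      ε ∎
    where open ℚₚ.≤-Reasoning

_+_ : ℝ → ℝ → ℝ
x + y = mkℝ (λ n → seq x n ℚ.+ seq y n) (+-cauchy x y)

_*_ : ℝ → ℝ → ℝ
x * y = mkℝ (λ n → seq x n ℚ.* seq y n) (*-cauchy x y)

+-0-rawMonoidℝ : RawMonoid 0ℓ 0ℓ
+-0-rawMonoidℝ = record { Carrier = ℝ ; _≈_ = _≃_ ; _∙_ = _+_ ; ε = 0ℝ }

sum : ∀ {n} → Vector ℝ n → ℝ
sum = fold +-0-rawMonoidℝ

-- The half-open box ∏ᵢ [ lower i , upper i ).  Restricting to rational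
-- corners does not change the inner and outer contents.
record Box (n : ℕ) : Set where
  field
    lower upper : Vector ℚ n
    lower≤upper : ∀ i → lower i ℚ.≤ upper i

open Box

⟦_⟧ : ∀ {n} → Box n → Pred (Vector ℝ n) 0ℓ
⟦ b ⟧ x = ∀ i → fromℚ (lower b i) ≤ x i × x i < fromℚ (upper b i)

boxVolume : ∀ {n} → Box n → ℚ
boxVolume b = fold ℚ.*-1-rawMonoid (λ i → upper b i ℚ.- lower b i)

totalVolume : ∀ {n} → List (Box n) → ℚ
totalVolume bs = foldr ℚ._+_ 0ℚ (map boxVolume bs)

Disjoint : ∀ {n} → Box n → Box n → Set
Disjoint b c = ∀ x → ¬ (⟦ b ⟧ x × ⟦ c ⟧ x)

-- S is Jordan measurable with content v: finite unions of boxes inside S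
-- and finite coverings of S by boxes have volumes arbitrarily close to v.
-- The double negation makes the covering condition the classical one; which
-- box contains a given real point is not decidable.
record HasContent {n : ℕ} (S : Pred (Vector ℝ n) 0ℓ) (v : ℝ) : Set where
  field
    inner : ∀ ε → 0ℚ ℚ.< ε → Σ[ bs ∈ List (Box n) ]
            AllPairs Disjoint bs × List.All (λ b → ⟦ b ⟧ ⊆ S) bs ×
            v ≤ fromℚ (totalVolume bs ℚ.+ ε)
    outer : ∀ ε → 0ℚ ℚ.< ε → Σ[ bs ∈ List (Box n) ]
            (∀ x → S x → ¬ ¬ Any (λ b → ⟦ b ⟧ x) bs) ×
            fromℚ (totalVolume bs) ≤ v + fromℚ ε

sumℤ : ∀ {n} → Vector ℤ n → ℤ
sumℤ = fold ℤ.+-0-rawMonoid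

module _ {I : Set} where

  record AffineHull (S : Pred (I → ℝ) 0ℓ) (y : I → ℝ) : Set where
    field
      {size}  : ℕ
      points  : Fin size → I → ℝ
      coeffs  : Fin size → ℝ
      points∈ : ∀ k → S (points k)
      affine  : sum coeffs ≃ 1ℝ
      equal   : ∀ i → y i ≃ sum (λ k → coeffs k * points k i)

  -- A lattice basis of aff(S) ∩ ℤᴵ translated to an integral base point,
  -- giving affine coordinates ℝⁿ ≅ aff(S) under which ℤⁿ ≅ aff(S) ∩ ℤᴵ.
  record LatticeChart (n : ℕ) (S : Pred (I → ℝ) 0ℓ) : Set where
    field
      origin : I → ℤ
      basis  : Fin n → I → ℤ

    point : Vector ℝ n → I → ℝ
    point t i = fromℤ (origin i) + sum (λ j → t j * fromℤ (basis j i))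

    field
      point∈hull  : ∀ t → AffineHull S (point t)
      hull⊆points : ∀ y → AffineHull S y → ∃[ t ] (∀ i → y i ≃ point t i)
      independent : ∀ (t : Vector ℝ n) → (∀ i → sum (λ j → t j * fromℤ (basis j i)) ≃ 0ℝ) →
                    (∀ j → t j ≃ 0ℝ)
      generating  : ∀ (z : I → ℤ) → AffineHull S (λ i → fromℤ (z i)) →
                    Σ[ c ∈ Vector ℤ n ]
                    (∀ i → z i ≡ origin i ℤ.+ sumℤ (λ j → c j ℤ.* basis j i))

  -- The n-dimensional volume of S, as measured in a chart carrying a
  -- fundamental parallelepiped of aff(S) ∩ ℤᴵ to the unit cube.  Any two
  -- charts differ by a translation and an element of GLₙ(ℤ), so the value
  -- does not depend on the chart.
  HasLatticeVolume : (n : ℕ) → Pred (I → ℝ) 0ℓ → ℝ → Set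
  HasLatticeVolume n S v =
    Σ[ χ ∈ LatticeChart n S ] HasContent (λ t → S (LatticeChart.point χ t)) v

record Birkhoff (d : ℕ) (x : Fin d × Fin d → ℝ) : Set where
  field
    nonneg : ∀ ij → 0ℝ ≤ x ij
    rows   : ∀ i → sum (λ j → x (i , j)) ≃ 1ℝ
    cols   : ∀ j → sum (λ i → x (i , j)) ≃ 1ℝ

Matrix : ℕ → Set
Matrix d = Vec (Vec ℕ d) d

Magic : ∀ {d} → ℕ → Matrix d → Set
Magic k M = All (λ r → Vec.sum r ≡ k) M × All (λ c → Vec.sum c ≡ k) (transpose M)

magic? : ∀ {d} k → Decidable (Magic {d} k)
magic? k M = all? (λ r → Vec.sum r ℕₚ.≟ k) M ×-dec all? (λ c → Vec.sum c ℕₚ.≟ k) (transpose M)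

vectors : ∀ {A : Set} → List A → (n : ℕ) → List (Vec A n)
vectors xs zero    = [] ∷ []
vectors xs (suc n) = cartesianProductWith _∷_ xs (vectors xs n)

-- The entries of a magic square with sums k are at most k, so a search over
-- entries 0, …, k finds all of them; see ∈-magicSquares and magicSquares-unique.
magicSquares : (d k : ℕ) → List (Matrix d)
magicSquares d k = filter (magic? k) (vectors (vectors (upTo (suc k)) d) d)

H : ℕ → ℕ → ℕ
H d k = length (magicSquares d k)

private
  ∈-vectors : ∀ {A : Set} {xs : List A} {n} {v : Vec A n} → All (_∈ xs) v → v ∈ vectors xs n
  ∈-vectors []       = here refl
  ∈-vectors (p ∷ ps) = ∈-cartesianProductWith⁺ _∷_ p (∈-vectors ps)

  vectors-unique : ∀ {A : Set} {xs : List A} → Unique xs → ∀ n → Unique (vectors xs n)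
  vectors-unique xs! zero    = List.[] ∷ []
  vectors-unique xs! (suc n) = Unique.cartesianProductWith⁺ _∷_ ∷-injective xs! (vectors-unique xs! n)

  entries≤sum : ∀ {n} (v : Vec ℕ n) → All (ℕ._≤ Vec.sum v) v
  entries≤sum []      = []
  entries≤sum (a ∷ v) = ℕₚ.m≤m+n a (Vec.sum v)
    ∷ All.map (λ le → ℕₚ.≤-trans le (ℕₚ.m≤n+m (Vec.sum v) a)) (entries≤sum v)

∈-magicSquares : ∀ {d k} {M : Matrix d} → Magic k M → M ∈ magicSquares d k
∈-magicSquares {k = k} magic@(rows , _) = ∈-filter⁺ (magic? k) (∈-vectors (All.map row∈ rows)) magic
  where
  row∈ : ∀ {n} {r : Vec ℕ n} → Vec.sum r ≡ k → r ∈ vectors (upTo (suc k)) n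
  row∈ {r = r} refl = ∈-vectors (All.map (λ le → ∈-upTo⁺ (ℕ.s≤s le)) (entries≤sum r))

magicSquares-magic : ∀ {d k} {M : Matrix d} → M ∈ magicSquares d k → Magic k M
magicSquares-magic {d} {k} M∈ = proj₂ (∈-filter⁻ (magic? k) {xs = vectors (vectors (upTo (suc k)) d) d} M∈)

magicSquares-unique : ∀ d k → Unique (magicSquares d k)
magicSquares-unique d k = Unique.filter⁺ (magic? k)
  (vectors-unique (vectors-unique (Unique.upTo⁺ (suc k)) d) d)

-- ∑₀^ n f = f 0 + f 1 + ⋯ + f n
∑₀^ : ℕ → (ℕ → ℤ) → ℤ
∑₀^ n f = sumℤ {suc n} (λ m → f (toℕ m))

n!*d^n≢0 : ∀ n d → .{{_ : NonZero d}} → NonZero (n ℕ.! ℕ.* d ℕ.^ n)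
n!*d^n≢0 n d = ℕₚ.m*n≢0 (n ℕ.!) (d ℕ.^ n) {{n ℕₚ.!≢0}} {{ℕₚ.m^n≢0 d n}}

-- For a point w in general position of the space of magic matrices, ordered
-- lexicographically, let C(w) be the set of magic squares M vanishing where w
-- does and with M_e ≥ 1 where w_e < 0.  Pull a permutation matrix π supported
-- in w: subtracting from M as large a multiple of π as possible makes an entry
-- of π vanish, ties being broken by the order of the w_e, and the remainder
-- lies in C(w − w_e π), a set of smaller dimension.  Passing from w to −w
-- exchanges the conditions t ≥ 0 and t ≥ 1 on this multiple t.  By induction there are
-- pairs (a , b) with a + b = D = (d − 1)² + 1, the same for both signs, such
-- that Σ_k |C(w)_k| q^k = Σ q^a / (1 − q)^D and Σ_k |C(−w)_k| q^k = Σ q^b / (1 − q)^D.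
-- For w positive the two sets count H(k) and H(k − d), so the symmetry a ↔ b is
-- the reciprocity law, and the alternating sum becomes a ((d − 1)²)-th backward
-- difference of a polynomial of that degree, namely d^((d − 1)²) times the number
-- of pairs.  Counting the cells of a grid inside the polytope, or meeting it, by
-- H at a slightly shifted argument gives the volume as the number of pairs
-- divided by ((d − 1)²)!.
module Submission where

open import Defs using (HasLatticeVolume; Birkhoff; fromℚ; H; ∑₀^; n!*d^n≢0)
open import Data.Nat.Base using (ℕ; NonZero; _+_; _*_; _∸_; _^_; _/_; _!)
open import Data.Nat.Combinatorics using (_C_)
open import Data.Integer.Base as ℤ using (+_; 1ℤ; -1ℤ)
open import Data.Rational.Base as ℚ using ()

open import Algebra.Bundles using (AbelianGroup; CommutativeRing)
import Algebra.Definitions.RawMonoid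
import Algebra.Properties.Group
import Algebra.Properties.Semiring.Sum
open import Data.Fin.Base as Fin using (Fin; zero; suc)
import Data.Fin.Properties as Finₚ
open import Data.Fin.Subset as Subset using (Subset; ⁅_⁆)
import Data.Fin.Subset.Properties as Subsetₚ
open import Data.Integer.Base using (ℤ; 0ℤ; -[1+_]; +≤+; -≤+; +<+; -<+)
import Data.Integer.Properties as ℤₚ
open import Data.Integer.Tactic.RingSolver using (solve-∀)
open import Data.List.Base as List using (List; []; _∷_)
open import Data.List.Membership.Propositional using (_∈_; find; lose)
import Data.List.Membership.Propositional.Properties as ∈ₚ
import Data.List.Properties as Listₚ
open import Data.List.Relation.Unary.All as ListAll using ([]; _∷_)
import Data.List.Relation.Unary.All.Properties as ListAllₚ
open import Data.List.Relation.Unary.AllPairs using (AllPairs; []; _∷_)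
import Data.List.Relation.Unary.AllPairs.Properties as AllPairsₚ
open import Data.List.Relation.Unary.Any as ListAny using (here; there)
import Data.List.Relation.Unary.Any.Properties as ListAnyₚ
import Data.List.Relation.Unary.Unique.DecPropositional.Properties as DecUniqueₚ
open import Data.List.Relation.Unary.Unique.Propositional using (Unique)
import Data.List.Relation.Unary.Unique.Propositional.Properties as Uniqueₚ
open import Data.Nat.Base as ℕ using (zero; suc; z≤n; s≤s)
open import Data.Nat.Combinatorics using (nCk+nC[k+1]≡[n+1]C[k+1]; nCk≡nC[n∸k]; nCn≡1)
import Data.Nat.DivMod as DivMod
import Data.Nat.Properties as ℕₚ
open import Data.Nat.Tactic.RingSolver using () renaming (solve-∀ to ℕ-solve-∀)
open import Data.Product.Base using (Σ-syntax; ∃-syntax; _×_; _,_; proj₁; proj₂)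
open import Data.Rational.Base using (ℚ; 0ℚ; 1ℚ)
import Data.Rational.Properties as ℚₚ
import Data.Rational.Unnormalised.Base as ℚᵘ
import Data.Rational.Unnormalised.Properties as ℚᵘₚ
open import Data.Sum.Base as Sum using (_⊎_; inj₁; inj₂)
open import Data.Unit.Base using (⊤; tt)
open import Data.Vec.Base as Vec using (Vec; []; _∷_)
import Data.Vec.Properties as Vecₚ
import Data.Vec.Relation.Unary.All.Properties as VecAllₚ
open import Defs using
  ( Matrix; Magic; magicSquares; ∈-magicSquares; magicSquares-magic; magicSquares-unique; sumℤ
  ; ℝ; 0ℝ; 1ℝ; fromℤ; Eventually; _≃_; _≤_; _<_; sum
  ; halve; divide; bounded; product-<; +-rearrange; *-rearrange
  ; AffineHull; LatticeChart; HasContent; Box; ⟦_⟧; boxVolume; totalVolume; Disjoint )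
  renaming (_+_ to _+ᴿ_; _*_ to _*ᴿ_)
open import Function.Base using (_∘_; id; case_of_)
open import Level using (0ℓ)
open import Relation.Binary.Definitions using (tri<; tri≈; tri>)
open import Relation.Binary.PropositionalEquality
  using (_≡_; _≢_; refl; sym; trans; cong; cong₂; subst; subst₂; module ≡-Reasoning)
open import Relation.Nullary using (¬_; Dec; yes; no; contradiction)
open import Relation.Nullary.Decidable using (_×-dec_; _⊎-dec_; ¬?; decidable-stable; dec⇒maybe)
open import Tactic.RingSolver using () renaming (solve-∀ to ring-solve-∀)
open import Tactic.RingSolver.Core.AlmostCommutativeRing using (AlmostCommutativeRing; fromCommutativeRing)

open ℝ using (seq; cauchy)

-- Entries of a permutation matrix are 0 or 1, so every facet missing π is at lattice distance 1
-- from it; this unimodularity is why the numerators are monomials. Ties decide the shape of the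
-- rest. The entries of w are integer vectors ordered lexicographically, that is, numbers with
-- infinitesimal parts, and the coordinates of w are kept a rational basis of the magic matrices on
-- the current face (`Generic`). Two entries of w then agree only if the corresponding entries of
-- every M on that face agree. Such entries cut out the same facet, so the pieces are indexed by
-- values of w instead of positions. With the strict inequalities the pieces are disjoint, and no
-- inclusion and exclusion is needed. Birkhoff's theorem enters because a non-empty cone of positive
-- dimension must leave a permutation matrix in the support of w to pull. Polynomiality of H is not
-- assumed: each pair contributes a product of linear factors, valid from k = 0 on because b is
-- never 0, and reflecting the product for a gives the one for b.

private
  variable
    dim e len : ℕ
    A B : Set

module Σℤ = Algebra.Properties.Semiring.Sum ℤₚ.+-*-semiring

-- Integer matrices with constant line sums

entry : Matrix dim → Fin dim → Fin dim → ℕ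
entry M i j = Vec.lookup (Vec.lookup M i) j

⟪_⟫ : Matrix dim → Fin dim → Fin dim → ℤ
⟪ M ⟫ i j = + entry M i j

fromEntries : (Fin dim → Fin dim → ℕ) → Matrix dim
fromEntries f = Vec.tabulate λ i → Vec.tabulate (f i)

-- Over ℤ, so that differences of magic squares, alternating cycles and the coordinates of w are
-- covered too.
LineSums : ℤ → (Fin dim → Fin dim → ℤ) → Set
LineSums k f = (∀ i → sumℤ (f i) ≡ k) × (∀ j → sumℤ (λ i → f i j) ≡ k)

entry-fromEntries : ∀ (f : Fin dim → Fin dim → ℕ) i j → entry (fromEntries f) i j ≡ f i j
entry-fromEntries f i j =
  trans (cong (λ r → Vec.lookup r j) (Vecₚ.lookup∘tabulate (λ i → Vec.tabulate (f i)) i))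
        (Vecₚ.lookup∘tabulate (f i) j)

lookup-injective : ∀ {A : Set} {xs ys : Vec A len} →
                   (∀ i → Vec.lookup xs i ≡ Vec.lookup ys i) → xs ≡ ys
lookup-injective {xs = xs} {ys} eq = begin
  xs  ≡⟨ Vecₚ.tabulate∘lookup xs ⟨
  Vec.tabulate (Vec.lookup xs) ≡⟨ Vecₚ.tabulate-cong eq ⟩
  Vec.tabulate (Vec.lookup ys) ≡⟨ Vecₚ.tabulate∘lookup ys ⟩
  ys  ∎
  where open ≡-Reasoning

entry-injective : ∀ {M M′ : Matrix dim} → (∀ i j → entry M i j ≡ entry M′ i j) → M ≡ M′
entry-injective eq = lookup-injective λ i → lookup-injective (eq i)

lookup-transpose : ∀ {m} {A : Set} (M : Vec (Vec A m) len) i j →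
                   Vec.lookup (Vec.lookup (Vec.transpose M) j) i ≡ Vec.lookup (Vec.lookup M i) j
lookup-transpose {m = m} {A} (r ∷ M) i j = trans (cong (λ c → Vec.lookup c i) column) (at i)
  where
  cons : A → Vec A _ → Vec A _
  cons = _∷_
  column : Vec.lookup (Vec.transpose (r ∷ M)) j ≡ Vec.lookup r j ∷ Vec.lookup (Vec.transpose M) j
  column = trans (Vecₚ.lookup-⊛ j (Vec.replicate m cons Vec.⊛ r) (Vec.transpose M))
    (cong (λ f → f (Vec.lookup (Vec.transpose M) j))
      (trans (Vecₚ.lookup-⊛ j (Vec.replicate m cons) r)
             (cong (λ f → f (Vec.lookup r j)) (Vecₚ.lookup-replicate j cons))))
  at : ∀ i → Vec.lookup (Vec.lookup r j ∷ Vec.lookup (Vec.transpose M) j) i ≡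
             Vec.lookup (Vec.lookup (r ∷ M) i) j
  at zero    = refl
  at (suc i) = lookup-transpose M i j

vecSum≡sumℤ : (v : Vec ℕ len) → + Vec.sum v ≡ sumℤ (λ i → + Vec.lookup v i)
vecSum≡sumℤ []      = refl
vecSum≡sumℤ (x ∷ v) = trans (ℤₚ.pos-+ x (Vec.sum v)) (cong (ℤ._+_ (+ x)) (vecSum≡sumℤ v))

colSum≡sumℤ : (M : Matrix dim) → ∀ j → + Vec.sum (Vec.lookup (Vec.transpose M) j) ≡ sumℤ (λ i → ⟪ M ⟫ i j)
colSum≡sumℤ M j = trans (vecSum≡sumℤ (Vec.lookup (Vec.transpose M) j))
                        (Σℤ.sum-cong-≗ λ i → cong +_ (lookup-transpose M i j))

magic⇒lineSums : ∀ {k} {M : Matrix dim} → Magic k M → LineSums (+ k) ⟪ M ⟫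
magic⇒lineSums {M = M} (rows , cols) =
  (λ i → trans (sym (vecSum≡sumℤ (Vec.lookup M i))) (cong +_ (VecAllₚ.lookup⁺ rows i))) ,
  (λ j → trans (sym (colSum≡sumℤ M j)) (cong +_ (VecAllₚ.lookup⁺ cols j)))

lineSums⇒magic : ∀ {k} {M : Matrix dim} → LineSums (+ k) ⟪ M ⟫ → Magic k M
lineSums⇒magic {M = M} (rows , cols) =
  VecAllₚ.lookup⁻ (λ i → ℤₚ.+-injective (trans (vecSum≡sumℤ (Vec.lookup M i)) (rows i))) ,
  VecAllₚ.lookup⁻ (λ j → ℤₚ.+-injective (trans (colSum≡sumℤ M j) (cols j)))

lineSums-cong : ∀ {k l} {f g : Fin dim → Fin dim → ℤ} → k ≡ l → (∀ i j → f i j ≡ g i j) →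
                LineSums k f → LineSums l g
lineSums-cong refl f≗g (rows , cols) =
  (λ i → trans (sym (Σℤ.sum-cong-≗ (f≗g i))) (rows i)) ,
  (λ j → trans (sym (Σℤ.sum-cong-≗ (λ i → f≗g i j))) (cols j))

sumℤ-linear : ∀ a b (f g : Fin len → ℤ) →
              sumℤ (λ i → a ℤ.* f i ℤ.+ b ℤ.* g i) ≡ a ℤ.* sumℤ f ℤ.+ b ℤ.* sumℤ g
sumℤ-linear a b f g = begin
  sumℤ (λ i → a ℤ.* f i ℤ.+ b ℤ.* g i)
    ≡⟨ Σℤ.∑-distrib-+ (λ i → a ℤ.* f i) (λ i → b ℤ.* g i) ⟩
  sumℤ (λ i → a ℤ.* f i) ℤ.+ sumℤ (λ i → b ℤ.* g i)
    ≡⟨ cong₂ ℤ._+_ (Σℤ.*-distribˡ-sum a f) (Σℤ.*-distribˡ-sum b g) ⟨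
  a ℤ.* sumℤ f ℤ.+ b ℤ.* sumℤ g ∎
  where open ≡-Reasoning

lineSums-linear : ∀ a b {k l} {f g : Fin dim → Fin dim → ℤ} → LineSums k f → LineSums l g →
                  LineSums (a ℤ.* k ℤ.+ b ℤ.* l) (λ i j → a ℤ.* f i j ℤ.+ b ℤ.* g i j)
lineSums-linear a b {f = f} {g} (rows , cols) (rows′ , cols′) =
  (λ i → trans (sumℤ-linear a b (f i) (g i)) (cong₂ (λ x y → a ℤ.* x ℤ.+ b ℤ.* y) (rows i) (rows′ i))) ,
  (λ j → trans (sumℤ-linear a b (λ i → f i j) (λ i → g i j))
               (cong₂ (λ x y → a ℤ.* x ℤ.+ b ℤ.* y) (cols j) (cols′ j)))

sumℤ-zero : ∀ {f : Fin len → ℤ} → (∀ i → f i ≡ 0ℤ) → sumℤ f ≡ 0ℤ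
sumℤ-zero {len} f≗0 = trans (Σℤ.sum-cong-≗ f≗0) (Σℤ.sum-replicate-zero len)

sumℤ-mono : ∀ {f g : Fin len → ℤ} → (∀ i → f i ℤ.≤ g i) → sumℤ f ℤ.≤ sumℤ g
sumℤ-mono {zero}  f≤g = ℤₚ.≤-refl
sumℤ-mono {suc len} f≤g = ℤₚ.+-mono-≤ (f≤g zero) (sumℤ-mono (f≤g ∘ suc))

sumℤ-nonneg : ∀ {f : Fin len → ℤ} → (∀ i → 0ℤ ℤ.≤ f i) → 0ℤ ℤ.≤ sumℤ f
sumℤ-nonneg {len} {f} 0≤f = subst (ℤ._≤ sumℤ f) (Σℤ.sum-replicate-zero len) (sumℤ-mono 0≤f)

δ : Fin len → Fin len → ℤ
δ zero    zero    = 1ℤ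
δ zero    (suc _) = 0ℤ
δ (suc _) zero    = 0ℤ
δ (suc i) (suc j) = δ i j

δ-refl : (i : Fin len) → δ i i ≡ 1ℤ
δ-refl zero    = refl
δ-refl (suc i) = δ-refl i

δ-≢ : ∀ {i j : Fin len} → i ≢ j → δ i j ≡ 0ℤ
δ-≢ {i = zero}  {zero}  i≢j = contradiction refl i≢j
δ-≢ {i = zero}  {suc j} i≢j = refl
δ-≢ {i = suc i} {zero}  i≢j = refl
δ-≢ {i = suc i} {suc j} i≢j = δ-≢ (i≢j ∘ cong suc)

sumℤ-δ : (i : Fin len) (f : Fin len → ℤ) → sumℤ (λ j → δ i j ℤ.* f j) ≡ f i
sumℤ-δ zero    f = trans (cong₂ ℤ._+_ (ℤₚ.*-identityˡ (f zero)) (sumℤ-zero λ j → ℤₚ.*-zeroˡ (f (suc j))))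
                         (ℤₚ.+-identityʳ (f zero))
sumℤ-δ (suc i) f = trans (cong₂ ℤ._+_ (ℤₚ.*-zeroˡ (f zero)) (sumℤ-δ i (f ∘ suc)))
                         (ℤₚ.+-identityˡ (f (suc i)))

sumℤ-δ-1 : (i : Fin len) → sumℤ (δ i) ≡ 1ℤ
sumℤ-δ-1 i = trans (Σℤ.sum-cong-≗ λ j → sym (ℤₚ.*-identityʳ (δ i j))) (sumℤ-δ i λ _ → 1ℤ)

term≤sumℤ : ∀ {f : Fin len → ℤ} → (∀ i → 0ℤ ℤ.≤ f i) → ∀ i → f i ℤ.≤ sumℤ f
term≤sumℤ {f = f} 0≤f zero    = subst (ℤ._≤ sumℤ f) (ℤₚ.+-identityʳ _)
  (ℤₚ.+-monoʳ-≤ (f zero) (sumℤ-nonneg (0≤f ∘ suc)))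
term≤sumℤ {f = f} 0≤f (suc i) = subst (ℤ._≤ sumℤ f) (ℤₚ.+-identityˡ _)
  (ℤₚ.+-mono-≤ (0≤f zero) (term≤sumℤ (0≤f ∘ suc) i))

two-terms≤sumℤ : ∀ {f : Fin len → ℤ} → (∀ i → 0ℤ ℤ.≤ f i) → ∀ {i j} → i ≢ j → f i ℤ.+ f j ℤ.≤ sumℤ f
two-terms≤sumℤ {f = f} 0≤f {zero}  {zero}  i≢j = contradiction refl i≢j
two-terms≤sumℤ {f = f} 0≤f {zero}  {suc j} i≢j = ℤₚ.+-monoʳ-≤ (f zero) (term≤sumℤ (0≤f ∘ suc) j)
two-terms≤sumℤ {f = f} 0≤f {suc i} {zero}  i≢j = subst (ℤ._≤ sumℤ f) (ℤₚ.+-comm (f zero) (f (suc i)))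
  (ℤₚ.+-monoʳ-≤ (f zero) (term≤sumℤ (0≤f ∘ suc) i))
two-terms≤sumℤ {f = f} 0≤f {suc i} {suc j} i≢j = subst (ℤ._≤ sumℤ f) (ℤₚ.+-identityˡ _)
  (ℤₚ.+-mono-≤ (0≤f zero) (two-terms≤sumℤ (0≤f ∘ suc) (i≢j ∘ cong suc)))

-- Birkhoff's theorem

-- A step of an alternating walk, leaving column j through row i for column j′.
turn : Fin dim → Fin dim → Fin dim → Fin dim → Fin dim → ℤ
turn i j j′ r l = δ i r ℤ.* (δ j l ℤ.- δ j′ l)

turn-row : ∀ (i j j′ r : Fin dim) → sumℤ (turn i j j′ r) ≡ 0ℤ
turn-row i j j′ r = begin
  sumℤ (turn i j j′ r)  ≡⟨ Σℤ.*-distribˡ-sum (δ i r) (λ l → δ j l ℤ.- δ j′ l) ⟨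
  δ i r ℤ.* sumℤ (λ l → δ j l ℤ.- δ j′ l)  ≡⟨ cong (δ i r ℤ.*_) (Σℤ.sum-cong-≗ λ l → as-linear (δ j l) (δ j′ l)) ⟩
  δ i r ℤ.* sumℤ (λ l → 1ℤ ℤ.* δ j l ℤ.+ -1ℤ ℤ.* δ j′ l) ≡⟨ cong (δ i r ℤ.*_) (sumℤ-linear 1ℤ -1ℤ (δ j) (δ j′)) ⟩
  δ i r ℤ.* (1ℤ ℤ.* sumℤ (δ j) ℤ.+ -1ℤ ℤ.* sumℤ (δ j′))
    ≡⟨ cong₂ (λ x y → δ i r ℤ.* (1ℤ ℤ.* x ℤ.+ -1ℤ ℤ.* y)) (sumℤ-δ-1 j) (sumℤ-δ-1 j′) ⟩
  δ i r ℤ.* 0ℤ  ≡⟨ ℤₚ.*-zeroʳ (δ i r) ⟩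
  0ℤ ∎
  where
  open ≡-Reasoning
  as-linear : ∀ x y → x ℤ.- y ≡ 1ℤ ℤ.* x ℤ.+ -1ℤ ℤ.* y
  as-linear = solve-∀

turn-col : ∀ (i j j′ l : Fin dim) → sumℤ (λ r → turn i j j′ r l) ≡ δ j l ℤ.- δ j′ l
turn-col i j j′ l = sumℤ-δ i (λ _ → δ j l ℤ.- δ j′ l)

-- Closing a chain adds -1 in the column where it started, so the entries of that column are kept
-- among 0 and 1; elsewhere -1 is allowed as well.
data Unit₀ : ℤ → Set where
  zero : Unit₀ 0ℤ
  one  : Unit₀ 1ℤ

data Trit : ℤ → Set where
  minus : Trit -1ℤ
  unit₀ : ∀ {x} → Unit₀ x → Trit x

trit-product : ∀ {x y} → Trit x → Trit y → 0ℤ ℤ.≤ 1ℤ ℤ.+ x ℤ.* y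
trit-product minus        minus        = +≤+ z≤n
trit-product minus        (unit₀ zero) = +≤+ z≤n
trit-product minus        (unit₀ one)  = +≤+ z≤n
trit-product (unit₀ zero) minus        = +≤+ z≤n
trit-product (unit₀ zero) (unit₀ zero) = +≤+ z≤n
trit-product (unit₀ zero) (unit₀ one)  = +≤+ z≤n
trit-product (unit₀ one)  minus        = +≤+ z≤n
trit-product (unit₀ one)  (unit₀ zero) = +≤+ z≤n
trit-product (unit₀ one)  (unit₀ one)  = +≤+ z≤n

-- Alternating cycles in a set of matrix positions

module _ (F : Fin dim → Fin dim → Set) where

  record Flow (X : Fin dim → Fin dim → ℤ) : Set where
    field
      trit    : ∀ r l → Trit (X r l)
      support : ∀ r l → X r l ≢ 0ℤ → F r l
      rowSums : ∀ r → sumℤ (X r) ≡ 0ℤ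

  zeroFlow : Flow λ _ _ → 0ℤ
  zeroFlow = record { trit = λ _ _ → unit₀ zero ; support = λ _ _ 0≢0 → contradiction refl 0≢0
                    ; rowSums = λ _ → sumℤ-zero {dim} λ _ → refl }

  -- c is the column where the chain X starts, j the one where it ends, having
  -- entered it in row p; in column c the chain is +1 at the row where it left.
  record Chain (visited : Subset dim) (p j c : Fin dim) (X : Fin dim → Fin dim → ℤ) : Set where
    field
      flow    : Flow X
      colSums : ∀ l → sumℤ (λ r → X r l) ≡ δ c l ℤ.- δ j l
      outside : ∀ r l → l Subset.∉ visited → X r l ≡ 0ℤ
      end     : ∀ r → r ≢ p → X r j ≡ 0ℤ
      start   : (c ≡ j × (∀ r l → X r l ≡ 0ℤ)) ⊎ (c ≢ j × (∀ r → Unit₀ (X r c)))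

  module _ {i j j′ : Fin dim} (j′≢j : j′ ≢ j) where

    turn-leave : turn i j j′ i j ≡ 1ℤ
    turn-leave = cong₂ ℤ._*_ (δ-refl i) (cong₂ ℤ._-_ (δ-refl j) (δ-≢ j′≢j))

    turn-arrive : turn i j j′ i j′ ≡ -1ℤ
    turn-arrive = cong₂ ℤ._*_ (δ-refl i) (cong₂ ℤ._-_ (δ-≢ (j′≢j ∘ sym)) (δ-refl j′))

    turn-column : ∀ {r l} → l ≢ j → l ≢ j′ → turn i j j′ r l ≡ 0ℤ
    turn-column {r} l≢j l≢j′ = trans
      (cong (δ i r ℤ.*_) (cong₂ ℤ._-_ (δ-≢ (l≢j ∘ sym)) (δ-≢ (l≢j′ ∘ sym)))) (ℤₚ.*-zeroʳ (δ i r))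

    turn-row′ : ∀ {r l} → r ≢ i → turn i j j′ r l ≡ 0ℤ
    turn-row′ {r} {l} r≢i = trans (cong (ℤ._* (δ j l ℤ.- δ j′ l)) (δ-≢ (r≢i ∘ sym))) (ℤₚ.*-zeroˡ (δ j l ℤ.- δ j′ l))

    -- Appending a turn changes two entries only: `X i j` rises from 0 to 1, and `X i j′`, which is
    -- 0 or 1, drops by 1. Hence all entries stay among -1, 0 and 1.
    module Extend {X} (flow : Flow X) (leave : X i j ≡ 0ℤ) (arrive : Unit₀ (X i j′)) (Fij : F i j) (Fij′ : F i j′) where
      open Flow flow

      X⁺ : Fin dim → Fin dim → ℤ
      X⁺ r l = X r l ℤ.+ turn i j j′ r l

      same : ∀ {r l} → turn i j j′ r l ≡ 0ℤ → X⁺ r l ≡ X r l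
      same {r} {l} eq = trans (cong (ℤ._+_ (X r l)) eq) (ℤₚ.+-identityʳ (X r l))

      at-leave : X⁺ i j ≡ 1ℤ
      at-leave = cong₂ ℤ._+_ leave turn-leave

      private
        lower : ∀ {x} → Unit₀ x → Trit (x ℤ.+ -1ℤ)
        lower zero = minus
        lower one  = unit₀ zero

      trit⁺ : ∀ r l → Trit (X⁺ r l)
      trit⁺ r l with r Finₚ.≟ i
      ... | no r≢i = subst Trit (sym (same (turn-row′ r≢i))) (trit r l)
      ... | yes refl with l Finₚ.≟ j
      ...   | yes refl = subst Trit (sym at-leave) (unit₀ one)
      ...   | no l≢j with l Finₚ.≟ j′
      ...     | yes refl = subst Trit (cong (ℤ._+_ (X i j′)) (sym turn-arrive)) (lower arrive)
      ...     | no l≢j′  = subst Trit (sym (same (turn-column l≢j l≢j′))) (trit r l)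

      support⁺ : ∀ r l → X⁺ r l ≢ 0ℤ → F r l
      support⁺ r l X≢0 with r Finₚ.≟ i
      ... | no r≢i = support r l (X≢0 ∘ trans (same (turn-row′ r≢i)))
      ... | yes refl with l Finₚ.≟ j
      ...   | yes refl = Fij
      ...   | no l≢j with l Finₚ.≟ j′
      ...     | yes refl = Fij′
      ...     | no l≢j′  = support r l (X≢0 ∘ trans (same (turn-column l≢j l≢j′)))

      rowSums⁺ : ∀ r → sumℤ (X⁺ r) ≡ 0ℤ
      rowSums⁺ r = trans (Σℤ.∑-distrib-+ (X r) (turn i j j′ r)) (cong₂ ℤ._+_ (rowSums r) (turn-row i j j′ r))

      flow⁺ : Flow X⁺
      flow⁺ = record { trit = trit⁺ ; support = support⁺ ; rowSums = rowSums⁺ }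

      colSums⁺ : ∀ {y} l → sumℤ (λ r → X r l) ≡ y → sumℤ (λ r → X⁺ r l) ≡ y ℤ.+ (δ j l ℤ.- δ j′ l)
      colSums⁺ l eq = trans (Σℤ.∑-distrib-+ (λ r → X r l) (λ r → turn i j j′ r l))
                            (cong₂ ℤ._+_ eq (turn-col i j j′ l))

  record AlternatingCycle : Set where
    field
      X       : Fin dim → Fin dim → ℤ
      flow    : Flow X
      colSums : ∀ l → sumℤ (λ r → X r l) ≡ 0ℤ
      nonzero : ∃[ r ] ∃[ l ] X r l ≢ 0ℤ

  module _ (otherInRow : ∀ {i j} → F i j → ∃[ j′ ] j′ ≢ j × F i j′)
           (otherInCol : ∀ {i j} → F i j → ∃[ i′ ] i′ ≢ i × F i′ j) where

    private
      -- It is not known in advance to which column the walk returns, so a chain from every visited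
      -- column to the current one is carried along; on return to j′ the chain that started there
      -- closes up. Every other step visits a new column, so `fuel` plus the number of visited
      -- columns stays above `dim`.
      walk : ∀ fuel (visited : Subset dim) {p j} → F p j → j Subset.∈ visited → dim ℕ.< fuel + Subset.∣ visited ∣ →
             (X : Fin dim → Fin dim → Fin dim → ℤ) → (∀ c → c Subset.∈ visited → Chain visited p j c (X c)) →
             AlternatingCycle
      walk zero visited _ _ dim<n _ _ = contradiction (Subsetₚ.∣p∣≤n visited) (ℕₚ.<⇒≱ dim<n)
      walk (suc fuel) visited {p} {j} Fpj j∈ dim<n X chain
        with i , i≢p , Fij ← otherInCol Fpj
        with j′ , j′≢j , Fij′ ← otherInRow Fij
        with j′ Subsetₚ.∈? visited
      ... | yes j′∈ = record
        { X = X⁺ ; flow = flow⁺ ; colSums = λ l → trans (colSums⁺ l (colSums l)) (cancel (δ j′ l) (δ j l))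
        ; nonzero = i , j , λ eq → case trans (sym at-leave) eq of λ () }
        where
        open Chain (chain j′ j′∈)
        arrive′ : Unit₀ (X j′ i j′)
        arrive′ with start
        ... | inj₁ (j′≡j , _) = contradiction j′≡j j′≢j
        ... | inj₂ (_ , unit) = unit i
        open Extend j′≢j flow (end i i≢p) arrive′ Fij Fij′
        cancel : ∀ x y → x ℤ.- y ℤ.+ (y ℤ.- x) ≡ 0ℤ
        cancel = solve-∀
      ... | no j′∉ = walk fuel visited′ Fij′ j′∈′ fuel′ X′ chain′
        where
        visited′ : Subset dim
        visited′ = visited Subset.∪ ⁅ j′ ⁆

        j′∈′ : j′ Subset.∈ visited′
        j′∈′ = Subsetₚ.q⊆p∪q visited ⁅ j′ ⁆ (Subsetₚ.x∈⁅x⁆ j′)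

        grows : Subset.∣ visited ∣ ℕ.< Subset.∣ visited′ ∣
        grows = Subsetₚ.p⊂q⇒∣p∣<∣q∣ (Subsetₚ.p⊆p∪q ⁅ j′ ⁆ , j′ , j′∈′ , j′∉)

        fuel′ : dim ℕ.< fuel + Subset.∣ visited′ ∣
        fuel′ = ℕₚ.≤-trans dim<n (ℕₚ.≤-trans (ℕₚ.≤-reflexive (sym (ℕₚ.+-suc fuel Subset.∣ visited ∣)))
                                           (ℕₚ.+-monoʳ-≤ fuel grows))

        X′ : Fin dim → Fin dim → Fin dim → ℤ
        X′ c r l with c Finₚ.≟ j′
        ... | yes _ = 0ℤ
        ... | no  _ = X c r l ℤ.+ turn i j j′ r l

        old : ∀ {c} → c Subset.∈ visited′ → c ≢ j′ → c Subset.∈ visited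
        old c∈ c≢j′ with Subsetₚ.x∈p∪q⁻ visited ⁅ j′ ⁆ c∈
        ... | inj₁ c∈v = c∈v
        ... | inj₂ c∈s = contradiction (Subsetₚ.x∈⁅y⁆⇒x≡y j′ c∈s) c≢j′

        chain′ : ∀ c → c Subset.∈ visited′ → Chain visited′ i j′ c (X′ c)
        chain′ c c∈ with c Finₚ.≟ j′
        ... | yes refl = record
          { flow = zeroFlow
          ; colSums = λ l → trans (sumℤ-zero {dim} λ _ → refl) (sym (ℤₚ.+-inverseʳ (δ j′ l)))
          ; outside = λ _ _ _ → refl ; end = λ _ _ → refl ; start = inj₁ (refl , λ _ _ → refl) }
        ... | no c≢j′ = record
          { flow = flow⁺
          ; colSums = λ l → trans (colSums⁺ l (colSums l)) (telescope (δ c l) (δ j l) (δ j′ l))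
          ; outside = λ r l l∉ → trans (same (turn-column {i = i} j′≢j {r} (λ { refl → l∉ (Subsetₚ.p⊆p∪q ⁅ j′ ⁆ j∈) }) λ { refl → l∉ j′∈′ }))
                                       (outside r l (l∉ ∘ Subsetₚ.p⊆p∪q ⁅ j′ ⁆))
          ; end = λ r r≢i → trans (same (turn-row′ j′≢j r≢i)) (outside r j′ j′∉)
          ; start = inj₂ (c≢j′ , start⁺ (c Finₚ.≟ j)) }
          where
          open Chain (chain c (old c∈ c≢j′))
          open Extend j′≢j flow (end i i≢p) (subst Unit₀ (sym (outside i j′ j′∉)) zero) Fij Fij′
          telescope : ∀ x y z → x ℤ.- y ℤ.+ (y ℤ.- z) ≡ x ℤ.- z
          telescope = solve-∀
          start⁺ : Dec (c ≡ j) → ∀ r → Unit₀ (X⁺ r c)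
          start⁺ (no c≢j) r with start
          ... | inj₁ (c≡j , _)  = contradiction c≡j c≢j
          ... | inj₂ (_ , unit) = subst Unit₀ (sym (same (turn-column {i = i} j′≢j {r} c≢j c≢j′))) (unit r)
          start⁺ (yes refl) r with start
          ... | inj₂ (c≢j , _)  = contradiction refl c≢j
          ... | inj₁ (_ , X≗0) with r Finₚ.≟ i
          ...   | yes refl = subst Unit₀ (sym at-leave) one
          ...   | no r≢i   = subst Unit₀ (sym (trans (same (turn-row′ j′≢j r≢i)) (X≗0 r j))) zero

    alternatingCycle : ∀ {i j} → F i j → AlternatingCycle
    alternatingCycle {i} {j} Fij = walk (suc dim) ⁅ j ⁆ Fij (Subsetₚ.x∈⁅x⁆ j) (ℕₚ.m≤m+n (suc dim) Subset.∣ ⁅ j ⁆ ∣)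
      (λ _ _ _ → 0ℤ) λ c c∈ → record
        { flow = zeroFlow
        ; colSums = λ l → trans (sumℤ-zero {dim} λ _ → refl)
            (sym (trans (cong (λ c → δ c l ℤ.- δ j l) (Subsetₚ.x∈⁅y⁆⇒x≡y j c∈)) (ℤₚ.+-inverseʳ (δ j l))))
        ; outside = λ _ _ _ → refl ; end = λ _ _ → refl
        ; start = inj₁ (Subsetₚ.x∈⁅y⁆⇒x≡y j c∈ , λ _ _ → refl) }

*-nonneg : ∀ {i j} → 0ℤ ℤ.≤ i → 0ℤ ℤ.≤ j → 0ℤ ℤ.≤ i ℤ.* j
*-nonneg {i} {+ n} 0≤i (+≤+ _) = ℤₚ.*-monoʳ-≤-nonNeg (+ n) 0≤i

square-nonneg : ∀ i → 0ℤ ℤ.≤ i ℤ.* i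
square-nonneg (+ n)    = *-nonneg {+ n} {+ n} (+≤+ z≤n) (+≤+ z≤n)
square-nonneg -[1+ n ] = +≤+ z≤n

square-pos : ∀ {i} → i ≢ 0ℤ → 0ℤ ℤ.< i ℤ.* i
square-pos {i} i≢0 = ℤₚ.≤∧≢⇒< (square-nonneg i) λ 0≡i² →
  case ℤₚ.i*j≡0⇒i≡0∨j≡0 i (sym 0≡i²) of λ { (inj₁ i≡0) → i≢0 i≡0 ; (inj₂ i≡0) → i≢0 i≡0 }

<suc⇒≤ : ∀ {i n} → i ℤ.< + suc n → i ℤ.≤ + n
<suc⇒≤ (+<+ (s≤s m≤n)) = +≤+ m≤n
<suc⇒≤ -<+             = -≤+

-- Rounding a matrix with line sums k to a multiple of a permutation matrix

module Rounding (k : ℤ) (0<k : 0ℤ ℤ.< k) where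

  Fractional : (Fin dim → Fin dim → ℤ) → Fin dim → Fin dim → Set
  Fractional M i j = 0ℤ ℤ.< M i j × M i j ℤ.< k

  fractional? : ∀ (M : Fin dim → Fin dim → ℤ) i j → Dec (Fractional M i j)
  fractional? M i j = 0ℤ ℤₚ.<? M i j ×-dec M i j ℤₚ.<? k

  -- If all other entries of the line vanished, its sum would be `f i`, which is below k. A second
  -- positive entry is itself below k because `f i` takes a positive share of the sum.
  otherFractional : ∀ {n} {f : Fin n → ℤ} → (∀ i → 0ℤ ℤ.≤ f i) → sumℤ f ≡ k →
                    ∀ {i} → 0ℤ ℤ.< f i × f i ℤ.< k → ∃[ j ] j ≢ i × 0ℤ ℤ.< f j × f j ℤ.< k
  otherFractional {f = f} 0≤f sum≡k {i} (0<fi , fi<k) with Finₚ.any? (λ j → ¬? (j Finₚ.≟ i) ×-dec 0ℤ ℤₚ.<? f j)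
  ... | yes (j , j≢i , 0<fj) = j , j≢i , 0<fj ,
    ℤₚ.<-≤-trans (subst (ℤ._< f i ℤ.+ f j) (ℤₚ.+-identityˡ (f j)) (ℤₚ.+-monoˡ-< (f j) 0<fi))
                 (subst (f i ℤ.+ f j ℤ.≤_) sum≡k (two-terms≤sumℤ 0≤f (j≢i ∘ sym)))
  ... | no ¬other = contradiction (trans (sym sum≡fi) sum≡k) (ℤₚ.<⇒≢ fi<k)
    where
    only : ∀ j → f j ≡ δ i j ℤ.* f j
    only j with j Finₚ.≟ i
    ... | yes refl = sym (trans (cong (ℤ._* f i) (δ-refl i)) (ℤₚ.*-identityˡ (f i)))
    ... | no j≢i   = trans (ℤₚ.≤-antisym (ℤₚ.≮⇒≥ λ 0<fj → ¬other (j , j≢i , 0<fj)) (0≤f j))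
                           (sym (trans (cong (ℤ._* f j) (δ-≢ (j≢i ∘ sym))) (ℤₚ.*-zeroˡ (f j))))
    sum≡fi : sumℤ f ≡ f i
    sum≡fi = trans (Σℤ.sum-cong-≗ only) (sumℤ-δ i f)

  term : (M : Fin dim → Fin dim → ℤ) → Fin dim → Fin dim → ℤ
  term M i j = M i j ℤ.* (k ℤ.- M i j)

  total : (Fin dim → Fin dim → ℤ) → ℤ
  total f = sumℤ λ i → sumℤ (f i)

  NonNegative : (Fin dim → Fin dim → ℤ) → Set
  NonNegative M = ∀ i j → 0ℤ ℤ.≤ M i j

  Supported : (M : Fin dim → Fin dim → ℤ) → Set
  Supported {dim} M = Σ[ P ∈ Matrix dim ] Magic 1 P × (∀ i j → entry P i j ≢ 0 → M i j ≢ 0ℤ)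

  module _ {M : Fin dim → Fin dim → ℤ} (0≤M : NonNegative M) (sums : LineSums k M) where

    entry≤k : ∀ i j → M i j ℤ.≤ k
    entry≤k i j = subst (M i j ℤ.≤_) (proj₁ sums i) (term≤sumℤ (0≤M i) j)

    total-nonneg : 0ℤ ℤ.≤ total (term M)
    total-nonneg = sumℤ-nonneg λ i → sumℤ-nonneg λ j → *-nonneg (0≤M i j) (ℤₚ.i≤j⇒0≤j-i (entry≤k i j))

    -- Every entry is then 0 or k, so M is k times a 0-1 matrix, and cancelling k in the line sums
    -- makes that matrix a permutation matrix.
    integral : (∀ i j → ¬ Fractional M i j) → Supported M
    integral ¬frac = P , lineSums⇒magic ((λ i → normalise (λ j → scaled i j) (proj₁ sums i)) ,
                                        (λ j → normalise (λ i → scaled i j) (proj₂ sums j))) , support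
      where
      indicator : ∀ {x : ℤ} → Dec (x ≡ 0ℤ) → ℕ
      indicator (yes _) = 0
      indicator (no _)  = 1
      P : Matrix dim
      P = fromEntries λ i j → indicator (M i j ℤₚ.≟ 0ℤ)
      scaled : ∀ i j → k ℤ.* ⟪ P ⟫ i j ≡ M i j
      scaled i j rewrite entry-fromEntries (λ i j → indicator (M i j ℤₚ.≟ 0ℤ)) i j with M i j ℤₚ.≟ 0ℤ
      ... | yes M≡0 = trans (ℤₚ.*-zeroʳ k) (sym M≡0)
      ... | no  M≢0 = trans (ℤₚ.*-identityʳ k) (ℤₚ.≤-antisym
        (ℤₚ.≮⇒≥ λ M<k → ¬frac i j (ℤₚ.≤∧≢⇒< (0≤M i j) (M≢0 ∘ sym) , M<k)) (entry≤k i j))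
      normalise : ∀ {n} {f g : Fin n → ℤ} → (∀ i → k ℤ.* f i ≡ g i) → sumℤ g ≡ k → sumℤ f ≡ + 1
      normalise {f = f} {g} eq sum≡k = ℤₚ.*-cancelˡ-≡ k (sumℤ f) (+ 1) {{ℤ.≢-nonZero (ℤₚ.<⇒≢ 0<k ∘ sym)}} (begin
        k ℤ.* sumℤ f  ≡⟨ Σℤ.*-distribˡ-sum k f ⟩
        sumℤ (λ i → k ℤ.* f i)  ≡⟨ Σℤ.sum-cong-≗ eq ⟩
        sumℤ g  ≡⟨ sum≡k ⟩
        k  ≡⟨ ℤₚ.*-identityʳ k ⟨
        k ℤ.* + 1  ∎)
        where open ≡-Reasoning
      support : ∀ i j → entry P i j ≢ 0 → M i j ≢ 0ℤ
      support i j P≢0 rewrite entry-fromEntries (λ i j → indicator (M i j ℤₚ.≟ 0ℤ)) i j with M i j ℤₚ.≟ 0ℤ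
      ... | yes _   = contradiction refl P≢0
      ... | no  M≢0 = M≢0

    cycle : ∀ {i j} → Fractional M i j → AlternatingCycle (Fractional M)
    cycle = alternatingCycle (Fractional M)
      (λ {i} → otherFractional (0≤M i) (proj₁ sums i))
      (λ {_} {j} → otherFractional (λ i → 0≤M i j) (proj₂ sums j))

    -- Moving by ±X keeps M a non-negative matrix with the same line sums; as
    -- x(k − x) is strictly concave, one of the two moves decreases its total.
    module Move (Z : AlternatingCycle (Fractional M)) where
      open AlternatingCycle Z
      open Flow flow

      M± : ℤ → Fin dim → Fin dim → ℤ
      M± s i j = 1ℤ ℤ.* M i j ℤ.+ s ℤ.* X i j

      sums± : ∀ s → LineSums k (M± s)
      sums± s = lineSums-cong (simplify k s) (λ _ _ → refl) (lineSums-linear 1ℤ s sums (rowSums , colSums))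
        where
        simplify : ∀ k s → 1ℤ ℤ.* k ℤ.+ s ℤ.* 0ℤ ≡ k
        simplify = solve-∀

      support± : ∀ s i j → M± s i j ≢ 0ℤ → M i j ≢ 0ℤ
      support± s i j M±≢0 M≡0 with X i j ℤₚ.≟ 0ℤ
      ... | yes X≡0 = M±≢0 (trans (cong₂ (λ x y → 1ℤ ℤ.* x ℤ.+ s ℤ.* y) M≡0 X≡0) (cong (ℤ._+_ 0ℤ) (ℤₚ.*-zeroʳ s)))
      ... | no  X≢0 = ℤₚ.<⇒≢ (proj₁ (support i j X≢0)) (sym M≡0)

      nonneg± : ∀ {s} → Trit s → ∀ i j → 0ℤ ℤ.≤ M± s i j
      nonneg± {s} ts i j with X i j ℤₚ.≟ 0ℤ
      ... | yes X≡0 = subst (0ℤ ℤ.≤_) (sym (trans (cong (λ x → 1ℤ ℤ.* M i j ℤ.+ s ℤ.* x) X≡0) (simplify (M i j) s))) (0≤M i j)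
        where
        simplify : ∀ x s → 1ℤ ℤ.* x ℤ.+ s ℤ.* 0ℤ ≡ x
        simplify = solve-∀
      -- X lives on fractional entries, so M i j - 1 and 1 + s X i j are both non-negative; the new
      -- entry is their sum.
      ... | no  X≢0 = subst (0ℤ ℤ.≤_) (regroup (M i j) (s ℤ.* X i j))
          (ℤₚ.+-mono-≤ (ℤₚ.i≤j⇒0≤j-i (ℤₚ.i<j⇒suc[i]≤j (proj₁ (support i j X≢0)))) (trit-product ts (trit i j)))
        where
        regroup : ∀ x y → x ℤ.- 1ℤ ℤ.+ (1ℤ ℤ.+ y) ≡ 1ℤ ℤ.* x ℤ.+ y
        regroup = solve-∀

      square : Fin dim → Fin dim → ℤ
      square i j = X i j ℤ.* X i j

      squares-pos : 0ℤ ℤ.< total square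
      squares-pos with i , j , X≢0 ← nonzero = ℤₚ.<-≤-trans (square-pos X≢0)
        (ℤₚ.≤-trans (term≤sumℤ (λ j → square-nonneg (X i j)) j)
                    (term≤sumℤ (λ i → sumℤ-nonneg λ j → square-nonneg (X i j)) i))

      total-linear : ∀ a b (f g : Fin dim → Fin dim → ℤ) →
                     total (λ i j → a ℤ.* f i j ℤ.+ b ℤ.* g i j) ≡ a ℤ.* total f ℤ.+ b ℤ.* total g
      total-linear a b f g = trans (Σℤ.sum-cong-≗ λ i → sumℤ-linear a b (f i) (g i))
                                   (sumℤ-linear a b (λ i → sumℤ (f i)) (λ i → sumℤ (g i)))

      -- The second difference of x (k - x) with step X is -2 X².
      concave : 1ℤ ℤ.* total (term (M± 1ℤ)) ℤ.+ 1ℤ ℤ.* total (term (M± -1ℤ)) ≡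
                + 2 ℤ.* total (term M) ℤ.+ -[1+ 1 ] ℤ.* total square
      concave = begin
        1ℤ ℤ.* total (term (M± 1ℤ)) ℤ.+ 1ℤ ℤ.* total (term (M± -1ℤ))
          ≡⟨ total-linear 1ℤ 1ℤ (term (M± 1ℤ)) (term (M± -1ℤ)) ⟨
        total (λ i j → 1ℤ ℤ.* term (M± 1ℤ) i j ℤ.+ 1ℤ ℤ.* term (M± -1ℤ) i j)
          ≡⟨ Σℤ.sum-cong-≗ (λ i → Σℤ.sum-cong-≗ λ j → identity (M i j) (X i j) k) ⟩
        total (λ i j → + 2 ℤ.* term M i j ℤ.+ -[1+ 1 ] ℤ.* square i j)
          ≡⟨ total-linear (+ 2) -[1+ 1 ] (term M) square ⟩
        + 2 ℤ.* total (term M) ℤ.+ -[1+ 1 ] ℤ.* total square ∎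
        where
        open ≡-Reasoning
        identity : ∀ m x k → 1ℤ ℤ.* ((1ℤ ℤ.* m ℤ.+ 1ℤ ℤ.* x) ℤ.* (k ℤ.- (1ℤ ℤ.* m ℤ.+ 1ℤ ℤ.* x))) ℤ.+
                             1ℤ ℤ.* ((1ℤ ℤ.* m ℤ.+ -1ℤ ℤ.* x) ℤ.* (k ℤ.- (1ℤ ℤ.* m ℤ.+ -1ℤ ℤ.* x))) ≡
                             + 2 ℤ.* (m ℤ.* (k ℤ.- m)) ℤ.+ -[1+ 1 ] ℤ.* (x ℤ.* x)
        identity = solve-∀

      decreasing : ∃[ s ] Trit s × total (term (M± s)) ℤ.< total (term M)
      decreasing with total (term (M± 1ℤ)) ℤₚ.<? total (term M) | total (term (M± -1ℤ)) ℤₚ.<? total (term M)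
      ... | yes lt | _     = 1ℤ , unit₀ one , lt
      ... | _     | yes lt = -1ℤ , minus , lt
      ... | no ≮₁ | no ≮₂ = contradiction squares-pos (ℤₚ.≤⇒≯ (ℤₚ.*-cancelˡ-≤-pos (total square) 0ℤ (+ 2) (begin
          + 2 ℤ.* total square
            ≡⟨ rearrange (total (term M)) (total square) ⟩
          + 2 ℤ.* total (term M) ℤ.- (+ 2 ℤ.* total (term M) ℤ.+ -[1+ 1 ] ℤ.* total square)
            ≡⟨ cong (λ x → + 2 ℤ.* total (term M) ℤ.- x) concave ⟨
          + 2 ℤ.* total (term M) ℤ.- (1ℤ ℤ.* total (term (M± 1ℤ)) ℤ.+ 1ℤ ℤ.* total (term (M± -1ℤ)))
            ≡⟨ regroup (total (term M)) (total (term (M± 1ℤ))) (total (term (M± -1ℤ))) ⟩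
          (total (term M) ℤ.- total (term (M± 1ℤ))) ℤ.+ (total (term M) ℤ.- total (term (M± -1ℤ)))
            ≤⟨ ℤₚ.+-mono-≤ (ℤₚ.i≤j⇒i-j≤0 (ℤₚ.≮⇒≥ ≮₁)) (ℤₚ.i≤j⇒i-j≤0 (ℤₚ.≮⇒≥ ≮₂)) ⟩
          0ℤ ∎)))
        where
        open ℤₚ.≤-Reasoning
        rearrange : ∀ t s → + 2 ℤ.* s ≡ + 2 ℤ.* t ℤ.- (+ 2 ℤ.* t ℤ.+ -[1+ 1 ] ℤ.* s)
        rearrange = solve-∀
        regroup : ∀ t a b → + 2 ℤ.* t ℤ.- (1ℤ ℤ.* a ℤ.+ 1ℤ ℤ.* b) ≡ (t ℤ.- a) ℤ.+ (t ℤ.- b)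
        regroup = solve-∀

  -- The total is a non-negative integer that every move decreases, so n bounds the number of moves.
  -- A move never enlarges the support, hence a permutation matrix supported in the final matrix is
  -- supported in M.
  supported : ∀ n {M : Fin dim → Fin dim → ℤ} → NonNegative M → LineSums k M → total (term M) ℤ.< + n → Supported M
  supported zero    0≤M sums total<n = contradiction (total-nonneg 0≤M sums) (ℤₚ.<⇒≱ total<n)
  supported (suc n) {M} 0≤M sums total<n
    with Finₚ.any? (λ i → Finₚ.any? (fractional? M i))
  ... | no ¬frac = integral 0≤M sums λ i j f → ¬frac (i , j , f)
  ... | yes (_ , _ , frac)
    with Z ← cycle 0≤M sums frac
    with s , ts , lt ← Move.decreasing 0≤M sums Z
    with P , magic , support ← supported n (Move.nonneg± 0≤M sums Z ts) (Move.sums± 0≤M sums Z s)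
                                 (ℤₚ.<-≤-trans lt (<suc⇒≤ total<n))
    = P , magic , λ i j P≢0 → Move.support± 0≤M sums Z s i j (support i j P≢0)

birkhoff : ∀ {k} {M : Fin dim → Fin dim → ℤ} → 0ℤ ℤ.< k → (∀ i j → 0ℤ ℤ.≤ M i j) → LineSums k M →
           Σ[ P ∈ Matrix dim ] Magic 1 P × (∀ i j → entry P i j ≢ 0 → M i j ≢ 0ℤ)
birkhoff {k = k} {M} 0<k 0≤M sums = supported (suc ℤ.∣ total (term M) ∣) 0≤M sums
  (ℤₚ.≤-<-trans (ℤₚ.≤-reflexive (sym (ℤₚ.0≤i⇒+∣i∣≡i (total-nonneg 0≤M sums)))) (+<+ ℕₚ.≤-refl))
  where
  open Rounding k 0<k

-- Integer vectors in lexicographic order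

data Sgn : Set where
  neg nil pos : Sgn

opp : Sgn → Sgn
opp neg = pos
opp nil = nil
opp pos = neg

sgnℤ : ℤ → Sgn
sgnℤ (+ zero)  = nil
sgnℤ (+ suc _) = pos
sgnℤ -[1+ _ ]  = neg

-- The first non-zero coordinate decides: later coordinates are infinitesimal relative to earlier
-- ones.
sgn : Vec ℤ len → Sgn
sgn []             = nil
sgn (+ zero  ∷ v) = sgn v
sgn (+ suc _ ∷ v) = pos
sgn (-[1+ _ ] ∷ v) = neg

nil? : (s : Sgn) → Dec (s ≡ nil)
nil? neg = no λ ()
nil? nil = yes refl
nil? pos = no λ ()

neg? : (s : Sgn) → Dec (s ≡ neg)
neg? neg = yes refl
neg? nil = no λ ()
neg? pos = no λ ()

sgn-nil : ∀ (v : Vec ℤ len) → sgn v ≡ nil → ∀ i → Vec.lookup v i ≡ 0ℤ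
sgn-nil (+ zero ∷ v) eq zero    = refl
sgn-nil (+ zero ∷ v) eq (suc i) = sgn-nil v eq i

nil-sgn : ∀ (v : Vec ℤ len) → (∀ i → Vec.lookup v i ≡ 0ℤ) → sgn v ≡ nil
nil-sgn []      eq = refl
nil-sgn (x ∷ v) eq with refl ← eq zero = nil-sgn v (eq ∘ suc)

_⊖_ : Vec ℤ len → Vec ℤ len → Vec ℤ len
_⊖_ = Vec.zipWith ℤ._-_

-- The sign of a sum as far as the signs of the summands determine it; only a pair of opposite signs
-- has no constructor.
data Add : Sgn → Sgn → Sgn → Set where
  nilˡ : ∀ {s} → Add nil s s
  nilʳ : ∀ {s} → Add s nil s
  same : ∀ {s} → Add s s s

private
  add-pos : ∀ {s t} → Add s pos t → pos ≡ t
  add-pos nilˡ = refl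
  add-pos same = refl

  add-neg : ∀ {s t} → Add s neg t → neg ≡ t
  add-neg nilˡ = refl
  add-neg same = refl

  pos-add : ∀ {s t} → Add pos s t → pos ≡ t
  pos-add nilʳ = refl
  pos-add same = refl

  neg-add : ∀ {s t} → Add neg s t → neg ≡ t
  neg-add nilʳ = refl
  neg-add same = refl

  sgn-+ : ∀ {s} x y (u v : Vec ℤ len) → Add (sgn (x ∷ u)) (sgn (y ∷ v)) s →
          (Add (sgn u) (sgn v) s → sgn (Vec.zipWith ℤ._+_ u v) ≡ s) →
          sgn (x ℤ.+ y ∷ Vec.zipWith ℤ._+_ u v) ≡ s
  sgn-+ (+ zero)  (+ zero)  u v a rec = rec a
  sgn-+ (+ zero)  (+ suc _) u v a rec = add-pos a
  sgn-+ (+ zero)  -[1+ _ ]  u v a rec = add-neg a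
  sgn-+ (+ suc _) (+ zero)  u v a rec = pos-add a
  sgn-+ (+ suc _) (+ suc _) u v a rec = pos-add a
  sgn-+ -[1+ _ ]  (+ zero)  u v a rec = neg-add a
  sgn-+ -[1+ _ ]  -[1+ _ ]  u v a rec = neg-add a

sgn-add : ∀ (u v : Vec ℤ len) {s} → Add (sgn u) (sgn v) s → sgn (Vec.zipWith ℤ._+_ u v) ≡ s
sgn-add []      []      nilˡ = refl
sgn-add []      []      nilʳ = refl
sgn-add []      []      same = refl
sgn-add (x ∷ u) (y ∷ v) a = sgn-+ x y u v a (sgn-add u v)

⊖-telescope : ∀ (u v w : Vec ℤ len) → Vec.zipWith ℤ._+_ (u ⊖ v) (v ⊖ w) ≡ u ⊖ w
⊖-telescope []      []      []      = refl
⊖-telescope (x ∷ u) (y ∷ v) (z ∷ w) = cong₂ _∷_ (telescope x y z) (⊖-telescope u v w)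
  where
  telescope : ∀ x y z → x ℤ.- y ℤ.+ (y ℤ.- z) ≡ x ℤ.- z
  telescope = solve-∀

sgn-swap : ∀ (u v : Vec ℤ len) → sgn (v ⊖ u) ≡ opp (sgn (u ⊖ v))
sgn-swap []      []      = refl
sgn-swap (x ∷ u) (y ∷ v) = trans (cong (λ z → sgn (z ∷ (v ⊖ u))) (swap x y)) (flip (x ℤ.- y))
  where
  swap : ∀ x y → y ℤ.- x ≡ ℤ.- (x ℤ.- y)
  swap = solve-∀
  flip : ∀ z → sgn (ℤ.- z ∷ (v ⊖ u)) ≡ opp (sgn (z ∷ (u ⊖ v)))
  flip (+ zero)  = sgn-swap u v
  flip (+ suc _) = refl
  flip -[1+ _ ]  = refl

𝟎 : Vec ℤ len
𝟎 = Vec.replicate _ 0ℤ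

⊖-𝟎 : (u : Vec ℤ len) → u ⊖ 𝟎 ≡ u
⊖-𝟎 []      = refl
⊖-𝟎 (x ∷ u) = cong₂ _∷_ (ℤₚ.+-identityʳ x) (⊖-𝟎 u)

data Orientation : Set where
  ⁺ ⁻ : Orientation

orient : Orientation → Sgn → Sgn
orient ⁺ s = s
orient ⁻ s = opp s

private
  opp-involutive : ∀ s → opp (opp s) ≡ s
  opp-involutive neg = refl
  opp-involutive nil = refl
  opp-involutive pos = refl

  opp-add : ∀ {a b s} → Add a b s → Add (opp a) (opp b) (opp s)
  opp-add nilˡ = nilˡ
  opp-add nilʳ = nilʳ
  opp-add same = same

  orient-nil : ∀ o s → orient o s ≡ nil → s ≡ nil
  orient-nil ⁺ s   eq = eq
  orient-nil ⁻ nil eq = refl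

  orient-opp : ∀ o s → orient o (opp s) ≡ opp (orient o s)
  orient-opp ⁺ s = refl
  orient-opp ⁻ s = refl

  orient-involutive : ∀ o s → orient o (orient o s) ≡ s
  orient-involutive ⁺ s = refl
  orient-involutive ⁻ s = opp-involutive s

  orient-add : ∀ o {a b s} → Add a b s → Add (orient o a) (orient o b) (orient o s)
  orient-add ⁺ add = add
  orient-add ⁻ add = opp-add add

-- Treats the orders induced by w and by -w at once, so that a single decomposition can serve both
-- orientations.
module Oriented (o : Orientation) where

  τ : Vec ℤ len → Sgn
  τ v = orient o (sgn v)

  τ-nil : ∀ (v : Vec ℤ len) → τ v ≡ nil → sgn v ≡ nil
  τ-nil v = orient-nil o (sgn v)

  nil-τ : ∀ (v : Vec ℤ len) → sgn v ≡ nil → τ v ≡ nil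
  nil-τ v eq = trans (cong (orient o) eq) (orient-opp-nil o)
    where
    orient-opp-nil : ∀ o → orient o nil ≡ nil
    orient-opp-nil ⁺ = refl
    orient-opp-nil ⁻ = refl

  τ-swap : ∀ (u v : Vec ℤ len) → τ (v ⊖ u) ≡ opp (τ (u ⊖ v))
  τ-swap u v = trans (cong (orient o) (sgn-swap u v)) (orient-opp o (sgn (u ⊖ v)))

  τ-trans : ∀ (u v w : Vec ℤ len) {s} → Add (τ (u ⊖ v)) (τ (v ⊖ w)) s → τ (u ⊖ w) ≡ s
  τ-trans u v w {s} add = begin
    τ (u ⊖ w)  ≡⟨ cong τ (⊖-telescope u v w) ⟨
    τ (Vec.zipWith ℤ._+_ (u ⊖ v) (v ⊖ w))  ≡⟨ cong (orient o) (sgn-add (u ⊖ v) (v ⊖ w) add′) ⟩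
    orient o (orient o s)  ≡⟨ orient-involutive o s ⟩
    s  ∎
    where
    open ≡-Reasoning
    add′ : Add (sgn (u ⊖ v)) (sgn (v ⊖ w)) (orient o s)
    add′ = subst₂ (λ x y → Add x y (orient o s)) (orient-involutive o _) (orient-involutive o _) (orient-add o add)

  _≼_ : Vec ℤ len → Vec ℤ len → Set
  u ≼ v = τ (v ⊖ u) ≢ neg

  ≼-total : ∀ (u v : Vec ℤ len) → u ≼ v ⊎ v ≼ u
  ≼-total u v rewrite τ-swap u v with τ (u ⊖ v)
  ... | neg = inj₁ λ ()
  ... | nil = inj₁ λ ()
  ... | pos = inj₂ λ ()

  ≼-trans : ∀ {u v w : Vec ℤ len} → u ≼ v → v ≼ w → u ≼ w
  ≼-trans {u = u} {v} {w} u≼v v≼w eq with τ (w ⊖ v) in p | τ (v ⊖ u) in q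
  ... | neg | _   = v≼w refl
  ... | nil | neg = u≼v refl
  ... | pos | neg = u≼v refl
  ... | nil | nil = case trans (sym eq) (τ-trans w v u (subst₂ (λ x y → Add x y nil) (sym p) (sym q) nilˡ)) of λ ()
  ... | nil | pos = case trans (sym eq) (τ-trans w v u (subst₂ (λ x y → Add x y pos) (sym p) (sym q) nilˡ)) of λ ()
  ... | pos | nil = case trans (sym eq) (τ-trans w v u (subst₂ (λ x y → Add x y pos) (sym p) (sym q) nilʳ)) of λ ()
  ... | pos | pos = case trans (sym eq) (τ-trans w v u (subst₂ (λ x y → Add x y pos) (sym p) (sym q) same)) of λ ()

  ≼-antisym : ∀ {u v : Vec ℤ len} → u ≼ v → v ≼ u → sgn (u ⊖ v) ≡ nil
  ≼-antisym {u = u} {v} u≼v v≼u rewrite τ-swap u v = τ-nil (u ⊖ v) (lemma (τ (u ⊖ v)) u≼v v≼u)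
    where
    lemma : ∀ s → opp s ≢ neg → s ≢ neg → s ≡ nil
    lemma neg _ s≢ = contradiction refl s≢
    lemma nil _ _  = refl
    lemma pos s≢ _ = contradiction refl s≢

  τ-neg-minus : ∀ (u v : Vec ℤ len) → τ u ≡ neg → τ v ≢ neg → τ (u ⊖ v) ≡ neg
  τ-neg-minus u v u-neg v≢neg = τ-trans u 𝟎 v
    (subst₂ (λ x y → Add x y neg) (sym (trans (cong τ (⊖-𝟎 u)) u-neg)) (sym v′) (lemma (τ v) v≢neg))
    where
    v′ : τ (𝟎 ⊖ v) ≡ opp (τ v)
    v′ = trans (τ-swap v 𝟎) (cong (opp ∘ τ) (⊖-𝟎 v))
    lemma : ∀ s → s ≢ neg → Add neg (opp s) neg
    lemma neg s≢neg = contradiction refl s≢neg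
    lemma nil _     = nilʳ
    lemma pos _     = same

-- Linear relations between coordinates and the elimination of one coordinate

dot : Vec ℤ len → Vec ℤ len → ℤ
dot []      []      = 0ℤ
dot (x ∷ u) (y ∷ v) = x ℤ.* y ℤ.+ dot u v

_-_·_ : Vec ℤ len → ℤ → Vec ℤ len → Vec ℤ len
u - m · v = Vec.zipWith (λ x y → x ℤ.- m ℤ.* y) u v

-·-lookup : ∀ (u : Vec ℤ len) m v i → Vec.lookup (u - m · v) i ≡ Vec.lookup u i ℤ.- m ℤ.* Vec.lookup v i
-·-lookup u m v i = Vecₚ.lookup-zipWith _ i u v

-1· : ∀ (u v : Vec ℤ len) → u - 1ℤ · v ≡ u ⊖ v
-1· []      []      = refl
-1· (x ∷ u) (y ∷ v) = cong₂ _∷_ (cong (λ z → x ℤ.- z) (ℤₚ.*-identityˡ y)) (-1· u v)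

-0· : ∀ (u v : Vec ℤ len) → u - 0ℤ · v ≡ u
-0· []      []      = refl
-0· (x ∷ u) (y ∷ v) = cong₂ _∷_ (ℤₚ.+-identityʳ x) (-0· u v)

dot-sub : ∀ (p u : Vec ℤ len) m v → dot p (u - m · v) ≡ dot p u ℤ.- m ℤ.* dot p v
dot-sub []      []      m []      = sym (trans (cong (ℤ._-_ 0ℤ) (ℤₚ.*-zeroʳ m)) refl)
dot-sub (a ∷ p) (x ∷ u) m (y ∷ v) =
  trans (cong (λ z → a ℤ.* (x ℤ.- m ℤ.* y) ℤ.+ z) (dot-sub p u m v)) (regroup a x m y (dot p u) (dot p v))
  where
  regroup : ∀ a x m y s t → a ℤ.* (x ℤ.- m ℤ.* y) ℤ.+ (s ℤ.- m ℤ.* t) ≡ a ℤ.* x ℤ.+ s ℤ.- m ℤ.* (a ℤ.* y ℤ.+ t)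
  regroup = solve-∀

dot-linear : ∀ a b (p q v : Vec ℤ len) →
             dot (Vec.zipWith (λ x y → a ℤ.* x ℤ.+ b ℤ.* y) p q) v ≡ a ℤ.* dot p v ℤ.+ b ℤ.* dot q v
dot-linear a b []      []      []      = sym (zeros a b)
  where
  zeros : ∀ a b → a ℤ.* 0ℤ ℤ.+ b ℤ.* 0ℤ ≡ 0ℤ
  zeros = solve-∀
dot-linear a b (x ∷ p) (y ∷ q) (z ∷ v) =
  trans (cong (ℤ._+_ ((a ℤ.* x ℤ.+ b ℤ.* y) ℤ.* z)) (dot-linear a b p q v)) (regroup a b x y z (dot p v) (dot q v))
  where
  regroup : ∀ a b x y z s t → (a ℤ.* x ℤ.+ b ℤ.* y) ℤ.* z ℤ.+ (a ℤ.* s ℤ.+ b ℤ.* t) ≡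
                              a ℤ.* (x ℤ.* z ℤ.+ s) ℤ.+ b ℤ.* (y ℤ.* z ℤ.+ t)
  regroup = solve-∀

dot-nilˡ : ∀ (p v : Vec ℤ len) → sgn p ≡ nil → dot p v ≡ 0ℤ
dot-nilˡ []           []      _  = refl
dot-nilˡ (+ zero ∷ p) (y ∷ v) eq = trans (ℤₚ.+-identityˡ (dot p v)) (dot-nilˡ p v eq)

dot-comm : ∀ (p v : Vec ℤ len) → dot p v ≡ dot v p
dot-comm []      []      = refl
dot-comm (x ∷ p) (y ∷ v) = cong₂ ℤ._+_ (ℤₚ.*-comm x y) (dot-comm p v)

dot-nilʳ : ∀ (p v : Vec ℤ len) → sgn v ≡ nil → dot p v ≡ 0ℤ
dot-nilʳ p v eq = trans (dot-comm p v) (dot-nilˡ v p eq)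

dot-removeAt : ∀ (p v : Vec ℤ (suc len)) i →
               dot p v ≡ Vec.lookup p i ℤ.* Vec.lookup v i ℤ.+ dot (Vec.removeAt p i) (Vec.removeAt v i)
dot-removeAt (x ∷ p)     (y ∷ v)     zero    = refl
dot-removeAt (x ∷ a ∷ p) (y ∷ b ∷ v) (suc i) =
  trans (cong (ℤ._+_ (x ℤ.* y)) (dot-removeAt (a ∷ p) (b ∷ v) i)) (regroup (x ℤ.* y) (Vec.lookup (a ∷ p) i ℤ.* Vec.lookup (b ∷ v) i) _)
  where
  regroup : ∀ s t u → s ℤ.+ (t ℤ.+ u) ≡ t ℤ.+ (s ℤ.+ u)
  regroup = solve-∀

dot-insertAt : ∀ (p : Vec ℤ len) v i → dot (Vec.insertAt p i 0ℤ) v ≡ dot p (Vec.removeAt v i)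
dot-insertAt p       (y ∷ v)     zero    = ℤₚ.+-identityˡ (dot p v)
dot-insertAt (x ∷ p) (y ∷ b ∷ v) (suc i) = cong (ℤ._+_ (x ℤ.* y)) (dot-insertAt p (b ∷ v) i)

-- On the hyperplane p · v = 0 the last coordinate i with pᵢ ≠ 0 is determined
-- by the earlier ones, so that forgetting it does not affect signs.
record Pivot (p : Vec ℤ (suc len)) : Set where
  field
    index   : Fin (suc len)
    nonzero : Vec.lookup p index ≢ 0ℤ
    sgn-removeAt : ∀ v → dot p v ≡ 0ℤ → sgn (Vec.removeAt v index) ≡ sgn v

pivot : (p : Vec ℤ (suc len)) → sgn p ≢ nil → Pivot p
pivot (a ∷ p) p≢0 with nil? (sgn p)
... | yes p≡nil = record { index = zero ; nonzero = a≢0 ; sgn-removeAt = forget }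
  where
  a≢0 : a ≢ 0ℤ
  a≢0 refl = p≢0 p≡nil
  forget : ∀ v → dot (a ∷ p) v ≡ 0ℤ → sgn (Vec.removeAt v zero) ≡ sgn v
  forget (x ∷ v) eq with ℤₚ.i*j≡0⇒i≡0∨j≡0 a (trans (sym (trans (cong (ℤ._+_ (a ℤ.* x)) (dot-nilˡ p v p≡nil)) (ℤₚ.+-identityʳ _))) eq)
  ... | inj₁ a≡0  = contradiction a≡0 a≢0
  ... | inj₂ refl = refl
pivot (a ∷ [])        p≢0 | no p≢nil = contradiction refl p≢nil
pivot (a ∷ p@(_ ∷ _)) p≢0 | no p≢nil = record { index = suc index ; nonzero = nonzero ; sgn-removeAt = forget }
  where
  open Pivot (pivot p p≢nil)
  forget : ∀ v → dot (a ∷ p) v ≡ 0ℤ → sgn (Vec.removeAt v (suc index)) ≡ sgn v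
  -- A non-zero first coordinate already decides the sign; if it is 0, the tail lies on the
  -- hyperplane given by the tail of p.
  forget (+ zero   ∷ y ∷ v) eq = sgn-removeAt (y ∷ v)
    (trans (sym (trans (cong (ℤ._+ dot p (y ∷ v)) (ℤₚ.*-zeroʳ a)) (ℤₚ.+-identityˡ (dot p (y ∷ v))))) eq)
  forget (+ suc _  ∷ y ∷ v) eq = refl
  forget (-[1+ _ ] ∷ y ∷ v) eq = refl

-- Counting

record Count (P : A → Set) (n : ℕ) : Set where
  field
    elements : List A
    unique   : Unique elements
    complete : ∀ {x} → P x → x ∈ elements
    sound    : ∀ {x} → x ∈ elements → P x
    size     : List.length elements ≡ n

count-⇔ : ∀ {P Q : A → Set} {n} → (∀ {x} → P x → Q x) → (∀ {x} → Q x → P x) → Count P n → Count Q n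
count-⇔ to from C₁ = record { elements = elements ; unique = unique ; complete = complete ∘ from
                            ; sound = to ∘ sound ; size = size }
  where open Count C₁

count-∅ : ∀ {P : A → Set} → (∀ x → ¬ P x) → Count P 0
count-∅ ∅ = record { elements = [] ; unique = [] ; complete = λ {x} Px → contradiction Px (∅ x)
                   ; sound = λ () ; size = refl }

count-singleton : ∀ {P : A → Set} x → P x → (∀ {y} → P y → y ≡ x) → Count P 1
count-singleton x Px only = record { elements = x ∷ [] ; unique = [] ∷ [] ; complete = here ∘ only
                                   ; sound = λ { (here refl) → Px } ; size = refl }

count-image : ∀ {P : A → Set} {n} (f : A → B) → (∀ {x y} → f x ≡ f y → x ≡ y) →
              Count P n → Count (λ y → ∃[ x ] P x × y ≡ f x) n
count-image f injective C₁ = record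
  { elements = List.map f elements ; unique = Uniqueₚ.map⁺ injective unique
  ; complete = λ { (x , Px , refl) → ∈ₚ.∈-map⁺ f (complete Px) }
  ; sound = λ y∈ → case ∈ₚ.∈-map⁻ f y∈ of λ { (x , x∈ , refl) → x , sound x∈ , refl }
  ; size = trans (Listₚ.length-map f elements) size }
  where open Count C₁

count-⊎ : ∀ {P Q : A → Set} {m n} → (∀ {x} → P x → ¬ Q x) → Count P m → Count Q n →
          Count (λ x → P x ⊎ Q x) (m + n)
count-⊎ disjoint C₁ C₂ = record
  { elements = C₁.elements List.++ C₂.elements
  ; unique = Uniqueₚ.++⁺ C₁.unique C₂.unique λ (x∈₁ , x∈₂) → disjoint (C₁.sound x∈₁) (C₂.sound x∈₂)
  ; complete = λ { (inj₁ Px) → ∈ₚ.∈-++⁺ˡ (C₁.complete Px) ; (inj₂ Qx) → ∈ₚ.∈-++⁺ʳ C₁.elements (C₂.complete Qx) }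
  ; sound = λ x∈ → Sum.map C₁.sound C₂.sound (∈ₚ.∈-++⁻ C₁.elements x∈)
  ; size = trans (Listₚ.length-++ C₁.elements) (cong₂ _+_ C₁.size C₂.size) }
  where
  module C₁ = Count C₁
  module C₂ = Count C₂

-- This is where descriptions of one set of matrices, by search and by pieces, become an equation
-- between H and the series.
count-unique : ∀ {P : A → Set} {m n} → Count P m → Count P n → m ≡ n
count-unique C₁ C₂ = trans (sym C₁.size) (trans (ℕₚ.≤-antisym
  (Unique-⊆ C₁.unique (C₂.complete ∘ C₁.sound)) (Unique-⊆ C₂.unique (C₁.complete ∘ C₂.sound))) C₂.size)
  where
  module C₁ = Count C₁
  module C₂ = Count C₂
  Unique-⊆ : ∀ {xs ys : List A} → Unique xs → (∀ {x} → x ∈ xs → x ∈ ys) → List.length xs ℕ.≤ List.length ys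
  Unique-⊆ {xs = []}     _        _     = z≤n
  Unique-⊆ {xs = x ∷ xs} (x∉ ∷ u) xs⊆ys with as , bs , refl ← ∈ₚ.∈-∃++ (xs⊆ys (here refl)) =
    subst (suc (List.length xs) ℕ.≤_)
      (sym (trans (Listₚ.length-++ as) (trans (ℕₚ.+-suc (List.length as) (List.length bs))
        (cong suc (sym (Listₚ.length-++ as {bs}))))))
      (s≤s (Unique-⊆ u λ y∈ → skip (λ { refl → ListAllₚ.All¬⇒¬Any x∉ y∈ }) (∈ₚ.∈-++⁻ as (xs⊆ys (there y∈)))))
    where
    skip : ∀ {y} → y ≢ x → y ∈ as ⊎ y ∈ x ∷ bs → y ∈ as List.++ bs
    skip y≢x (inj₁ y∈as)         = ∈ₚ.∈-++⁺ˡ y∈as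
    skip y≢x (inj₂ (here y≡x))   = contradiction y≡x y≢x
    skip y≢x (inj₂ (there y∈bs)) = ∈ₚ.∈-++⁺ʳ as y∈bs

∑< : (ℕ → ℕ) → ℕ → ℕ
∑< f zero    = 0
∑< f (suc n) = ∑< f n + f n

∑∈ : (A → ℕ) → List A → ℕ
∑∈ f []       = 0
∑∈ f (x ∷ xs) = f x + ∑∈ f xs

∑∈-++ : ∀ (f : A → ℕ) xs ys → ∑∈ f (xs List.++ ys) ≡ ∑∈ f xs + ∑∈ f ys
∑∈-++ f []       ys = refl
∑∈-++ f (x ∷ xs) ys = trans (cong (ℕ._+_ (f x)) (∑∈-++ f xs ys)) (sym (ℕₚ.+-assoc (f x) _ _))

∑∈-map : ∀ (f : B → ℕ) (g : A → B) xs → ∑∈ f (List.map g xs) ≡ ∑∈ (f ∘ g) xs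
∑∈-map f g []       = refl
∑∈-map f g (x ∷ xs) = cong (ℕ._+_ (f (g x))) (∑∈-map f g xs)

∑∈-cong : ∀ {f g : A → ℕ} → (∀ x → f x ≡ g x) → ∀ xs → ∑∈ f xs ≡ ∑∈ g xs
∑∈-cong f≗g []       = refl
∑∈-cong f≗g (x ∷ xs) = cong₂ _+_ (f≗g x) (∑∈-cong f≗g xs)

∑<-∑∈ : ∀ (f : A → ℕ → ℕ) n xs → ∑< (λ i → ∑∈ (λ x → f x i) xs) n ≡ ∑∈ (λ x → ∑< (f x) n) xs
∑<-∑∈ f zero    xs = sym (zeros xs)
  where
  zeros : ∀ xs → ∑∈ (λ x → ∑< (f x) zero) xs ≡ 0
  zeros []       = refl
  zeros (x ∷ xs) = zeros xs
∑<-∑∈ f (suc n) xs = trans (cong (_+ ∑∈ (λ x → f x n) xs) (∑<-∑∈ f n xs)) (distrib xs)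
  where
  distrib : ∀ xs → ∑∈ (λ x → ∑< (f x) n) xs + ∑∈ (λ x → f x n) xs ≡ ∑∈ (λ x → ∑< (f x) (suc n)) xs
  distrib []       = refl
  distrib (x ∷ xs) = trans (interchange (∑< (f x) n) _ (f x n) _) (cong (ℕ._+_ (∑< (f x) n + f x n)) (distrib xs))
    where
    interchange : ∀ a b c d → a + b + (c + d) ≡ a + c + (b + d)
    interchange = ℕ-solve-∀

count-∑< : ∀ {P : ℕ → A → Set} {c : ℕ → ℕ} → (∀ {i j x} → P i x → P j x → i ≡ j) →
           (∀ i → Count (P i) (c i)) → ∀ n → Count (λ x → ∃[ i ] i ℕ.< n × P i x) (∑< c n)
count-∑< disjoint C₁ zero    = count-∅ λ { _ (_ , () , _) }
count-∑< disjoint C₁ (suc n) = count-⇔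
  (λ { (inj₁ (i , i<n , Pi)) → i , ℕₚ.m<n⇒m<1+n i<n , Pi ; (inj₂ Pn) → n , ℕₚ.n<1+n n , Pn })
  (λ { (i , i<1+n , Pi) → case ℕₚ.m≤n⇒m<n∨m≡n (ℕ.s≤s⁻¹ i<1+n) of λ
       { (inj₁ i<n) → inj₁ (i , i<n , Pi) ; (inj₂ refl) → inj₂ Pi } })
  (count-⊎ (λ { (i , i<n , Pi) Pn → ℕₚ.<⇒≢ i<n (disjoint Pi Pn) }) (count-∑< disjoint C₁ n) (C₁ n))

-- compositions D j k counts the D-tuples of natural numbers with sum k − j.
compositions : ℕ → ℕ → ℕ → ℕ
compositions zero    zero    zero    = 1
compositions zero    zero    (suc k) = 0
compositions zero    (suc j) zero    = 0
compositions zero    (suc j) (suc k) = compositions zero j k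
compositions (suc D) j       k       = ∑< (compositions D j) (suc k)

compositions-0-0 : ∀ D → compositions D 0 0 ≡ 1
compositions-0-0 zero    = refl
compositions-0-0 (suc D) = compositions-0-0 D

compositions-suc-zero : ∀ D j → compositions D (suc j) 0 ≡ 0
compositions-suc-zero zero    j = refl
compositions-suc-zero (suc D) j = compositions-suc-zero D j

compositions-suc-suc : ∀ D j k → compositions D (suc j) (suc k) ≡ compositions D j k
compositions-suc-suc zero    j k = refl
compositions-suc-suc (suc D) j k = shift (suc k)
  where
  shift : ∀ n → ∑< (compositions D (suc j)) (suc n) ≡ ∑< (compositions D j) n
  shift zero    = compositions-suc-zero D j
  shift (suc n) = cong₂ _+_ (shift n) (compositions-suc-suc D j n)

-- Stopping before k makes the new part at least 1: the series is multiplied by q / (1 - q) instead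
-- of 1 / (1 - q).
∑<-compositions : ∀ D j k → ∑< (compositions D j) k ≡ compositions (suc D) (suc j) k
∑<-compositions D j zero    = sym (compositions-suc-zero D j)
∑<-compositions D j (suc k) = sym (compositions-suc-suc (suc D) j k)

minimum : ∀ {_≲_ : A → A → Set} → (∀ x y → x ≲ y ⊎ y ≲ x) → (∀ {x y z} → x ≲ y → y ≲ z → x ≲ z) →
          ∀ {x} {xs : List A} → x ∈ xs → ∃[ m ] m ∈ xs × (∀ {y} → y ∈ xs → m ≲ y)
minimum {A = A} {_≲_} total transitive {xs = x₀ ∷ xs₀} _ = least x₀ xs₀
  where
  ≲-refl : ∀ x → x ≲ x
  ≲-refl x = Sum.reduce (total x x)
  least : ∀ x xs → ∃[ m ] m ∈ x ∷ xs × (∀ {y} → y ∈ x ∷ xs → m ≲ y)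
  least x []        = x , here refl , λ { (here refl) → ≲-refl x }
  least x (x′ ∷ xs) with m , m∈ , m≲ ← least x′ xs with total x m
  ... | inj₁ x≲m = x , here refl , λ { (here refl) → ≲-refl x ; (there y∈) → transitive x≲m (m≲ y∈) }
  ... | inj₂ m≲x = m , there m∈ , λ { (here refl) → m≲x ; (there y∈) → m≲ y∈ }

-- Decomposition of the cone of magic squares

Ok : Sgn → ℕ → Set
Ok neg m = 1 ℕ.≤ m
Ok nil m = m ≡ 0
Ok pos m = ⊤

-- Magic squares whose position relative to the point w of the ordered space is
-- recorded by strict inequalities: an entry where w is negative must not vanish.
record Cone {d D} (o : Orientation) (w : Fin d → Fin d → Vec ℤ D) (k : ℕ) (M : Matrix d) : Set where
  constructor cone
  field
    magic : Magic k M
    ok    : ∀ i j → Ok (orient o (sgn (w i j))) (entry M i j)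

-- The coordinates of w form a basis of the space of magic matrices supported
-- in the support of w.
record Generic {d D} (w : Fin d → Fin d → Vec ℤ D) : Set where
  field
    magic : ∀ x → ∃[ k ] LineSums k (λ i j → Vec.lookup (w i j) x)
    indep : ∀ p → (∀ i j → dot p (w i j) ≡ 0ℤ) → sgn p ≡ nil
    span  : ∀ {M k} → Magic k M → (∀ i j → sgn (w i j) ≡ nil → entry M i j ≡ 0) →
            ∃[ c ] ∃[ p ] c ≢ 0ℤ × (∀ i j → c ℤ.* ⟪ M ⟫ i j ≡ dot p (w i j))

side : Orientation → ℕ × ℕ → ℕ
side ⁺ = proj₁
side ⁻ = proj₂

-- `compositions D a k` is the coefficient of q^k in q^a / (1 - q)^D, so `counts` is an identity of
-- series, stated coefficient by coefficient.
record Decomposition {d D} (w : Fin d → Fin d → Vec ℤ D) : Set where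
  field
    pieces  : List (ℕ × ℕ)
    degrees : ListAll.All (λ (a , b) → a + b ≡ D) pieces
    counts  : ∀ o k → Count (Cone o w k) (∑∈ (λ p → compositions D (side o p) k) pieces)

cone-vanishes : ∀ {d D o k} {w : Fin d → Fin d → Vec ℤ D} {M} → Cone o w k M →
                ∀ i j → sgn (w i j) ≡ nil → entry M i j ≡ 0
cone-vanishes {o = o} {w = w} {M} (cone _ ok) i j eq =
  subst (λ s → Ok s (entry M i j)) (Oriented.nil-τ o (w i j) eq) (ok i j)

magic-entry≤ : ∀ {d k} {M : Matrix d} → Magic k M → ∀ i j → entry M i j ℕ.≤ k
magic-entry≤ {k = k} {M} magic i j = ℤₚ.drop‿+≤+
  (subst (⟪ M ⟫ i j ℤ.≤_) (proj₁ (magic⇒lineSums {k = k} {M} magic) i) (term≤sumℤ (λ _ → +≤+ z≤n) j))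

magic-unique : ∀ {e k l} {M : Matrix (suc e)} → Magic k M → Magic l M → k ≡ l
magic-unique {k = k} {l} {M} magic₁ magic₂ = ℤₚ.+-injective
  (trans (sym (proj₁ (magic⇒lineSums {k = k} {M} magic₁) zero)) (proj₁ (magic⇒lineSums {k = l} {M} magic₂) zero))

magic₁-nonzero : ∀ {e} {P : Matrix (suc e)} → Magic 1 P → ∃[ i ] ∃[ j ] entry P i j ≢ 0
magic₁-nonzero {e} {P} magic with Finₚ.any? (λ j → ¬? (entry P zero j ℕₚ.≟ 0))
... | yes (j , P≢0) = zero , j , P≢0
... | no P≡0 = contradiction (trans (sym (proj₁ (magic⇒lineSums {k = 1} {P} magic) zero)) (sumℤ-zero {f = ⟪ P ⟫ zero} zeros)) λ ()
  where
  zeros : ∀ j → ⟪ P ⟫ zero j ≡ 0ℤ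
  zeros j = cong +_ (decidable-stable (entry P zero j ℕₚ.≟ 0) λ P≢0 → P≡0 (j , P≢0))

Compatible : ∀ {d D} → (Fin d → Fin d → Vec ℤ D) → Matrix d → Set
Compatible w P = ∀ i j → entry P i j ≡ 0 ⊎ sgn (w i j) ≢ nil

compatible? : ∀ {d D} (w : Fin d → Fin d → Vec ℤ D) P → Dec (Compatible w P)
compatible? w P = Finₚ.all? λ i → Finₚ.all? λ j → (entry P i j ℕₚ.≟ 0) ⊎-dec ¬? (nil? (sgn (w i j)))

module _ {e D} {w : Fin (suc e) → Fin (suc e) → Vec ℤ (suc D)} (generic : Generic w) where

  open Generic generic

  private
    d : ℕ
    d = suc e

  orientℤ : Orientation → ℤ → ℤ
  orientℤ ⁺ x = 1ℤ ℤ.* x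
  orientℤ ⁻ x = -1ℤ ℤ.* x

  -- For k > 0 Birkhoff's theorem applies to M itself. For k = 0 the square M is zero, which is
  -- allowed only if no entry of w is negative in this orientation. The leading coordinate of w, up
  -- to sign, is then a non-negative matrix with constant line sums, and it is not zero because the
  -- coordinates are independent; Birkhoff's theorem applies to it instead.
  cone-nonempty : ∀ {o k M} → Cone o w k M → ∃[ P ] Magic 1 P × Compatible w P
  cone-nonempty {o} {suc k} {M} C₁@(cone magic _)
    with P , magicP , support ← birkhoff {M = ⟪ M ⟫} (+<+ (s≤s z≤n)) (λ _ _ → +≤+ z≤n) (magic⇒lineSums {k = suc k} {M} magic)
    = P , magicP , compatible
    where
    compatible : Compatible w P
    compatible i j with entry P i j ℕₚ.≟ 0
    ... | yes P≡0 = inj₁ P≡0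
    ... | no  P≢0 = inj₂ λ nil → support i j P≢0 (cong +_ (cone-vanishes C₁ i j nil))
  cone-nonempty {o} {zero} {M} (cone magicM ok) =
    let P , magicP , support = birkhoff 0<K h-nonneg h-sums in P , magicP , compatible P support
    where
    h : Fin d → Fin d → ℤ
    h i j = orientℤ o (Vec.lookup (w i j) zero)

    sign : ∀ o (v : Vec ℤ (suc D)) → Ok (orient o (sgn v)) 0 → 0ℤ ℤ.≤ orientℤ o (Vec.lookup v zero)
    sign ⁺ (+ zero  ∷ v) _ = +≤+ z≤n
    sign ⁺ (+ suc _ ∷ v) _ = +≤+ z≤n
    sign ⁻ (+ zero  ∷ v) _ = +≤+ z≤n
    sign ⁻ (-[1+ _ ] ∷ v) _ = +≤+ z≤n

    h-nonneg : ∀ i j → 0ℤ ℤ.≤ h i j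
    h-nonneg i j = sign o (w i j)
      (subst (Ok (orient o (sgn (w i j)))) (ℕₚ.n≤0⇒n≡0 (magic-entry≤ {M = M} magicM i j)) (ok i j))

    orient-sums : ∀ o {k} {f : Fin d → Fin d → ℤ} → LineSums k f → LineSums (orientℤ o k) (λ i j → orientℤ o (f i j))
    orient-sums ⁺ {k} {f} sums = lineSums-cong (drop₀ k k) (λ i j → drop₀ (f i j) (f i j)) (lineSums-linear 1ℤ 0ℤ {f = f} {f} sums sums)
      where
      drop₀ : ∀ x y → 1ℤ ℤ.* x ℤ.+ 0ℤ ℤ.* y ≡ 1ℤ ℤ.* x
      drop₀ = solve-∀
    orient-sums ⁻ {k} {f} sums = lineSums-cong (drop₀ k k) (λ i j → drop₀ (f i j) (f i j)) (lineSums-linear -1ℤ 0ℤ {f = f} {f} sums sums)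
      where
      drop₀ : ∀ x y → -1ℤ ℤ.* x ℤ.+ 0ℤ ℤ.* y ≡ -1ℤ ℤ.* x
      drop₀ = solve-∀

    K : ℤ
    K = orientℤ o (proj₁ (magic zero))

    h-sums : LineSums K h
    h-sums = orient-sums o {f = λ i j → Vec.lookup (w i j) zero} (proj₂ (magic zero))

    orientℤ-zero : ∀ o {x} → orientℤ o x ≡ 0ℤ → x ≡ 0ℤ
    orientℤ-zero ⁺ {x} eq = trans (sym (ℤₚ.*-identityˡ x)) eq
    orientℤ-zero ⁻ {x} eq = ℤₚ.neg-injective (trans (sym (ℤₚ.-1*i≡-i x)) eq)

    0<K : 0ℤ ℤ.< K
    0<K = ℤₚ.≤∧≢⇒< (subst (0ℤ ℤ.≤_) (proj₁ h-sums zero) (sumℤ-nonneg (h-nonneg zero))) λ 0≡K →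
      case indep (1ℤ ∷ 𝟎) (λ i j → first-zero (w i j) (orientℤ-zero o (ℤₚ.≤-antisym
        (subst (h i j ℤ.≤_) (trans (proj₁ h-sums i) (sym 0≡K)) (term≤sumℤ (h-nonneg i) j)) (h-nonneg i j)))) of λ ()
      where
      first-zero : ∀ (v : Vec ℤ (suc D)) → Vec.lookup v zero ≡ 0ℤ → dot (1ℤ ∷ 𝟎) v ≡ 0ℤ
      first-zero (x ∷ v) refl = cong (ℤ._+_ 0ℤ) (dot-nilˡ (𝟎 {D}) v (nil-sgn (𝟎 {D}) λ i → Vecₚ.lookup-replicate i 0ℤ))

    compatible : ∀ P → (∀ i j → entry P i j ≢ 0 → h i j ≢ 0ℤ) → Compatible w P
    compatible P support i j with entry P i j ℕₚ.≟ 0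
    ... | yes P≡0 = inj₁ P≡0
    ... | no  P≢0 = inj₂ λ nil → support i j P≢0 (zero-orientℤ o (sgn-nil (w i j) nil zero))
      where
      zero-orientℤ : ∀ o {x} → x ≡ 0ℤ → orientℤ o x ≡ 0ℤ
      zero-orientℤ ⁺ refl = refl
      zero-orientℤ ⁻ refl = refl

  module Pulling {π : Matrix (suc e)} (magicπ : Magic 1 π) (compatible : Compatible w π) where

    π-cases : ∀ i j → entry π i j ≡ 0 ⊎ entry π i j ≡ 1
    π-cases i j with entry π i j | magic-entry≤ {M = π} magicπ i j
    ... | zero  | _       = inj₁ refl
    ... | suc _ | s≤s z≤n = inj₂ refl

    π-sums : LineSums 1ℤ ⟪ π ⟫
    π-sums = magic⇒lineSums {k = 1} {π} magicπ

    π-vanishes : ∀ i j → sgn (w i j) ≡ nil → entry π i j ≡ 0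
    π-vanishes i j eq with compatible i j
    ... | inj₁ π≡0  = π≡0
    ... | inj₂ ≢nil = contradiction eq ≢nil

    π-coordinates : ∃[ c ] ∃[ p ] c ≢ 0ℤ × (∀ i j → c ℤ.* ⟪ π ⟫ i j ≡ dot p (w i j))
    π-coordinates = span {M = π} {k = 1} magicπ π-vanishes

    c : ℤ
    c = proj₁ π-coordinates

    p : Vec ℤ (suc D)
    p = proj₁ (proj₂ π-coordinates)

    c≢0 : c ≢ 0ℤ
    c≢0 = proj₁ (proj₂ (proj₂ π-coordinates))

    p·w : ∀ i j → c ℤ.* ⟪ π ⟫ i j ≡ dot p (w i j)
    p·w = proj₂ (proj₂ (proj₂ π-coordinates))

    *-≢0 : ∀ {x y} → x ≢ 0ℤ → y ≢ 0ℤ → x ℤ.* y ≢ 0ℤ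
    *-≢0 {x} x≢0 y≢0 eq = case ℤₚ.i*j≡0⇒i≡0∨j≡0 x eq of λ { (inj₁ x≡0) → x≢0 x≡0 ; (inj₂ y≡0) → y≢0 y≡0 }

    p≢nil : sgn p ≢ nil
    p≢nil eq with a , b , π≢0 ← magic₁-nonzero {P = π} magicπ =
      *-≢0 c≢0 (π≢0 ∘ ℤₚ.+-injective) (trans (p·w a b) (dot-nilˡ p (w a b) eq))

    open Pivot (pivot p p≢nil)

    -- The projection of w from π to the hyperplane where an entry equal to v vanishes.
    project : Vec ℤ (suc D) → Fin (suc e) → Fin (suc e) → Vec ℤ (suc D)
    project v i j = w i j - ⟪ π ⟫ i j · v

    shrink : Vec ℤ (suc D) → Fin (suc e) → Fin (suc e) → Vec ℤ D
    shrink v i j = Vec.removeAt (project v i j) index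

    project-off : ∀ v {i j} → entry π i j ≡ 0 → project v i j ≡ w i j
    project-off v {i} {j} eq = trans (cong (λ m → w i j - + m · v) eq) (-0· (w i j) v)

    project-on : ∀ v {i j} → entry π i j ≡ 1 → project v i j ≡ w i j ⊖ v
    project-on v {i} {j} eq = trans (cong (λ m → w i j - + m · v) eq) (-1· (w i j) v)

    module At (a b : Fin (suc e)) (π≡1 : entry π a b ≡ 1) where

      v : Vec ℤ (suc D)
      v = w a b

      p·project : ∀ i j → dot p (project v i j) ≡ 0ℤ
      p·project i j = begin
        dot p (project v i j)  ≡⟨ dot-sub p (w i j) (⟪ π ⟫ i j) v ⟩
        dot p (w i j) ℤ.- ⟪ π ⟫ i j ℤ.* dot p v  ≡⟨ cong₂ (λ x y → x ℤ.- ⟪ π ⟫ i j ℤ.* y) (p·w i j) (p·w a b) ⟨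
        c ℤ.* ⟪ π ⟫ i j ℤ.- ⟪ π ⟫ i j ℤ.* (c ℤ.* + entry π a b)  ≡⟨ cong (λ m → c ℤ.* ⟪ π ⟫ i j ℤ.- ⟪ π ⟫ i j ℤ.* (c ℤ.* + m)) π≡1 ⟩
        c ℤ.* ⟪ π ⟫ i j ℤ.- ⟪ π ⟫ i j ℤ.* (c ℤ.* 1ℤ)  ≡⟨ cancel c (⟪ π ⟫ i j) ⟩
        0ℤ  ∎
        where
        open ≡-Reasoning
        cancel : ∀ c x → c ℤ.* x ℤ.- x ℤ.* (c ℤ.* 1ℤ) ≡ 0ℤ
        cancel = solve-∀

      sgn-shrink : ∀ i j → sgn (shrink v i j) ≡ sgn (project v i j)
      sgn-shrink i j = sgn-removeAt (project v i j) (p·project i j)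

      project-ab : sgn (project v a b) ≡ nil
      project-ab = trans (cong sgn (project-on v π≡1)) (nil-sgn (v ⊖ v) λ x →
        trans (Vecₚ.lookup-zipWith ℤ._-_ x v v) (ℤₚ.+-inverseʳ (Vec.lookup v x)))

      project-nil : ∀ {i j} → sgn (w i j) ≡ nil → sgn (project v i j) ≡ nil
      project-nil {i} {j} eq = trans (cong sgn (project-off v (π-vanishes i j eq))) eq

      shrink-generic : Generic (shrink v)
      shrink-generic = record { magic = magic′ ; indep = indep′ ; span = span′ }
        where
        open ≡-Reasoning

        lookup-removeAt : ∀ {n} (u : Vec ℤ (suc n)) i x → Vec.lookup (Vec.removeAt u i) x ≡ Vec.lookup u (Fin.punchIn i x)
        lookup-removeAt u i x = trans (cong (λ y → Vec.lookup (Vec.removeAt u i) y) (sym (Finₚ.punchOut-punchIn i)))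
          (Vecₚ.removeAt-punchOut u (Finₚ.punchInᵢ≢i i x ∘ sym))

        magic′ : ∀ x → ∃[ k ] LineSums k (λ i j → Vec.lookup (shrink v i j) x)
        magic′ x = 1ℤ ℤ.* proj₁ (magic y) ℤ.+ (ℤ.- Vec.lookup v y) ℤ.* 1ℤ , lineSums-cong refl
          (λ i j → trans (as-linear (Vec.lookup (w i j) y) (⟪ π ⟫ i j) (Vec.lookup v y))
            (sym (trans (lookup-removeAt (project v i j) index x) (-·-lookup (w i j) (⟪ π ⟫ i j) v y))))
          (lineSums-linear 1ℤ (ℤ.- Vec.lookup v y) {f = λ i j → Vec.lookup (w i j) y} {⟪ π ⟫} (proj₂ (magic y)) π-sums)
          where
          y : Fin (suc D)
          y = Fin.punchIn index x
          as-linear : ∀ x m y → 1ℤ ℤ.* x ℤ.+ (ℤ.- y) ℤ.* m ≡ x ℤ.- m ℤ.* y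
          as-linear = solve-∀

        -- Padding a relation q with 0 at the pivot gives q⁺ with q⁺ · w = s π. Then c q⁺ - s p
        -- annihilates w and so vanishes. At the pivot q⁺ is 0 and p is not, whence s = 0, and then
        -- q = 0 because c is not 0.
        indep′ : ∀ q → (∀ i j → dot q (shrink v i j) ≡ 0ℤ) → sgn q ≡ nil
        indep′ q q·w′ = nil-sgn q λ x →
          case ℤₚ.i*j≡0⇒i≡0∨j≡0 c (trans (sym (combination-at (Fin.punchIn index x))) (comb-zero (Fin.punchIn index x))) of λ
          { (inj₁ c≡0) → contradiction c≡0 c≢0
          ; (inj₂ q⁺≡0) → trans (sym (Vecₚ.insertAt-punchIn q index 0ℤ x)) q⁺≡0 }
          where
          q⁺ : Vec ℤ (suc D)
          q⁺ = Vec.insertAt q index 0ℤ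
          s : ℤ
          s = dot q⁺ v
          q⁺·w : ∀ i j → dot q⁺ (w i j) ≡ ⟪ π ⟫ i j ℤ.* s
          q⁺·w i j = ℤₚ.i-j≡0⇒i≡j _ _ (begin
            dot q⁺ (w i j) ℤ.- ⟪ π ⟫ i j ℤ.* s  ≡⟨ dot-sub q⁺ (w i j) (⟪ π ⟫ i j) v ⟨
            dot q⁺ (project v i j)  ≡⟨ dot-insertAt q (project v i j) index ⟩
            dot q (shrink v i j)  ≡⟨ q·w′ i j ⟩
            0ℤ  ∎)
          combination : Vec ℤ (suc D)
          combination = Vec.zipWith (λ x y → c ℤ.* x ℤ.+ (ℤ.- s) ℤ.* y) q⁺ p
          combination·w : ∀ i j → dot combination (w i j) ≡ 0ℤ
          combination·w i j = begin
            dot combination (w i j)  ≡⟨ dot-linear c (ℤ.- s) q⁺ p (w i j) ⟩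
            c ℤ.* dot q⁺ (w i j) ℤ.+ (ℤ.- s) ℤ.* dot p (w i j)  ≡⟨ cong₂ (λ x y → c ℤ.* x ℤ.+ (ℤ.- s) ℤ.* y) (q⁺·w i j) (sym (p·w i j)) ⟩
            c ℤ.* (⟪ π ⟫ i j ℤ.* s) ℤ.+ (ℤ.- s) ℤ.* (c ℤ.* ⟪ π ⟫ i j)  ≡⟨ cancel c (⟪ π ⟫ i j) s ⟩
            0ℤ  ∎
            where
            cancel : ∀ c x s → c ℤ.* (x ℤ.* s) ℤ.+ (ℤ.- s) ℤ.* (c ℤ.* x) ≡ 0ℤ
            cancel = solve-∀
          comb-zero : ∀ x → Vec.lookup combination x ≡ 0ℤ
          comb-zero = sgn-nil combination (indep combination combination·w)
          s≡0 : s ≡ 0ℤ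
          s≡0 = case ℤₚ.i*j≡0⇒i≡0∨j≡0 (ℤ.- s) (begin
            (ℤ.- s) ℤ.* Vec.lookup p index
              ≡⟨ ℤₚ.+-identityˡ _ ⟨
            0ℤ ℤ.+ (ℤ.- s) ℤ.* Vec.lookup p index
              ≡⟨ cong (ℤ._+ (ℤ.- s) ℤ.* Vec.lookup p index) (trans (cong (c ℤ.*_) (Vecₚ.insertAt-lookup q index 0ℤ)) (ℤₚ.*-zeroʳ c)) ⟨
            c ℤ.* Vec.lookup q⁺ index ℤ.+ (ℤ.- s) ℤ.* Vec.lookup p index
              ≡⟨ Vecₚ.lookup-zipWith _ index q⁺ p ⟨
            Vec.lookup combination index
              ≡⟨ comb-zero index ⟩
            0ℤ ∎) of λ
            { (inj₁ -s≡0) → ℤₚ.neg-injective -s≡0 ; (inj₂ p≡0) → contradiction p≡0 nonzero }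
          combination-at : ∀ x → Vec.lookup combination x ≡ c ℤ.* Vec.lookup q⁺ x
          combination-at x = begin
            Vec.lookup combination x  ≡⟨ Vecₚ.lookup-zipWith _ x q⁺ p ⟩
            c ℤ.* Vec.lookup q⁺ x ℤ.+ (ℤ.- s) ℤ.* Vec.lookup p x  ≡⟨ cong (λ s → c ℤ.* Vec.lookup q⁺ x ℤ.+ (ℤ.- s) ℤ.* Vec.lookup p x) s≡0 ⟩
            c ℤ.* Vec.lookup q⁺ x ℤ.+ 0ℤ ℤ.* Vec.lookup p x  ≡⟨ cong (ℤ._+_ (c ℤ.* Vec.lookup q⁺ x)) (ℤₚ.*-zeroˡ (Vec.lookup p x)) ⟩
            c ℤ.* Vec.lookup q⁺ x ℤ.+ 0ℤ  ≡⟨ ℤₚ.+-identityʳ _ ⟩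
            c ℤ.* Vec.lookup q⁺ x  ∎

        -- The relation q · w = cM M also holds for the projected w, because M vanishes at (a , b)
        -- and hence q · v = 0. Replacing q by pᵢ q - qᵢ p clears the pivot coordinate, and p
        -- contributes nothing on the projection; the denominator becomes pᵢ cM.
        span′ : ∀ {M k} → Magic k M → (∀ i j → sgn (shrink v i j) ≡ nil → entry M i j ≡ 0) →
                ∃[ c ] ∃[ p ] c ≢ 0ℤ × (∀ i j → c ℤ.* ⟪ M ⟫ i j ≡ dot p (shrink v i j))
        span′ {M} {k} magicM vanishes
          with cM , q , cM≢0 , q·w ← span {M = M} {k = k} magicM (λ i j eq → vanishes i j (trans (sgn-shrink i j) (project-nil eq)))
          = pᵢ ℤ.* cM , Vec.removeAt combination index , *-≢0 nonzero cM≢0 , coordinates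
          where
          pᵢ qᵢ : ℤ
          pᵢ = Vec.lookup p index
          qᵢ = Vec.lookup q index
          combination : Vec ℤ (suc D)
          combination = Vec.zipWith (λ x y → pᵢ ℤ.* x ℤ.+ (ℤ.- qᵢ) ℤ.* y) q p
          q·v≡0 : dot q v ≡ 0ℤ
          q·v≡0 = begin
            dot q v  ≡⟨ q·w a b ⟨
            cM ℤ.* + entry M a b  ≡⟨ cong (λ m → cM ℤ.* + m) (vanishes a b (trans (sgn-shrink a b) project-ab)) ⟩
            cM ℤ.* 0ℤ  ≡⟨ ℤₚ.*-zeroʳ cM ⟩
            0ℤ  ∎
          combinationᵢ : Vec.lookup combination index ≡ 0ℤ
          combinationᵢ = trans (Vecₚ.lookup-zipWith _ index q p) (cancel pᵢ qᵢ)
            where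
            cancel : ∀ x y → x ℤ.* y ℤ.+ (ℤ.- y) ℤ.* x ≡ 0ℤ
            cancel = solve-∀
          q·project : ∀ i j → dot q (project v i j) ≡ cM ℤ.* ⟪ M ⟫ i j
          q·project i j = begin
            dot q (project v i j)  ≡⟨ dot-sub q (w i j) (⟪ π ⟫ i j) v ⟩
            dot q (w i j) ℤ.- ⟪ π ⟫ i j ℤ.* dot q v  ≡⟨ cong₂ (λ x y → x ℤ.- ⟪ π ⟫ i j ℤ.* y) (sym (q·w i j)) q·v≡0 ⟩
            cM ℤ.* ⟪ M ⟫ i j ℤ.- ⟪ π ⟫ i j ℤ.* 0ℤ  ≡⟨ drop₀ (cM ℤ.* ⟪ M ⟫ i j) (⟪ π ⟫ i j) ⟩
            cM ℤ.* ⟪ M ⟫ i j  ∎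
            where
            drop₀ : ∀ x y → x ℤ.- y ℤ.* 0ℤ ≡ x
            drop₀ = solve-∀
          coordinates : ∀ i j → pᵢ ℤ.* cM ℤ.* ⟪ M ⟫ i j ≡ dot (Vec.removeAt combination index) (shrink v i j)
          coordinates i j = sym (begin
            dot (Vec.removeAt combination index) (shrink v i j)
              ≡⟨ ℤₚ.+-identityˡ _ ⟨
            0ℤ ℤ.+ dot (Vec.removeAt combination index) (shrink v i j)
              ≡⟨ cong (ℤ._+ dot (Vec.removeAt combination index) (shrink v i j))
                   (trans (cong (ℤ._* Vec.lookup (project v i j) index) combinationᵢ) (ℤₚ.*-zeroˡ (Vec.lookup (project v i j) index))) ⟨
            Vec.lookup combination index ℤ.* Vec.lookup (project v i j) index ℤ.+ dot (Vec.removeAt combination index) (shrink v i j)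
              ≡⟨ dot-removeAt combination (project v i j) index ⟨
            dot combination (project v i j)
              ≡⟨ dot-linear pᵢ (ℤ.- qᵢ) q p (project v i j) ⟩
            pᵢ ℤ.* dot q (project v i j) ℤ.+ (ℤ.- qᵢ) ℤ.* dot p (project v i j)
              ≡⟨ cong₂ (λ x y → pᵢ ℤ.* x ℤ.+ (ℤ.- qᵢ) ℤ.* y) (q·project i j) (p·project i j) ⟩
            pᵢ ℤ.* (cM ℤ.* ⟪ M ⟫ i j) ℤ.+ (ℤ.- qᵢ) ℤ.* 0ℤ
              ≡⟨ regroup pᵢ cM (⟪ M ⟫ i j) qᵢ ⟩
            pᵢ ℤ.* cM ℤ.* ⟪ M ⟫ i j ∎)
            where
            regroup : ∀ x y z q → x ℤ.* (y ℤ.* z) ℤ.+ (ℤ.- q) ℤ.* 0ℤ ≡ x ℤ.* y ℤ.* z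
            regroup = solve-∀

-- The value at `nil` is a default, here and in `bump`: v is an entry of w at a position of π, hence
-- non-zero by compatibility.
bound : Sgn → ℕ → ℕ
bound neg k = k
bound nil k = suc k
bound pos k = suc k

-- The multiple of π is strict in exactly one of the two orientations. So one series gains the
-- factor q / (1 - q) and the other 1 / (1 - q), and a + b grows with the dimension.
bump : Sgn → ℕ × ℕ → ℕ × ℕ
bump neg (a , b) = suc a , b
bump nil (a , b) = a , suc b
bump pos (a , b) = a , suc b

bump-degree : ∀ s {D} ((a , b) : ℕ × ℕ) → a + b ≡ D → let (a′ , b′) = bump s (a , b) in a′ + b′ ≡ suc D
bump-degree neg (a , b) refl = refl
bump-degree nil (a , b) refl = ℕₚ.+-suc a b
bump-degree pos (a , b) refl = ℕₚ.+-suc a b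

∑<-bump : ∀ o {s} D p k → s ≢ nil →
          ∑< (compositions D (side o p)) (bound (orient o s) k) ≡ compositions (suc D) (side o (bump s p)) k
∑<-bump ⁺ {neg} D (a , b) k _ = ∑<-compositions D a k
∑<-bump ⁺ {pos} D (a , b) k _ = refl
∑<-bump ⁻ {neg} D (a , b) k _ = refl
∑<-bump ⁻ {pos} D (a , b) k _ = ∑<-compositions D b k
∑<-bump o {nil} D p k s≢nil = contradiction refl s≢nil

bound≤ : ∀ s {i k} → i ℕ.< bound s k → i ℕ.≤ k
bound≤ neg i<k       = ℕₚ.<⇒≤ i<k
bound≤ nil (s≤s i≤k) = i≤k
bound≤ pos (s≤s i≤k) = i≤k

-- The pieces of a cone pulled at π

module Pieces {e D} {w : Fin (suc e) → Fin (suc e) → Vec ℤ (suc D)} (generic : Generic w)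
              {π : Matrix (suc e)} (magicπ : Magic 1 π) (compatible : Compatible w π) where

  open Pulling generic magicπ compatible

  private
    d : ℕ
    d = suc e

  translate : ℕ → Matrix d → Matrix d
  translate t M = fromEntries λ i j → entry M i j + t * entry π i j

  entry-translate : ∀ t M i j → entry (translate t M) i j ≡ entry M i j + t * entry π i j
  entry-translate t M = entry-fromEntries λ i j → entry M i j + t * entry π i j

  translate-injective : ∀ t {M M′} → translate t M ≡ translate t M′ → M ≡ M′
  translate-injective t {M} {M′} eq = entry-injective λ i j → ℕₚ.+-cancelʳ-≡ (t * entry π i j) _ _
    (trans (sym (entry-translate t M i j)) (trans (cong (λ M → entry M i j) eq) (entry-translate t M′ i j)))

  translate-magic : ∀ t {i M} → Magic i M → Magic (i + t) (translate t M)
  translate-magic t {i} {M} magicM = lineSums⇒magic {k = i + t} (lineSums-cong (numbers i t) entries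
    (lineSums-linear 1ℤ (+ t) {f = ⟪ M ⟫} {⟪ π ⟫} (magic⇒lineSums {k = i} {M} magicM) π-sums))
    where
    numbers : ∀ i t → 1ℤ ℤ.* + i ℤ.+ + t ℤ.* 1ℤ ≡ + (i + t)
    numbers i t = trans (cong₂ ℤ._+_ (ℤₚ.*-identityˡ (+ i)) (ℤₚ.*-identityʳ (+ t))) (sym (ℤₚ.pos-+ i t))
    entries : ∀ i j → 1ℤ ℤ.* ⟪ M ⟫ i j ℤ.+ + t ℤ.* ⟪ π ⟫ i j ≡ ⟪ translate t M ⟫ i j
    entries i j = trans (cong₂ ℤ._+_ (ℤₚ.*-identityˡ (⟪ M ⟫ i j)) (sym (ℤₚ.pos-* t (entry π i j))))
      (trans (sym (ℤₚ.pos-+ (entry M i j) _)) (cong +_ (sym (entry-translate t M i j))))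

  On : Fin d → Fin d → Set
  On i j = entry π i j ≡ 1

  module _ (o : Orientation) where

    open Oriented o

    -- The squares M′ + (k − i) π with M′ on the face where the entries equal to v
    -- vanish; the bound on i says k − i ≥ 1 when v is negative.
    Slice : Vec ℤ (suc D) → ℕ → ℕ → Matrix d → Set
    Slice v k i M = ∃[ M′ ] Cone o (project v) i M′ × M ≡ translate (k ∸ i) M′

    Piece : Vec ℤ (suc D) → ℕ → Matrix d → Set
    Piece v k M = ∃[ i ] i ℕ.< bound (τ v) k × Slice v k i M

    slice-entry : ∀ {a b k i M} → On a b → Slice (w a b) k i M → entry M a b ≡ k ∸ i
    slice-entry {a} {b} {k} {i} on (M′ , C′ , refl) = trans (entry-translate (k ∸ i) M′ a b)
      (cong₂ _+_ (cone-vanishes C′ a b (At.project-ab a b on)) (trans (cong ((k ∸ i) *_) on) (ℕₚ.*-identityʳ (k ∸ i))))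

    -- The entry at (a , b) recovers k ∸ i, but this truncated difference does not determine i when
    -- i may exceed k. The line sum i + (k ∸ i) of M, equal for both slices, does.
    slice-disjoint : ∀ {a b k i j M} → On a b → Slice (w a b) k i M → Slice (w a b) k j M → i ≡ j
    slice-disjoint {a} {b} {k} {i} {j} {M} on S₁@(M₁ , cone magic₁ _ , eq₁) S₂@(M₂ , cone magic₂ _ , eq₂) =
      ℕₚ.+-cancelʳ-≡ (k ∸ i) i j (trans
        (magic-unique {M = M} (subst (Magic (i + (k ∸ i))) (sym eq₁) (translate-magic (k ∸ i) {i} {M₁} magic₁))
                              (subst (Magic (j + (k ∸ j))) (sym eq₂) (translate-magic (k ∸ j) {j} {M₂} magic₂)))
        (cong (ℕ._+_ j) (trans (sym (slice-entry on S₂)) (slice-entry on S₁))))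

    piece-count : ∀ {a b} → On a b → (decomposition : Decomposition (shrink (w a b))) → ∀ k →
                  Count (Piece (w a b) k)
                    (∑∈ (λ p → compositions (suc D) (side o (bump (sgn (w a b)) p)) k) (Decomposition.pieces decomposition))
    piece-count {a} {b} on decomposition k = subst (Count _) size
      (count-∑< (slice-disjoint on) (λ i → count-image (translate (k ∸ i)) (translate-injective (k ∸ i))
        (count-⇔ (unshrink i) (shrink′ i) (counts o i))) (bound (τ (w a b)) k))
      where
      open Decomposition decomposition
      unshrink : ∀ i {M} → Cone o (shrink (w a b)) i M → Cone o (project (w a b)) i M
      unshrink _ {M} (cone magicM ok) = cone magicM λ i j →
        subst (λ s → Ok (orient o s) (entry M i j)) (At.sgn-shrink a b on i j) (ok i j)
      shrink′ : ∀ i {M} → Cone o (project (w a b)) i M → Cone o (shrink (w a b)) i M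
      shrink′ _ {M} (cone magicM ok) = cone magicM λ i j →
        subst (λ s → Ok (orient o s) (entry M i j)) (sym (At.sgn-shrink a b on i j)) (ok i j)
      v≢nil : sgn (w a b) ≢ nil
      v≢nil = case compatible a b of λ { (inj₁ π≡0) _ → case trans (sym on) π≡0 of λ () ; (inj₂ ≢nil) → ≢nil }
      size : ∑< (λ i → ∑∈ (λ p → compositions D (side o p) i) pieces) (bound (τ (w a b)) k) ≡
             ∑∈ (λ p → compositions (suc D) (side o (bump (sgn (w a b)) p)) k) pieces
      size = trans (∑<-∑∈ (λ p i → compositions D (side o p) i) (bound (τ (w a b)) k) pieces)
                   (∑∈-cong (λ p → ∑<-bump o D p k v≢nil) pieces)

    -- The delicate positions are those of π where w is negative and M must not vanish. If v is
    -- negative, the multiple t of π is at least 1. Otherwise w x y - v is negative, and M′ is at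
    -- least 1 there already.
    piece⇒cone : ∀ {a b k M} → On a b → Piece (w a b) k M → Cone o w k M
    piece⇒cone {a} {b} {k} on (i , i<bound , M′ , cone magic′ ok′ , refl) =
      cone (subst (λ k → Magic k (translate t M′)) (ℕₚ.m+[n∸m]≡n (bound≤ (τ v) i<bound)) (translate-magic t {i} {M′} magic′))
           λ x y → subst (Ok (τ (w x y))) (sym (entry-translate t M′ x y)) (ok x y (π-cases x y))
      where
      v : Vec ℤ (suc D)
      v = w a b
      t : ℕ
      t = k ∸ i
      v≢nil : sgn v ≢ nil
      v≢nil = case compatible a b of λ { (inj₁ π≡0) _ → case trans (sym on) π≡0 of λ () ; (inj₂ ≢nil) → ≢nil }
      positive : ∀ s → i ℕ.< bound s k → s ≡ neg → 1 ℕ.≤ t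
      positive neg i<k refl = ℕₚ.m<n⇒0<n∸m i<k
      on-π : ∀ x y → On x y → Ok (τ (w x y)) (entry M′ x y + t)
      on-π x y onxy with τ (w x y) in eq
      ... | pos = tt
      ... | nil = case compatible x y of λ
        { (inj₁ π≡0)  → case trans (sym onxy) π≡0 of λ ()
        ; (inj₂ ≢nil) → contradiction (τ-nil (w x y) eq) ≢nil }
      ... | neg with neg? (τ v)
      ...   | yes v-neg = ℕₚ.≤-trans (positive (τ v) i<bound v-neg) (ℕₚ.m≤n+m t (entry M′ x y))
      ...   | no  v≢neg = ℕₚ.≤-trans (subst (λ s → Ok s (entry M′ x y))
                (trans (cong τ (project-on v onxy)) (τ-neg-minus (w x y) v eq v≢neg)) (ok′ x y)) (ℕₚ.m≤m+n (entry M′ x y) t)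
      ok : ∀ x y → entry π x y ≡ 0 ⊎ entry π x y ≡ 1 → Ok (τ (w x y)) (entry M′ x y + t * entry π x y)
      ok x y (inj₁ π≡0) = subst₂ (λ u m → Ok (τ u) m) (project-off v π≡0)
        (sym (trans (cong (λ m → entry M′ x y + t * m) π≡0) (trans (cong (ℕ._+_ (entry M′ x y)) (ℕₚ.*-zeroʳ t)) (ℕₚ.+-identityʳ _)))) (ok′ x y)
      ok x y (inj₂ onxy) = subst (Ok (τ (w x y)))
        (sym (trans (cong (λ m → entry M′ x y + t * m) onxy) (cong (ℕ._+_ (entry M′ x y)) (ℕₚ.*-identityʳ t)))) (on-π x y onxy)

    -- (a , b) is an entry of π where M is minimal, ties being broken by w.
    cone⇒piece : ∀ {a b k M} → On a b → Cone o w k M →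
                 (∀ {x y} → On x y → entry M a b ℕ.< entry M x y ⊎ (entry M a b ≡ entry M x y × w a b ≼ w x y)) →
                 Piece (w a b) k M
    cone⇒piece {a} {b} {k} {M} on C₁@(cone magicM ok) least =
      k ∸ t , below (τ v) (ok a b) , M′ , cone magic′ (λ x y → ok′ x y (π-cases x y)) ,
      entry-injective λ x y → sym (trans (entry-translate (k ∸ (k ∸ t)) M′ x y)
        (trans (cong (λ t → entry M′ x y + t * entry π x y) (ℕₚ.m∸[m∸n]≡n t≤k)) (restore x y)))
      where
      v : Vec ℤ (suc D)
      v = w a b
      t : ℕ
      t = entry M a b
      t≤k : t ℕ.≤ k
      t≤k = magic-entry≤ {M = M} magicM a b
      below : ∀ s → Ok s t → k ∸ t ℕ.< bound s k
      below neg 0<t = ℕₚ.∸-monoʳ-< 0<t t≤k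
      below nil _   = s≤s (ℕₚ.m∸n≤m k t)
      below pos _   = s≤s (ℕₚ.m∸n≤m k t)
      M′ : Matrix d
      M′ = fromEntries λ x y → entry M x y ∸ t * entry π x y
      entry-M′ : ∀ x y → entry M′ x y ≡ entry M x y ∸ t * entry π x y
      entry-M′ = entry-fromEntries λ x y → entry M x y ∸ t * entry π x y
      off : ∀ x y → entry π x y ≡ 0 → entry M′ x y ≡ entry M x y
      off x y π≡0 = trans (entry-M′ x y) (trans (cong (λ m → entry M x y ∸ t * m) π≡0) (cong (entry M x y ∸_) (ℕₚ.*-zeroʳ t)))
      on′ : ∀ x y → On x y → entry M′ x y ≡ entry M x y ∸ t
      on′ x y onxy = trans (entry-M′ x y) (trans (cong (λ m → entry M x y ∸ t * m) onxy) (cong (entry M x y ∸_) (ℕₚ.*-identityʳ t)))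
      t≤ : ∀ x y → On x y → t ℕ.≤ entry M x y
      t≤ x y onxy = case least onxy of λ { (inj₁ t<) → ℕₚ.<⇒≤ t< ; (inj₂ (t≡ , _)) → ℕₚ.≤-reflexive t≡ }
      tπ≤ : ∀ x y → t * entry π x y ℕ.≤ entry M x y
      tπ≤ x y = case π-cases x y of λ
        { (inj₁ π≡0)  → subst (ℕ._≤ entry M x y) (sym (trans (cong (t *_) π≡0) (ℕₚ.*-zeroʳ t))) z≤n
        ; (inj₂ onxy) → subst (ℕ._≤ entry M x y) (sym (trans (cong (t *_) onxy) (ℕₚ.*-identityʳ t))) (t≤ x y onxy) }
      restore : ∀ x y → entry M′ x y + t * entry π x y ≡ entry M x y
      restore x y = trans (cong (_+ t * entry π x y) (entry-M′ x y)) (ℕₚ.m∸n+n≡m (tπ≤ x y))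
      magic′ : Magic (k ∸ t) M′
      magic′ = lineSums⇒magic {k = k ∸ t} (lineSums-cong
        (trans (as-difference (+ k) (+ t) 1ℤ) (trans (cong (λ z → + k ℤ.- z) (ℤₚ.*-identityʳ (+ t))) (difference t≤k)))
        (λ x y → trans (as-difference (⟪ M ⟫ x y) (+ t) (⟪ π ⟫ x y))
          (trans (cong (λ z → ⟪ M ⟫ x y ℤ.- z) (sym (ℤₚ.pos-* t (entry π x y))))
            (trans (difference (tπ≤ x y)) (cong +_ (sym (entry-M′ x y))))))
        (lineSums-linear 1ℤ (ℤ.- + t) {f = ⟪ M ⟫} {⟪ π ⟫} (magic⇒lineSums {k = k} {M} magicM) π-sums))
        where
        as-difference : ∀ x y z → 1ℤ ℤ.* x ℤ.+ (ℤ.- y) ℤ.* z ≡ x ℤ.- y ℤ.* z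
        as-difference = solve-∀
        difference : ∀ {m n} → n ℕ.≤ m → + m ℤ.- + n ≡ + (m ∸ n)
        difference {m} {n} n≤m = trans (ℤₚ.m-n≡m⊖n m n) (ℤₚ.⊖-≥ n≤m)
      -- A multiple of M is a combination of the coordinates of w, so equal entries of w force equal
      -- entries of M; thus M′ vanishes wherever the projected w does.
      equal : ∀ x y → sgn (w x y ⊖ v) ≡ nil → entry M x y ≡ t
      equal x y eq with c′ , q , c′≢0 , q·w ← Generic.span generic {M} {k} magicM (cone-vanishes C₁) =
        ℤₚ.+-injective (ℤₚ.*-cancelˡ-≡ c′ (⟪ M ⟫ x y) (+ t) {{ℤ.≢-nonZero c′≢0}} (begin
          c′ ℤ.* ⟪ M ⟫ x y  ≡⟨ q·w x y ⟩
          dot q (w x y)  ≡⟨ ℤₚ.i-j≡0⇒i≡j _ _ (begin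
            dot q (w x y) ℤ.- dot q v  ≡⟨ cong (λ z → dot q (w x y) ℤ.- z) (ℤₚ.*-identityˡ (dot q v)) ⟨
            dot q (w x y) ℤ.- 1ℤ ℤ.* dot q v  ≡⟨ dot-sub q (w x y) 1ℤ v ⟨
            dot q (w x y - 1ℤ · v)  ≡⟨ cong (dot q) (-1· (w x y) v) ⟩
            dot q (w x y ⊖ v)  ≡⟨ dot-nilʳ q (w x y ⊖ v) eq ⟩
            0ℤ  ∎) ⟩
          dot q v  ≡⟨ q·w a b ⟨
          c′ ℤ.* + t  ∎))
        where open ≡-Reasoning
      ok″ : ∀ x y → On x y → Ok (τ (w x y ⊖ v)) (entry M x y ∸ t)
      ok″ x y onxy with τ (w x y ⊖ v) in eq
      ... | pos = tt
      ... | nil = trans (cong (_∸ t) (equal x y (τ-nil (w x y ⊖ v) eq))) (ℕₚ.n∸n≡0 t)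
      ... | neg with least onxy
      ...   | inj₁ t<        = ℕₚ.m<n⇒0<n∸m t<
      ...   | inj₂ (_ , v≼) = contradiction eq v≼
      ok′ : ∀ x y → entry π x y ≡ 0 ⊎ entry π x y ≡ 1 → Ok (τ (project v x y)) (entry M′ x y)
      ok′ x y (inj₁ π≡0)  = subst₂ (λ u m → Ok (τ u) m) (sym (project-off v π≡0)) (sym (off x y π≡0)) (ok x y)
      ok′ x y (inj₂ onxy) = subst₂ (λ u m → Ok (τ u) m) (sym (project-on v onxy)) (sym (on′ x y onxy)) (ok″ x y onxy)

    -- M′ vanishes at (a , b). At (x , y) it is either positive, and then M is larger there, or
    -- zero, and then w x y - w a b cannot be negative, since a negative sign asks for at least 1.
    -- So a piece knows the minimal position up to the value of w, which makes the pieces disjoint.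
    piece-least : ∀ {a b x y k M} → On a b → On x y → Piece (w a b) k M →
                  entry M a b ℕ.< entry M x y ⊎ (entry M a b ≡ entry M x y × w a b ≼ w x y)
    piece-least {a} {b} {x} {y} {k} {M} on onxy (i , _ , S@(M′ , cone _ ok′ , refl))
      with entry M′ x y in M′≡ | subst₂ (λ u m → Ok (τ u) m) (project-on (w a b) onxy) refl (ok′ x y)
    ... | suc m | _ = inj₁ (begin-strict
          entry M a b  ≡⟨ slice-entry on S ⟩
          k ∸ i  <⟨ s≤s (ℕₚ.m≤n+m (k ∸ i) m) ⟩
          suc m + (k ∸ i)  ≡⟨ entry-xy ⟨
          entry M x y  ∎)
      where
      open ℕₚ.≤-Reasoning
      entry-xy : entry M x y ≡ suc m + (k ∸ i)
      entry-xy = trans (entry-translate (k ∸ i) M′ x y) (cong₂ _+_ M′≡ (trans (cong ((k ∸ i) *_) onxy) (ℕₚ.*-identityʳ (k ∸ i))))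
    ... | zero | ok = inj₂ (trans (slice-entry on S) (sym entry-xy) , λ neg → case subst (λ s → Ok s 0) neg ok of λ ())
      where
      entry-xy : entry M x y ≡ k ∸ i
      entry-xy = trans (entry-translate (k ∸ i) M′ x y) (cong₂ _+_ M′≡ (trans (cong ((k ∸ i) *_) onxy) (ℕₚ.*-identityʳ (k ∸ i))))

    ⊖-nil : ∀ {n} (u v : Vec ℤ n) → sgn (u ⊖ v) ≡ nil → u ≡ v
    ⊖-nil u v eq = lookup-injective λ i → ℤₚ.i-j≡0⇒i≡j _ _
      (trans (sym (Vecₚ.lookup-zipWith ℤ._-_ i u v)) (sgn-nil (u ⊖ v) eq i))

    piece-disjoint : ∀ {a b x y k M} → On a b → On x y → Piece (w a b) k M → Piece (w x y) k M → w a b ≡ w x y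
    piece-disjoint {a} {b} {x} {y} on onxy P₁ P₂ with piece-least on onxy P₁ | piece-least onxy on P₂
    ... | inj₁ lt       | inj₁ gt       = contradiction lt (ℕₚ.<⇒≯ gt)
    ... | inj₁ lt       | inj₂ (eq , _)  = contradiction (sym eq) (ℕₚ.<⇒≢ lt)
    ... | inj₂ (eq , _)  | inj₁ gt       = contradiction (sym eq) (ℕₚ.<⇒≢ gt)
    ... | inj₂ (_ , le) | inj₂ (_ , ge) = ⊖-nil (w a b) (w x y) (≼-antisym {u = w a b} {w x y} le ge)

  positions : List (Fin d × Fin d)
  positions = List.filter (λ (i , j) → entry π i j ℕₚ.≟ 1) (List.cartesianProduct (List.allFin d) (List.allFin d))

  position-on : ∀ {i j} → (i , j) ∈ positions → On i j
  position-on ij∈ = proj₂ (∈ₚ.∈-filter⁻ (λ (i , j) → entry π i j ℕₚ.≟ 1) {xs = List.cartesianProduct (List.allFin d) (List.allFin d)} ij∈)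

  on-position : ∀ {i j} → On i j → (i , j) ∈ positions
  on-position {i} {j} on = ∈ₚ.∈-filter⁺ (λ (i , j) → entry π i j ℕₚ.≟ 1)
    (∈ₚ.∈-cartesianProduct⁺ (∈ₚ.∈-allFin i) (∈ₚ.∈-allFin j)) on

  _≟ᵛ_ : (u v : Vec ℤ (suc D)) → Dec (u ≡ v)
  _≟ᵛ_ = Vecₚ.≡-dec ℤₚ._≟_

  -- Positions with equal entries of w share one and the same piece, which must be counted once.
  values : List (Vec ℤ (suc D))
  values = List.deduplicate _≟ᵛ_ (List.map (λ (i , j) → w i j) positions)

  value-on : ∀ {v} → v ∈ values → ∃[ i ] ∃[ j ] On i j × v ≡ w i j
  value-on v∈ with (i , j) , ij∈ , eq ← ∈ₚ.∈-map⁻ (λ (i , j) → w i j) (∈ₚ.∈-deduplicate⁻ _≟ᵛ_ (List.map (λ (i , j) → w i j) positions) v∈) =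
    i , j , position-on ij∈ , eq

  cone-piece : ∀ o {k M} → Cone o w k M → ∃[ v ] v ∈ values × Piece o v k M
  cone-piece o {k} {M} C₁ =
    let a , b , π≢0 = magic₁-nonzero {P = π} magicπ
        on = Sum.fromInj₂ (λ π≡0 → contradiction π≡0 π≢0) (π-cases a b)
        (x , y) , xy∈ , least = minimum {_≲_ = _≲_} ≲-total (λ {p} {q} {r} → ≲-trans {p} {q} {r}) (on-position on)
    in w x y , ∈ₚ.∈-deduplicate⁺ _≟ᵛ_ (∈ₚ.∈-map⁺ (λ (i , j) → w i j) xy∈) ,
       cone⇒piece o (position-on xy∈) C₁ (least ∘ on-position)
    where
    open Oriented o
    _≲_ : Fin d × Fin d → Fin d × Fin d → Set
    (i , j) ≲ (i′ , j′) = entry M i j ℕ.< entry M i′ j′ ⊎ (entry M i j ≡ entry M i′ j′ × w i j ≼ w i′ j′)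
    ≲-total : ∀ p q → p ≲ q ⊎ q ≲ p
    ≲-total (i , j) (i′ , j′) with ℕₚ.<-cmp (entry M i j) (entry M i′ j′)
    ... | tri< lt _ _ = inj₁ (inj₁ lt)
    ... | tri> _ _ gt = inj₂ (inj₁ gt)
    ... | tri≈ _ eq _ = Sum.map (λ le → inj₂ (eq , le)) (λ ge → inj₂ (sym eq , ge)) (≼-total (w i j) (w i′ j′))
    ≲-trans : ∀ {p q r} → p ≲ q → q ≲ r → p ≲ r
    ≲-trans (inj₁ <₁)       (inj₁ <₂)       = inj₁ (ℕₚ.<-trans <₁ <₂)
    ≲-trans (inj₁ <₁)       (inj₂ (≡₂ , _)) = inj₁ (ℕₚ.<-≤-trans <₁ (ℕₚ.≤-reflexive ≡₂))
    ≲-trans (inj₂ (≡₁ , _)) (inj₁ <₂)       = inj₁ (ℕₚ.≤-<-trans (ℕₚ.≤-reflexive ≡₁) <₂)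
    ≲-trans {i , j} {i′ , j′} {i″ , j″} (inj₂ (≡₁ , ≼₁)) (inj₂ (≡₂ , ≼₂)) =
      inj₂ (trans ≡₁ ≡₂ , ≼-trans {u = w i j} {w i′ j′} {w i″ j″} ≼₁ ≼₂)

  module _ (decompose : ∀ {a b} → On a b → Decomposition (shrink (w a b))) where

    record Partial (vs : List (Vec ℤ (suc D))) : Set where
      field
        pieces  : List (ℕ × ℕ)
        degrees : ListAll.All (λ (a , b) → a + b ≡ suc D) pieces
        counts  : ∀ o k → Count (λ M → ∃[ v ] v ∈ vs × Piece o v k M) (∑∈ (λ p → compositions (suc D) (side o p) k) pieces)

    partial : ∀ vs → Unique vs → (∀ {v} → v ∈ vs → v ∈ values) → Partial vs
    partial []       _        _  = record { pieces = [] ; degrees = [] ; counts = λ o k → count-∅ λ { _ (_ , () , _) } }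
    partial (v ∷ vs) (v∉ ∷ u) vs⊆ with a , b , on , refl ← value-on (vs⊆ (here refl)) = record
      { pieces  = new List.++ Rest.pieces
      ; degrees = ListAllₚ.++⁺ (ListAllₚ.map⁺ (ListAll.map (λ {p} → bump-degree (sgn v) p) First.degrees)) Rest.degrees
      ; counts  = λ o k → count-⇔
          (λ { (inj₁ P) → v , here refl , P ; (inj₂ (u , u∈ , P)) → u , there u∈ , P })
          (λ { (u , here refl , P) → inj₁ P ; (u , there u∈ , P) → inj₂ (u , u∈ , P) })
          (subst (Count _) (size o k) (count-⊎ (disjoint o) (piece-count o on (decompose on) k) (Rest.counts o k))) }
      where
      module First = Decomposition (decompose on)
      module Rest = Partial (partial vs u (vs⊆ ∘ there))
      new : List (ℕ × ℕ)
      new = List.map (bump (sgn v)) First.pieces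
      size : ∀ o k → ∑∈ (λ p → compositions (suc D) (side o (bump (sgn v) p)) k) First.pieces +
                     ∑∈ (λ p → compositions (suc D) (side o p) k) Rest.pieces ≡
                     ∑∈ (λ p → compositions (suc D) (side o p) k) (new List.++ Rest.pieces)
      size o k = sym (trans (∑∈-++ (λ p → compositions (suc D) (side o p) k) new Rest.pieces)
        (cong (_+ _) (∑∈-map (λ p → compositions (suc D) (side o p) k) (bump (sgn v)) First.pieces)))
      disjoint : ∀ o {k M} → Piece o v k M → ¬ (∃[ u ] u ∈ vs × Piece o u k M)
      disjoint o P₁ (u , u∈ , P₂) with x , y , onxy , refl ← value-on (vs⊆ (there u∈)) =
        ListAllₚ.All¬⇒¬Any v∉ (subst (_∈ vs) (sym (piece-disjoint o on onxy P₁ P₂)) u∈)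

    assemble : Decomposition w
    assemble = record { pieces = pieces ; degrees = degrees ; counts = λ o k → count-⇔
      (λ (v , v∈ , P) → case value-on v∈ of λ { (a , b , on , refl) → piece⇒cone o on P })
      (cone-piece o) (counts o k) }
      where open Partial (partial values (DecUniqueₚ.deduplicate-! _≟ᵛ_ _) id)

-- In dimension 0 all entries of w vanish and only the zero matrix remains. In positive dimension,
-- if no permutation matrix is compatible with w, both cones are empty in every degree, 0 included,
-- and the empty list of pairs is correct.
decompose : ∀ {e} D {w : Fin (suc e) → Fin (suc e) → Vec ℤ D} → Generic w → Decomposition w
decompose {e} zero {w} generic = record
  { pieces = (0 , 0) ∷ [] ; degrees = refl ∷ [] ; counts = counts }
  where
  vanishes : ∀ {o k M} → Cone o w k M → ∀ i j → entry M i j ≡ 0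
  vanishes C₁ i j = cone-vanishes C₁ i j (empty (w i j))
    where
    empty : (v : Vec ℤ 0) → sgn v ≡ nil
    empty [] = refl
  O : Matrix (suc e)
  O = fromEntries λ _ _ → 0
  entry-O : ∀ i j → entry O i j ≡ 0
  entry-O = entry-fromEntries λ _ _ → 0
  O-magic : Magic 0 O
  O-magic = lineSums⇒magic {k = 0} ((λ i → sumℤ-zero λ j → cong +_ (entry-O i j)) , (λ j → sumℤ-zero λ i → cong +_ (entry-O i j)))
  ok-nil : ∀ o (v : Vec ℤ 0) → Ok (orient o (sgn v)) 0
  ok-nil ⁺ [] = refl
  ok-nil ⁻ [] = refl
  side₀ : ∀ o → side o (0 , 0) ≡ 0
  side₀ ⁺ = refl
  side₀ ⁻ = refl
  counts : ∀ o k → Count (Cone o w k) (∑∈ (λ p → compositions 0 (side o p) k) ((0 , 0) ∷ []))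
  counts o k rewrite side₀ o with k
  ... | zero  = count-singleton O
    (cone O-magic λ i j → subst (Ok (orient o (sgn (w i j)))) (sym (entry-O i j)) (ok-nil o (w i j)))
    λ C₁ → entry-injective λ i j → trans (vanishes C₁ i j) (sym (entry-O i j))
  ... | suc k = count-∅ λ M C₁ → case trans (sym (proj₁ (magic⇒lineSums {k = suc k} {M} (Cone.magic C₁)) zero))
    (sumℤ-zero {f = ⟪ M ⟫ zero} λ j → cong +_ (vanishes C₁ zero j)) of λ ()
decompose {e} (suc D) {w} generic with ListAny.any? (compatible? w) (magicSquares (suc e) 1)
... | no none = record
  { pieces = [] ; degrees = []
  ; counts = λ o k → count-∅ λ M C₁ → case cone-nonempty generic C₁ of λ
      { (P , magicP , compatible) → none (ListAny.map (λ { refl → compatible }) (∈-magicSquares {k = 1} magicP)) } }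
... | yes some with π , π∈ , compatible ← find some = Pieces.assemble generic magicπ compatible λ {a} {b} on →
  decompose D (Pulling.At.shrink-generic generic magicπ compatible a b on)
  where
  magicπ : Magic 1 π
  magicπ = magicSquares-magic {k = 1} π∈

-- Matrices with line sums 1, in the coordinates of their lower right block

coef : Fin e → Fin (suc e) → ℤ
coef a zero    = -1ℤ
coef a (suc i) = δ a i

sumℤ-coef : (a : Fin e) → sumℤ (coef a) ≡ 0ℤ
sumℤ-coef a = cong (ℤ._+_ -1ℤ) (sumℤ-δ-1 a)

-- E_{ab} − E_{a0} − E_{0b} + E_{00}
corner : Fin e × Fin e → Fin (suc e) → Fin (suc e) → ℤ
corner (a , b) i j = coef a i ℤ.* coef b j

corner-sums : ∀ (ab : Fin e × Fin e) → LineSums 0ℤ (corner ab)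
corner-sums (a , b) =
  (λ i → trans (sym (Σℤ.*-distribˡ-sum (coef a i) (coef b))) (trans (cong (coef a i ℤ.*_) (sumℤ-coef b)) (ℤₚ.*-zeroʳ (coef a i)))) ,
  (λ j → trans (sym (Σℤ.*-distribʳ-sum (coef b j) (coef a))) (trans (cong (ℤ._* coef b j) (sumℤ-coef a)) (ℤₚ.*-zeroˡ (coef b j))))

basis : Fin (e * e) → Fin (suc e) → Fin (suc e) → ℤ
basis {e} x = corner (Fin.remQuot {e} e x)

corner-combine : ∀ (a b : Fin e) → basis {e} (Fin.combine a b) (suc a) (suc b) ≡ 1ℤ
corner-combine a b = trans (cong (λ y → corner y (suc a) (suc b)) (Finₚ.remQuot-combine a b)) (cong₂ ℤ._*_ (δ-refl a) (δ-refl b))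

corner-≢ : ∀ {a b : Fin e} x → x ≢ Fin.combine a b → basis {e} x (suc a) (suc b) ≡ 0ℤ
corner-≢ {e} {a} {b} x x≢ with proj₁ (Fin.remQuot {e} e x) Finₚ.≟ a | proj₂ (Fin.remQuot {e} e x) Finₚ.≟ b
... | no ≢a | _     = trans (cong (ℤ._* coef (proj₂ (Fin.remQuot {e} e x)) (suc b)) (δ-≢ ≢a)) (ℤₚ.*-zeroˡ (coef (proj₂ (Fin.remQuot {e} e x)) (suc b)))
... | yes _ | no ≢b = trans (cong (coef (proj₁ (Fin.remQuot {e} e x)) (suc a) ℤ.*_) (δ-≢ ≢b)) (ℤₚ.*-zeroʳ (coef (proj₁ (Fin.remQuot {e} e x)) (suc a)))
... | yes ≡a | yes ≡b = contradiction (trans (sym (Finₚ.combine-remQuot {e} e x)) (cong₂ Fin.combine ≡a ≡b)) x≢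

-- The only matrix with line sums 1 whose lower right block is 0.
origin : Fin (suc e) → Fin (suc e) → ℤ
origin {e} zero zero    = 1ℤ ℤ.- + e
origin     zero (suc b) = 1ℤ
origin     (suc a) zero = 1ℤ
origin  (suc a) (suc b) = 0ℤ

sumℤ-const : ∀ len → sumℤ {len} (λ _ → 1ℤ) ≡ + len
sumℤ-const zero    = refl
sumℤ-const (suc len) = cong (ℤ._+_ 1ℤ) (sumℤ-const len)

origin-sums : LineSums 1ℤ (origin {e})
origin-sums {e} = (λ { zero → top ; (suc a) → cong (ℤ._+_ 1ℤ) (sumℤ-zero {e} λ _ → refl) }) ,
                  (λ { zero → top ; (suc b) → cong (ℤ._+_ 1ℤ) (sumℤ-zero {e} λ _ → refl) })
  where
  cancel : ∀ x → 1ℤ ℤ.- x ℤ.+ x ≡ 1ℤ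
  cancel = solve-∀
  top : 1ℤ ℤ.- + e ℤ.+ sumℤ {e} (λ _ → 1ℤ) ≡ 1ℤ
  top = trans (cong (ℤ._+_ (1ℤ ℤ.- + e)) (sumℤ-const e)) (cancel (+ e))

-- Used over ℤ for lattice points, over ℝ for the chart, and over ℚ for the single terms of Cauchy
-- sequences.
module BlockCoordinates (R : CommutativeRing 0ℓ 0ℓ) (ι : ℤ → CommutativeRing.Carrier R)
  (ι-+ : ∀ a b → CommutativeRing._≈_ R (ι (a ℤ.+ b)) (CommutativeRing._+_ R (ι a) (ι b)))
  (ι-0 : CommutativeRing._≈_ R (ι 0ℤ) (CommutativeRing.0# R))
  (ι-1 : CommutativeRing._≈_ R (ι 1ℤ) (CommutativeRing.1# R)) where

  open CommutativeRing R hiding (zero) renaming (_+_ to _⊕_; _*_ to _⊗_; sym to ≈-sym; trans to ≈-trans; refl to ≈-refl)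
  open Algebra.Properties.Group +-group using (∙-cancelʳ)
  open import Relation.Binary.Reasoning.Setoid setoid
  module S = Algebra.Properties.Semiring.Sum semiring

  Sums : Carrier → (Fin len × Fin len → Carrier) → Set
  Sums k f = (∀ i → S.sum (λ j → f (i , j)) ≈ k) × (∀ j → S.sum (λ i → f (i , j)) ≈ k)

  sum-zero : ∀ {f : Fin len → Carrier} → (∀ i → f i ≈ 0#) → S.sum f ≈ 0#
  sum-zero {len} f≈0 = ≈-trans (S.sum-cong-≋ f≈0) (S.sum-replicate-zero len)

  sum-single : ∀ {f : Fin len → Carrier} i → (∀ j → j ≢ i → f j ≈ 0#) → S.sum f ≈ f i
  sum-single {suc len} {f} zero others =
    ≈-trans (+-congˡ (sum-zero {len} {f ∘ suc} λ j → others (suc j) λ ())) (+-identityʳ (f zero))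
  sum-single {suc len} {f} (suc i) others =
    ≈-trans (+-cong (others zero λ ()) (sum-single {len} {f ∘ suc} i λ j j≢i → others (suc j) (j≢i ∘ Finₚ.suc-injective))) (+-identityˡ (f (suc i)))

  ι-sum : ∀ (f : Fin len → ℤ) → ι (sumℤ f) ≈ S.sum (ι ∘ f)
  ι-sum {zero}  f = ι-0
  ι-sum {suc len} f = ≈-trans (ι-+ (f zero) (sumℤ (f ∘ suc))) (+-congˡ (ι-sum (f ∘ suc)))

  block-determines : ∀ {k} {f g : Fin (suc e) × Fin (suc e) → Carrier} → Sums k f → Sums k g →
                     (∀ a b → f (suc a , suc b) ≈ g (suc a , suc b)) → ∀ ij → f ij ≈ g ij
  block-determines {e} {f = f} {g} (rows , cols) (rows′ , cols′) block (i , j) = from-tail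
    {λ i → f (i , j)} {λ i → g (i , j)} (≈-trans (cols j) (≈-sym (cols′ j)))
    (λ a → from-tail {λ j → f (suc a , j)} {λ j → g (suc a , j)} (≈-trans (rows (suc a)) (≈-sym (rows′ (suc a)))) (block a) j) i
    where
    from-tail : ∀ {f g : Fin (suc e) → Carrier} → S.sum f ≈ S.sum g → (∀ a → f (suc a) ≈ g (suc a)) → ∀ i → f i ≈ g i
    from-tail {f} {g} eq tail zero = ∙-cancelʳ (S.sum (f ∘ suc)) (f zero) (g zero)
      (≈-trans eq (+-congˡ (≈-sym (S.sum-cong-≋ tail))))
    from-tail eq tail (suc a) = tail a

  private
    affine-line : ∀ {m} (c : Fin m → Carrier) (p : Fin m → Fin len → Carrier) {s} → (∀ k → S.sum (p k) ≈ s) →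
                  S.sum (λ j → S.sum (λ k → c k ⊗ p k j)) ≈ S.sum c ⊗ s
    affine-line c p {s} sums = begin
      S.sum (λ j → S.sum (λ k → c k ⊗ p k j))  ≈⟨ S.∑-comm (λ j k → c k ⊗ p k j) ⟩
      S.sum (λ k → S.sum (λ j → c k ⊗ p k j))  ≈⟨ S.sum-cong-≋ (λ k → ≈-trans (≈-sym (S.*-distribˡ-sum (c k) (p k))) (*-congˡ (sums k))) ⟩
      S.sum (λ k → c k ⊗ s)  ≈⟨ S.*-distribʳ-sum s c ⟨
      S.sum c ⊗ s  ∎

  affine-sums : ∀ {m} (c : Fin m → Carrier) (p : Fin m → Fin len × Fin len → Carrier) → (∀ k → Sums 1# (p k)) →
                Sums (S.sum c) (λ ij → S.sum (λ k → c k ⊗ p k ij))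
  affine-sums c p sums =
    (λ i → ≈-trans (affine-line c (λ k j → p k (i , j)) λ k → proj₁ (sums k) i) (*-identityʳ (S.sum c))) ,
    (λ j → ≈-trans (affine-line c (λ k i → p k (i , j)) λ k → proj₂ (sums k) j) (*-identityʳ (S.sum c)))

  affine-hull-sums : ∀ {m} (c : Fin m → Carrier) (p : Fin m → Fin len × Fin len → Carrier) → (∀ k → Sums 1# (p k)) →
                     S.sum c ≈ 1# → ∀ {y} → (∀ ij → y ij ≈ S.sum (λ k → c k ⊗ p k ij)) → Sums 1# y
  affine-hull-sums c p sums c≈1 y≈ =
    (λ i → ≈-trans (S.sum-cong-≋ λ j → y≈ (i , j)) (≈-trans (proj₁ (affine-sums c p sums) i) c≈1)) ,
    (λ j → ≈-trans (S.sum-cong-≋ λ i → y≈ (i , j)) (≈-trans (proj₂ (affine-sums c p sums) j) c≈1))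

  -- Over ℝ this unfolds to `LatticeChart.point` of the chart built from `origin` and `basis`, so
  -- the results below apply to the chart directly.
  pointᴿ : (Fin (e * e) → Carrier) → Fin (suc e) × Fin (suc e) → Carrier
  pointᴿ {e} t (i , j) = ι (origin i j) ⊕ S.sum (λ x → t x ⊗ ι (basis {e} x i j))

  point-sums : ∀ (t : Fin (e * e) → Carrier) → Sums 1# (pointᴿ t)
  point-sums {e} t =
    (λ i → line (origin i) (λ x → basis {e} x i) (proj₁ origin-sums i) (λ x → proj₁ (corner-sums (Fin.remQuot {e} e x)) i)) ,
    (λ j → line (λ i → origin i j) (λ x i → basis {e} x i j) (proj₂ origin-sums j) (λ x → proj₂ (corner-sums (Fin.remQuot {e} e x)) j))
    where
    line : ∀ {len} (o : Fin len → ℤ) (c : Fin (e * e) → Fin len → ℤ) → sumℤ o ≡ 1ℤ → (∀ x → sumℤ (c x) ≡ 0ℤ) →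
           S.sum (λ j → ι (o j) ⊕ S.sum (λ x → t x ⊗ ι (c x j))) ≈ 1#
    line o c o≡1 c≡0 = begin
      S.sum (λ j → ι (o j) ⊕ S.sum (λ x → t x ⊗ ι (c x j)))
        ≈⟨ S.∑-distrib-+ (ι ∘ o) (λ j → S.sum (λ x → t x ⊗ ι (c x j))) ⟩
      S.sum (ι ∘ o) ⊕ S.sum (λ j → S.sum (λ x → t x ⊗ ι (c x j)))
        ≈⟨ +-cong (≈-trans (≈-sym (ι-sum o)) (≈-trans (reflexive (cong ι o≡1)) ι-1))
                  (affine-line t (λ x j → ι (c x j)) λ x → ≈-trans (≈-sym (ι-sum (c x))) (≈-trans (reflexive (cong ι (c≡0 x))) ι-0)) ⟩
      1# ⊕ S.sum t ⊗ 0#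
        ≈⟨ ≈-trans (+-congˡ (zeroʳ (S.sum t))) (+-identityʳ 1#) ⟩
      1# ∎

  -- Restricted to the lower right block, the corner matrices are the matrix units.
  linear-block : ∀ (t : Fin (e * e) → Carrier) a b →
                 S.sum (λ x → t x ⊗ ι (basis {e} x (suc a) (suc b))) ≈ t (Fin.combine a b)
  linear-block {e} t a b = ≈-trans
    (sum-single {f = λ x → t x ⊗ ι (basis {e} x (suc a) (suc b))} (Fin.combine a b) λ x x≢ → ≈-trans (*-congˡ (≈-trans (reflexive (cong ι (corner-≢ {e} {a} {b} x x≢))) ι-0)) (zeroʳ (t x)))
    (≈-trans (*-congˡ (≈-trans (reflexive (cong ι (corner-combine {e} a b))) ι-1)) (*-identityʳ (t (Fin.combine a b))))

  point-block : ∀ (t : Fin (e * e) → Carrier) a b → pointᴿ t (suc a , suc b) ≈ t (Fin.combine a b)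
  point-block {e} t a b = ≈-trans (+-cong ι-0 (linear-block {e} t a b)) (+-identityˡ (t (Fin.combine a b)))

module ℤᴮ = BlockCoordinates ℤₚ.+-*-commutativeRing id (λ _ _ → refl) refl refl

-- The function H

dot≡sumℤ : ∀ {n} (p v : Vec ℤ n) → dot p v ≡ sumℤ (λ x → Vec.lookup p x ℤ.* Vec.lookup v x)
dot≡sumℤ []      []      = refl
dot≡sumℤ (x ∷ p) (y ∷ v) = cong (ℤ._+_ (x ℤ.* y)) (dot≡sumℤ p v)

dot-lineSums : ∀ {d D} {w : Fin d → Fin d → Vec ℤ D} (p : Vec ℤ D) (K : Fin D → ℤ) →
               (∀ x → LineSums (K x) (λ i j → Vec.lookup (w i j) x)) →
               LineSums (sumℤ (λ x → Vec.lookup p x ℤ.* K x)) (λ i j → dot p (w i j))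
dot-lineSums {w = w} p K sums = (λ i → line (w i) λ x → proj₁ (sums x) i) , (λ j → line (λ i → w i j) λ x → proj₂ (sums x) j)
  where
  open ≡-Reasoning
  line : ∀ (u : Fin _ → Vec ℤ _) → (∀ x → sumℤ (λ j → Vec.lookup (u j) x) ≡ K x) →
         sumℤ (λ j → dot p (u j)) ≡ sumℤ (λ x → Vec.lookup p x ℤ.* K x)
  line u eq = begin
    sumℤ (λ j → dot p (u j))
      ≡⟨ Σℤ.sum-cong-≗ (λ j → dot≡sumℤ p (u j)) ⟩
    sumℤ (λ j → sumℤ λ x → Vec.lookup p x ℤ.* Vec.lookup (u j) x)
      ≡⟨ Σℤ.∑-comm (λ j x → Vec.lookup p x ℤ.* Vec.lookup (u j) x) ⟩
    sumℤ (λ x → sumℤ λ j → Vec.lookup p x ℤ.* Vec.lookup (u j) x)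
      ≡⟨ Σℤ.sum-cong-≗ (λ x → trans (sym (Σℤ.*-distribˡ-sum (Vec.lookup p x) (λ j → Vec.lookup (u j) x)))
                                    (cong (Vec.lookup p x ℤ.*_) (eq x))) ⟩
    sumℤ (λ x → Vec.lookup p x ℤ.* K x) ∎

-- The first coordinate is the all-ones matrix, so every entry is positive.
start : ∀ e → Fin (suc e) → Fin (suc e) → Vec ℤ (suc (e * e))
start e i j = 1ℤ ∷ Vec.tabulate λ x → basis {e} x i j

module _ (e : ℕ) where

  private
    d D : ℕ
    d = suc e
    D = suc (e * e)

    lookup-start : ∀ x i j → basis {e} x i j ≡ Vec.lookup (start e i j) (suc x)
    lookup-start x i j = sym (Vecₚ.lookup∘tabulate (λ x → basis {e} x i j) x)

    K : Fin D → ℤ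
    K zero    = + d
    K (suc x) = 0ℤ

    ones : ∀ n → sumℤ {n} (λ _ → 1ℤ) ≡ + n
    ones zero    = refl
    ones (suc n) = cong (ℤ._+_ 1ℤ) (ones n)

    start-sums : ∀ x → LineSums (K x) (λ i j → Vec.lookup (start e i j) x)
    start-sums zero    = (λ _ → ones d) , (λ _ → ones d)
    start-sums (suc x) = lineSums-cong refl (lookup-start x) (corner-sums (Fin.remQuot {e} e x))

    dot-sums : ∀ p₀ (q : Vec ℤ (e * e)) → LineSums (p₀ ℤ.* + d) (λ i j → dot (p₀ ∷ q) (start e i j))
    dot-sums p₀ q = lineSums-cong {f = λ i j → dot (p₀ ∷ q) (start e i j)}
      (trans (cong (ℤ._+_ (p₀ ℤ.* + d)) (sumℤ-zero λ x → ℤₚ.*-zeroʳ (Vec.lookup q x))) (ℤₚ.+-identityʳ (p₀ ℤ.* + d)))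
      (λ _ _ → refl) (dot-lineSums {w = start e} (p₀ ∷ q) K start-sums)

    dot-block : ∀ p₀ (q : Vec ℤ (e * e)) a b → dot (p₀ ∷ q) (start e (suc a) (suc b)) ≡ p₀ ℤ.+ Vec.lookup q (Fin.combine a b)
    dot-block p₀ q a b = cong₂ ℤ._+_ (ℤₚ.*-identityʳ p₀) (begin
      dot q (Vec.tabulate λ x → basis {e} x (suc a) (suc b))
        ≡⟨ dot≡sumℤ q _ ⟩
      sumℤ (λ x → Vec.lookup q x ℤ.* Vec.lookup (Vec.tabulate λ x → basis {e} x (suc a) (suc b)) x)
        ≡⟨ Σℤ.sum-cong-≗ (λ x → cong (Vec.lookup q x ℤ.*_) (lookup-start x (suc a) (suc b))) ⟨
      sumℤ (λ x → Vec.lookup q x ℤ.* basis {e} x (suc a) (suc b))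
        ≡⟨ ℤᴮ.linear-block (Vec.lookup q) a b ⟩
      Vec.lookup q (Fin.combine a b) ∎)
      where
      open ≡-Reasoning

  -- Corner matrices have line sums 0, so the line sums of a combination isolate the coefficient p₀
  -- of the all-ones matrix J, and the block then gives the others. Conversely d M and k J have the
  -- same line sums, so d M - k J is the combination of corner matrices read off its block; the
  -- factor d avoids fractions.
  start-generic : Generic (start e)
  start-generic = record { magic = λ x → K x , start-sums x ; indep = indep ; span = span }
    where
    open ≡-Reasoning
    indep : ∀ p → (∀ i j → dot p (start e i j) ≡ 0ℤ) → sgn p ≡ nil
    indep (p₀ ∷ q) p·w = nil-sgn (p₀ ∷ q) λ { zero → p₀≡0 ; (suc x) → begin
      Vec.lookup q x  ≡⟨ cong (Vec.lookup q) (Finₚ.combine-remQuot {e} e x) ⟨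
      Vec.lookup q (Fin.combine (a x) (b x))  ≡⟨ ℤₚ.+-identityˡ _ ⟨
      0ℤ ℤ.+ Vec.lookup q (Fin.combine (a x) (b x))  ≡⟨ cong (ℤ._+ Vec.lookup q (Fin.combine (a x) (b x))) p₀≡0 ⟨
      p₀ ℤ.+ Vec.lookup q (Fin.combine (a x) (b x))  ≡⟨ dot-block p₀ q (a x) (b x) ⟨
      dot (p₀ ∷ q) (start e (suc (a x)) (suc (b x)))  ≡⟨ p·w (suc (a x)) (suc (b x)) ⟩
      0ℤ  ∎ }
      where
      a b : Fin (e * e) → Fin e
      a x = proj₁ (Fin.remQuot {e} e x)
      b x = proj₂ (Fin.remQuot {e} e x)
      p₀≡0 : p₀ ≡ 0ℤ
      p₀≡0 = case ℤₚ.i*j≡0⇒i≡0∨j≡0 p₀ (trans (sym (proj₁ (dot-sums p₀ q) zero)) (sumℤ-zero (p·w zero))) of λ { (inj₁ eq) → eq }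
    span : ∀ {M k} → Magic k M → (∀ i j → sgn (start e i j) ≡ nil → entry M i j ≡ 0) →
           ∃[ c ] ∃[ p ] c ≢ 0ℤ × (∀ i j → c ℤ.* ⟪ M ⟫ i j ≡ dot p (start e i j))
    span {M} {k} magicM _ = + d , + k ∷ q , (λ ()) , λ i j → ℤᴮ.block-determines {f = λ (i , j) → + d ℤ.* ⟪ M ⟫ i j} {λ (i , j) → dot (+ k ∷ q) (start e i j)}
      (lineSums-cong (trans (drop₀ (+ d) (+ k)) (ℤₚ.*-comm (+ d) (+ k))) (λ i j → drop₀ (+ d) (⟪ M ⟫ i j))
        (lineSums-linear (+ d) 0ℤ {f = ⟪ M ⟫} {⟪ M ⟫} sums sums))
      (dot-sums (+ k) q)
      (λ a b → sym (trans (dot-block (+ k) q a b) (trans (cong (ℤ._+_ (+ k)) (trans (Vecₚ.lookup∘tabulate _ (Fin.combine a b))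
        (cong (λ (a , b) → + d ℤ.* ⟪ M ⟫ (suc a) (suc b) ℤ.- + k) (Finₚ.remQuot-combine a b)))) (cancel (+ k) (+ d ℤ.* ⟪ M ⟫ (suc a) (suc b)))))) (i , j)
      where
      sums : LineSums (+ k) ⟪ M ⟫
      sums = magic⇒lineSums {k = k} {M} magicM
      q : Vec ℤ (e * e)
      q = Vec.tabulate λ x → let (a , b) = Fin.remQuot {e} e x in + d ℤ.* ⟪ M ⟫ (suc a) (suc b) ℤ.- + k
      drop₀ : ∀ x y → x ℤ.* y ℤ.+ 0ℤ ℤ.* y ≡ x ℤ.* y
      drop₀ = solve-∀
      cancel : ∀ x y → x ℤ.+ (y ℤ.- x) ≡ y
      cancel = solve-∀

  count-H : ∀ k → Count (Magic {d} k) (H d k)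
  count-H k = record { elements = magicSquares d k ; unique = magicSquares-unique d k
                     ; complete = ∈-magicSquares ; sound = magicSquares-magic ; size = refl }

  count-cone⁺ : ∀ k → Count (Cone ⁺ (start e) k) (H d k)
  count-cone⁺ k = count-⇔ (λ magicM → cone magicM λ _ _ → tt) Cone.magic (count-H k)

  private
    addOnes : Matrix d → Matrix d
    addOnes M = fromEntries λ i j → suc (entry M i j)

    entry-addOnes : ∀ M i j → entry (addOnes M) i j ≡ suc (entry M i j)
    entry-addOnes M = entry-fromEntries λ i j → suc (entry M i j)

    addOnes-sums : ∀ {k M} → LineSums k ⟪ M ⟫ → LineSums (k ℤ.+ + d) ⟪ addOnes M ⟫
    addOnes-sums {k} {M} sums = lineSums-cong (cong₂ ℤ._+_ (ℤₚ.*-identityˡ k) (ℤₚ.*-identityˡ (+ d)))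
      (λ i j → trans (trans (ℤₚ.+-comm (1ℤ ℤ.* ⟪ M ⟫ i j) 1ℤ) (cong (ℤ._+_ 1ℤ) (ℤₚ.*-identityˡ (⟪ M ⟫ i j)))) (cong +_ (sym (entry-addOnes M i j))))
      (lineSums-linear 1ℤ 1ℤ {f = ⟪ M ⟫} {λ _ _ → 1ℤ} sums ((λ _ → ones d) , (λ _ → ones d)))

    addOnes-injective : ∀ {M M′} → addOnes M ≡ addOnes M′ → M ≡ M′
    addOnes-injective {M} {M′} eq = entry-injective λ i j → ℕₚ.suc-injective
      (trans (sym (entry-addOnes M i j)) (trans (cong (λ M → entry M i j) eq) (entry-addOnes M′ i j)))

  count-cone⁻ : ∀ k → Count (Cone ⁻ (start e) (k + d)) (H d k)
  count-cone⁻ k = count-⇔ to from (count-image addOnes addOnes-injective (count-H k))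
    where
    to : ∀ {N} → ∃[ M ] Magic k M × N ≡ addOnes M → Cone ⁻ (start e) (k + d) N
    to (M , magicM , refl) = cone (lineSums⇒magic {k = k + d} (lineSums-cong {f = ⟪ addOnes M ⟫} (sym (ℤₚ.pos-+ k d)) (λ _ _ → refl) (addOnes-sums {+ k} {M} (magic⇒lineSums {k = k} {M} magicM))))
      λ i j → subst (1 ℕ.≤_) (sym (entry-addOnes M i j)) (s≤s z≤n)
    from : ∀ {N} → Cone ⁻ (start e) (k + d) N → ∃[ M ] Magic k M × N ≡ addOnes M
    from {N} (cone magicN ok) = M , lineSums⇒magic {k = k}
      (lineSums-cong (trans (difference (+ (k + d)) (+ d)) (trans (cong (ℤ._- + d) (ℤₚ.pos-+ k d)) (cancel (+ k) (+ d))))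
        (λ i j → trans (difference (⟪ N ⟫ i j) 1ℤ) (trans (cong (ℤ._- 1ℤ) (cong +_ (N≡ i j))) (cancel₁ (⟪ M ⟫ i j))))
        (lineSums-linear 1ℤ -1ℤ {f = ⟪ N ⟫} {λ _ _ → 1ℤ} (magic⇒lineSums {k = k + d} {N} magicN) ((λ _ → ones d) , (λ _ → ones d)))) ,
      entry-injective λ i j → trans (N≡ i j) (sym (entry-addOnes M i j))
      where
      M : Matrix d
      M = fromEntries λ i j → ℕ.pred (entry N i j)
      N≡ : ∀ i j → entry N i j ≡ suc (entry M i j)
      N≡ i j = trans (sym (ℕₚ.suc-pred (entry N i j) {{ℕ.>-nonZero (ok i j)}})) (cong suc (sym (entry-fromEntries (λ i j → ℕ.pred (entry N i j)) i j)))
      difference : ∀ x y → 1ℤ ℤ.* x ℤ.+ -1ℤ ℤ.* y ≡ x ℤ.- y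
      difference = solve-∀
      cancel : ∀ x y → x ℤ.+ y ℤ.- y ≡ x
      cancel = solve-∀
      cancel₁ : ∀ x → 1ℤ ℤ.+ x ℤ.- 1ℤ ≡ x
      cancel₁ = solve-∀

  -- The series Σ H(k) q^k is Σ q^a / (1 − q)^D over the pieces (a , b), and
  -- multiplied by q^d it is Σ q^b / (1 − q)^D.
  record HilbertSeries : Set where
    field
      pieces  : List (ℕ × ℕ)
      degrees : ListAll.All (λ (a , b) → a + b ≡ D) pieces
      proper  : ListAll.All (λ (a , b) → b ≢ 0) pieces
      H≡      : ∀ k → H d k ≡ ∑∈ (λ p → compositions D (proj₁ p) k) pieces
      H≡′     : ∀ k → H d k ≡ ∑∈ (λ p → compositions D (proj₂ p) (k + d)) pieces

  hilbertSeries : HilbertSeries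
  hilbertSeries = record
    { pieces = pieces ; degrees = degrees ; proper = proper
    ; H≡  = λ k → count-unique (count-cone⁺ k) (counts ⁺ k)
    ; H≡′ = λ k → count-unique (count-cone⁻ k) (counts ⁻ (k + d)) }
    where
    open Decomposition (decompose D start-generic)
    -- A pair with b = 0 would contribute 1 in degree 0, where the cone for -w is empty. This gives
    -- a ≤ e * e, which makes the polynomial formula for the counts valid from k = 0 on.
    proper : ListAll.All (λ (a , b) → b ≢ 0) pieces
    proper = all-proper pieces (count-unique (counts ⁻ 0) (count-∅ λ M (cone magicM ok) →
      ℕₚ.<⇒≱ (ok zero zero) (magic-entry≤ {M = M} magicM zero zero)))
      where
      all-proper : ∀ ps → ∑∈ (λ p → compositions D (proj₂ p) 0) ps ≡ 0 → ListAll.All (λ (a , b) → b ≢ 0) ps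
      all-proper []             _  = []
      all-proper ((a , b) ∷ ps) eq =
        (λ { refl → case trans (sym (compositions-0-0 D)) (ℕₚ.m+n≡0⇒m≡0 (compositions D 0 0) eq) of λ () }) ∷
        all-proper ps (ℕₚ.m+n≡0⇒n≡0 (compositions D b 0) eq)

-- Backward differences

∇ : ℕ → (ℤ → ℤ) → ℤ → ℤ
∇ zero    f x = f x
∇ (suc N) f x = ∇ N f x ℤ.- ∇ N f (x ℤ.- 1ℤ)

∇-cong : ∀ N {f g} → (∀ x → f x ≡ g x) → ∀ x → ∇ N f x ≡ ∇ N g x
∇-cong zero    f≗g x = f≗g x
∇-cong (suc N) f≗g x = cong₂ ℤ._-_ (∇-cong N f≗g x) (∇-cong N f≗g (x ℤ.- 1ℤ))

-- Leibniz rule: the higher differences of the linear factor vanish, so two terms remain.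
∇-linear-* : ∀ M a c g x → let l = λ x → a ℤ.* x ℤ.+ c in
             ∇ (suc M) (λ x → l x ℤ.* g x) x ≡ l x ℤ.* ∇ (suc M) g x ℤ.+ + suc M ℤ.* a ℤ.* ∇ M g (x ℤ.- 1ℤ)
∇-linear-* zero a c g x = identity a c x (g x) (g (x ℤ.- 1ℤ))
  where
  identity : ∀ a c x g₀ g₁ → (a ℤ.* x ℤ.+ c) ℤ.* g₀ ℤ.- (a ℤ.* (x ℤ.- 1ℤ) ℤ.+ c) ℤ.* g₁ ≡
                             (a ℤ.* x ℤ.+ c) ℤ.* (g₀ ℤ.- g₁) ℤ.+ 1ℤ ℤ.* a ℤ.* g₁
  identity = solve-∀
∇-linear-* (suc M) a c g x = trans
  (cong₂ ℤ._-_ (∇-linear-* M a c g x) (∇-linear-* M a c g (x ℤ.- 1ℤ)))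
  (trans (identity a c x (+ suc M) (∇ M g x) (∇ M g (x ℤ.- 1ℤ)) (∇ M g (x ℤ.- 1ℤ ℤ.- 1ℤ)))
         (cong (λ z → (a ℤ.* x ℤ.+ c) ℤ.* ∇ (suc (suc M)) g x ℤ.+ z ℤ.* a ℤ.* ∇ (suc M) g (x ℤ.- 1ℤ)) (sym (ℤₚ.pos-+ 1 (suc M)))))
  where
  identity : ∀ a c x s g₀ g₁ g₂ →
             ((a ℤ.* x ℤ.+ c) ℤ.* (g₀ ℤ.- g₁) ℤ.+ s ℤ.* a ℤ.* g₁) ℤ.-
             ((a ℤ.* (x ℤ.- 1ℤ) ℤ.+ c) ℤ.* (g₁ ℤ.- g₂) ℤ.+ s ℤ.* a ℤ.* g₂) ≡
             (a ℤ.* x ℤ.+ c) ℤ.* ((g₀ ℤ.- g₁) ℤ.- (g₁ ℤ.- g₂)) ℤ.+ (1ℤ ℤ.+ s) ℤ.* a ℤ.* (g₁ ℤ.- g₂)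
  identity = solve-∀

-- The product (x + 1) ⋯ (x + N), which is N! times the binomial coefficient of x + N over N: it
-- extends the number of (N + 1)-tuples with sum x to negative x.
rising : ℕ → ℤ → ℤ
rising zero    x = 1ℤ
rising (suc N) x = (x ℤ.+ + suc N) ℤ.* rising N x

-- In the product rule the difference of the inductive value vanishes, as that value does not depend
-- on x; only the second term survives, and it multiplies the result by (N + 1) a.
∇-rising : ∀ N a c x → ∇ N (λ x → rising N (a ℤ.* x ℤ.+ c)) x ≡ + (N !) ℤ.* a ℤ.^ N
∇-rising zero    a c x = refl
∇-rising (suc N) a c x = begin
  ∇ (suc N) (λ x → (a ℤ.* x ℤ.+ c ℤ.+ + suc N) ℤ.* rising N (a ℤ.* x ℤ.+ c)) x
    ≡⟨ ∇-cong (suc N) (λ x → cong (ℤ._* rising N (a ℤ.* x ℤ.+ c)) (ℤₚ.+-assoc (a ℤ.* x) c (+ suc N))) x ⟩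
  ∇ (suc N) (λ x → (a ℤ.* x ℤ.+ (c ℤ.+ + suc N)) ℤ.* rising N (a ℤ.* x ℤ.+ c)) x
    ≡⟨ ∇-linear-* N a (c ℤ.+ + suc N) g x ⟩
  (a ℤ.* x ℤ.+ (c ℤ.+ + suc N)) ℤ.* (∇ N g x ℤ.- ∇ N g (x ℤ.- 1ℤ)) ℤ.+ + suc N ℤ.* a ℤ.* ∇ N g (x ℤ.- 1ℤ)
    ≡⟨ cong₂ (λ y z → (a ℤ.* x ℤ.+ (c ℤ.+ + suc N)) ℤ.* (y ℤ.- z) ℤ.+ + suc N ℤ.* a ℤ.* z) (∇-rising N a c x) (∇-rising N a c (x ℤ.- 1ℤ)) ⟩
  (a ℤ.* x ℤ.+ (c ℤ.+ + suc N)) ℤ.* (+ (N !) ℤ.* a ℤ.^ N ℤ.- + (N !) ℤ.* a ℤ.^ N) ℤ.+ + suc N ℤ.* a ℤ.* (+ (N !) ℤ.* a ℤ.^ N)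
    ≡⟨ identity (a ℤ.* x ℤ.+ (c ℤ.+ + suc N)) (+ suc N) a (+ (N !)) (a ℤ.^ N) ⟩
  + suc N ℤ.* + (N !) ℤ.* (a ℤ.* a ℤ.^ N)
    ≡⟨ cong (ℤ._* (a ℤ.* a ℤ.^ N)) (ℤₚ.pos-* (suc N) (N !)) ⟨
  + (suc N !) ℤ.* a ℤ.^ suc N ∎
  where
  open ≡-Reasoning
  g : ℤ → ℤ
  g x = rising N (a ℤ.* x ℤ.+ c)
  identity : ∀ l s a f p → l ℤ.* (f ℤ.* p ℤ.- f ℤ.* p) ℤ.+ s ℤ.* a ℤ.* (f ℤ.* p) ≡ s ℤ.* f ℤ.* (a ℤ.* p)
  identity = solve-∀

rising-shift : ∀ N x → rising (suc N) x ≡ (x ℤ.+ 1ℤ) ℤ.* rising N (x ℤ.+ 1ℤ)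
rising-shift zero    x = refl
rising-shift (suc N) x = trans (cong ((x ℤ.+ + suc (suc N)) ℤ.*_) (rising-shift N x))
  (trans (cong (λ z → (x ℤ.+ z) ℤ.* ((x ℤ.+ 1ℤ) ℤ.* rising N (x ℤ.+ 1ℤ))) (ℤₚ.pos-+ 1 (suc N)))
         (identity x (+ suc N) (rising N (x ℤ.+ 1ℤ))))
  where
  identity : ∀ x n r → (x ℤ.+ (1ℤ ℤ.+ n)) ℤ.* ((x ℤ.+ 1ℤ) ℤ.* r) ≡ (x ℤ.+ 1ℤ) ℤ.* ((x ℤ.+ 1ℤ ℤ.+ n) ℤ.* r)
  identity = solve-∀

-- The reflection sends the factor x + i to - (x + N + 1 - i), so it permutes the factors up to N
-- signs. This is reciprocity for a single simplex.
rising-reflect : ∀ N x → rising N (ℤ.- x ℤ.- + suc N) ≡ -1ℤ ℤ.^ N ℤ.* rising N x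
rising-reflect zero    x = refl
rising-reflect (suc N) x = begin
  (ℤ.- x ℤ.- + suc (suc N) ℤ.+ + suc N) ℤ.* rising N (ℤ.- x ℤ.- + suc (suc N))
    ≡⟨ cong (λ z → (ℤ.- x ℤ.- z ℤ.+ + suc N) ℤ.* rising N (ℤ.- x ℤ.- z)) (ℤₚ.pos-+ 1 (suc N)) ⟩
  (ℤ.- x ℤ.- (1ℤ ℤ.+ + suc N) ℤ.+ + suc N) ℤ.* rising N (ℤ.- x ℤ.- (1ℤ ℤ.+ + suc N))
    ≡⟨ cong₂ (λ y z → y ℤ.* rising N z) (head x (+ suc N)) (argument x (+ suc N)) ⟩
  -1ℤ ℤ.* (x ℤ.+ 1ℤ) ℤ.* rising N (ℤ.- (x ℤ.+ 1ℤ) ℤ.- + suc N)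
    ≡⟨ cong (-1ℤ ℤ.* (x ℤ.+ 1ℤ) ℤ.*_) (rising-reflect N (x ℤ.+ 1ℤ)) ⟩
  -1ℤ ℤ.* (x ℤ.+ 1ℤ) ℤ.* (-1ℤ ℤ.^ N ℤ.* rising N (x ℤ.+ 1ℤ))
    ≡⟨ regroup (x ℤ.+ 1ℤ) (-1ℤ ℤ.^ N) (rising N (x ℤ.+ 1ℤ)) ⟩
  -1ℤ ℤ.* -1ℤ ℤ.^ N ℤ.* ((x ℤ.+ 1ℤ) ℤ.* rising N (x ℤ.+ 1ℤ))
    ≡⟨ cong (-1ℤ ℤ.^ suc N ℤ.*_) (rising-shift N x) ⟨
  -1ℤ ℤ.^ suc N ℤ.* rising (suc N) x ∎
  where
  open ≡-Reasoning
  head : ∀ x n → ℤ.- x ℤ.- (1ℤ ℤ.+ n) ℤ.+ n ≡ -1ℤ ℤ.* (x ℤ.+ 1ℤ)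
  head = solve-∀
  argument : ∀ x n → ℤ.- x ℤ.- (1ℤ ℤ.+ n) ≡ ℤ.- (x ℤ.+ 1ℤ) ℤ.- n
  argument = solve-∀
  regroup : ∀ y s r → -1ℤ ℤ.* y ℤ.* (s ℤ.* r) ≡ -1ℤ ℤ.* s ℤ.* (y ℤ.* r)
  regroup = solve-∀

rising-zero : ∀ N j → j ℕ.< N → rising N (ℤ.- + suc j) ≡ 0ℤ
rising-zero (suc N) j j<1+N with ℕₚ.m≤n⇒m<n∨m≡n (ℕ.s≤s⁻¹ j<1+N)
... | inj₁ j<N  = trans (cong ((ℤ.- + suc j ℤ.+ + suc N) ℤ.*_) (rising-zero N j j<N)) (ℤₚ.*-zeroʳ (ℤ.- + suc j ℤ.+ + suc N))
... | inj₂ refl = trans (cong (ℤ._* rising N (ℤ.- + suc j)) (ℤₚ.+-inverseˡ (+ suc N))) (ℤₚ.*-zeroˡ (rising N (ℤ.- + suc j)))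

rising-0 : ∀ N → rising N 0ℤ ≡ + (N !)
rising-0 zero    = refl
rising-0 (suc N) = trans (cong₂ ℤ._*_ (ℤₚ.+-identityˡ (+ suc N)) (rising-0 N)) (sym (ℤₚ.pos-* (suc N) (N !)))

compositions-0≡rising : ∀ N k → + (N !) ℤ.* + compositions (suc N) 0 k ≡ rising N (+ k)
compositions-0≡rising N zero = trans (cong (λ c → + (N !) ℤ.* + c) (compositions-0-0 (suc N)))
  (trans (ℤₚ.*-identityʳ (+ (N !))) (sym (rising-0 N)))
compositions-0≡rising zero (suc k) = trans (ℤₚ.*-identityˡ _) (cong +_ (all-one k))
  where
  all-one : ∀ k → compositions 1 0 (suc k) ≡ 1
  all-one zero    = refl
  all-one (suc k) = trans (ℕₚ.+-identityʳ _) (all-one k)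
compositions-0≡rising (suc N) (suc k) = begin
  + (suc N !) ℤ.* + (compositions (suc (suc N)) 0 k + compositions (suc N) 0 (suc k))
    ≡⟨ cong (+ (suc N !) ℤ.*_) (ℤₚ.pos-+ (compositions (suc (suc N)) 0 k) _) ⟩
  + (suc N !) ℤ.* (+ compositions (suc (suc N)) 0 k ℤ.+ + compositions (suc N) 0 (suc k))
    ≡⟨ ℤₚ.*-distribˡ-+ (+ (suc N !)) _ _ ⟩
  + (suc N !) ℤ.* + compositions (suc (suc N)) 0 k ℤ.+ + (suc N !) ℤ.* + compositions (suc N) 0 (suc k)
    ≡⟨ cong₂ ℤ._+_ (compositions-0≡rising (suc N) k) (trans (cong (ℤ._* + compositions (suc N) 0 (suc k)) (ℤₚ.pos-* (suc N) (N !)))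
         (trans (ℤₚ.*-assoc (+ suc N) (+ (N !)) _) (cong (+ suc N ℤ.*_) (compositions-0≡rising N (suc k))))) ⟩
  rising (suc N) (+ k) ℤ.+ + suc N ℤ.* rising N (+ suc k)
    ≡⟨ cong (ℤ._+ + suc N ℤ.* rising N (+ suc k)) (trans (rising-shift N (+ k)) (cong (λ y → y ℤ.* rising N y) (ℤₚ.+-comm (+ k) 1ℤ))) ⟩
  + suc k ℤ.* rising N (+ suc k) ℤ.+ + suc N ℤ.* rising N (+ suc k)
    ≡⟨ ℤₚ.*-distribʳ-+ (rising N (+ suc k)) (+ suc k) (+ suc N) ⟨
  rising (suc N) (+ suc k) ∎
  where open ≡-Reasoning

-- For k < j the count is 0, and the hypothesis keeps k - j among the roots -1, ..., -N of the
-- product.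
compositions≡rising : ∀ N j k → j ℕ.≤ N + k → + (N !) ℤ.* + compositions (suc N) j k ≡ rising N (+ k ℤ.- + j)
compositions≡rising N zero    k       _  = trans (compositions-0≡rising N k) (cong (rising N) (sym (ℤₚ.+-identityʳ (+ k))))
compositions≡rising N (suc j) zero    le = trans (cong (λ c → + (N !) ℤ.* + c) (compositions-suc-zero (suc N) j))
  (trans (ℤₚ.*-zeroʳ (+ (N !))) (sym (rising-zero N j (subst (suc j ℕ.≤_) (ℕₚ.+-identityʳ N) le))))
compositions≡rising N (suc j) (suc k) le = trans (cong (λ c → + (N !) ℤ.* + c) (compositions-suc-suc (suc N) j k))
  (trans (compositions≡rising N j k (ℕ.s≤s⁻¹ (subst (suc j ℕ.≤_) (ℕₚ.+-suc N k) le)))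
         (cong (rising N) (sym (trans (ℤₚ.[1+m]⊖[1+n]≡m⊖n k j) (sym (ℤₚ.m-n≡m⊖n k j))))))

∑ : ℕ → (ℕ → ℤ) → ℤ
∑ M f = sumℤ {M} (f ∘ Fin.toℕ)

∑-cong : ∀ M {f g} → (∀ i → f i ≡ g i) → ∑ M f ≡ ∑ M g
∑-cong M f≗g = Σℤ.sum-cong-≗ {M} (f≗g ∘ Fin.toℕ)

∑-+ : ∀ M f g → ∑ M (λ i → f i ℤ.+ g i) ≡ ∑ M f ℤ.+ ∑ M g
∑-+ M f g = Σℤ.∑-distrib-+ {M} (f ∘ Fin.toℕ) (g ∘ Fin.toℕ)

∑-* : ∀ M c f → c ℤ.* ∑ M f ≡ ∑ M (λ i → c ℤ.* f i)
∑-* M c f = Σℤ.*-distribˡ-sum {M} c (f ∘ Fin.toℕ)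

∑-snoc : ∀ M f → ∑ (suc M) f ≡ ∑ M f ℤ.+ f M
∑-snoc zero    f = trans (ℤₚ.+-identityʳ (f 0)) (sym (ℤₚ.+-identityˡ (f 0)))
∑-snoc (suc M) f = trans (cong (ℤ._+_ (f 0)) (∑-snoc M (f ∘ suc))) (sym (ℤₚ.+-assoc (f 0) _ (f (suc M))))

∑-split : ∀ M K f → ∑ (M + K) f ≡ ∑ M f ℤ.+ ∑ K (λ i → f (M + i))
∑-split zero    K f = sym (ℤₚ.+-identityˡ (∑ K f))
∑-split (suc M) K f = trans (cong (ℤ._+_ (f 0)) (∑-split M K (f ∘ suc))) (sym (ℤₚ.+-assoc (f 0) _ _))

∑-reverse : ∀ n f → ∑ (suc n) f ≡ ∑ (suc n) (λ m → f (n ∸ m))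
∑-reverse zero    f = refl
∑-reverse (suc n) f = trans (∑-snoc (suc n) f)
  (trans (ℤₚ.+-comm (∑ (suc n) f) (f (suc n))) (cong (ℤ._+_ (f (suc n))) (∑-reverse n f)))

∑-zero : ∀ M {f} → (∀ i → f i ≡ 0ℤ) → ∑ M f ≡ 0ℤ
∑-zero M f≗0 = sumℤ-zero {M} (f≗0 ∘ Fin.toℕ)

ε : ℕ → ℤ
ε n = -1ℤ ℤ.^ n

ε-double : ∀ n → ε (n + n) ≡ 1ℤ
ε-double zero    = refl
ε-double (suc n) = trans (cong (λ m → -1ℤ ℤ.* ε m) (ℕₚ.+-suc n n)) (trans (sym (ℤₚ.*-assoc -1ℤ -1ℤ (ε (n + n)))) (cong (1ℤ ℤ.*_) (ε-double n)))

-- Terms beyond N vanish with their binomial coefficients. A free upper limit M lets the sum be cut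
-- into two halves of equal length whatever the parity of N.
∇-expand : ∀ N M → N ℕ.< M → ∀ f x → ∇ N f x ≡ ∑ M (λ i → ε i ℤ.* + (N C i) ℤ.* f (x ℤ.- + i))
∇-expand zero (suc M) _ f x = sym (begin
  1ℤ ℤ.* f (x ℤ.- 0ℤ) ℤ.+ ∑ M (λ i → ε (suc i) ℤ.* 0ℤ ℤ.* f (x ℤ.- + suc i))
    ≡⟨ cong₂ ℤ._+_ (trans (ℤₚ.*-identityˡ _) (cong f (ℤₚ.+-identityʳ x)))
         (∑-zero M λ i → trans (cong (ℤ._* f (x ℤ.- + suc i)) (ℤₚ.*-zeroʳ (ε (suc i)))) (ℤₚ.*-zeroˡ (f (x ℤ.- + suc i)))) ⟩
  f x ℤ.+ 0ℤ
    ≡⟨ ℤₚ.+-identityʳ (f x) ⟩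
  f x ∎)
  where open ≡-Reasoning
∇-expand (suc N) (suc M) (s≤s N<M) f x = begin
  ∇ N f x ℤ.- ∇ N f (x ℤ.- 1ℤ)
    ≡⟨ cong₂ ℤ._-_ (∇-expand N (suc M) (ℕₚ.m<n⇒m<1+n N<M) f x) (∇-expand N M N<M f (x ℤ.- 1ℤ)) ⟩
  1ℤ ℤ.* + (N C 0) ℤ.* f₀ ℤ.+ ∑ M shifted ℤ.- ∑ M lower
    ≡⟨ regroup (1ℤ ℤ.* + (N C 0) ℤ.* f₀) (∑ M shifted) (∑ M lower) ⟩
  1ℤ ℤ.* + (N C 0) ℤ.* f₀ ℤ.+ (∑ M shifted ℤ.+ -1ℤ ℤ.* ∑ M lower)
    ≡⟨ cong₂ (λ c s → 1ℤ ℤ.* + c ℤ.* f₀ ℤ.+ s) (nC0≡ N) (trans (cong (ℤ._+_ (∑ M shifted)) (∑-* M -1ℤ lower))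
         (trans (sym (∑-+ M shifted (λ i → -1ℤ ℤ.* lower i))) (∑-cong M pascal))) ⟩
  ∑ (suc M) (λ i → ε i ℤ.* + (suc N C i) ℤ.* f (x ℤ.- + i)) ∎
  where
  open ≡-Reasoning
  f₀ : ℤ
  f₀ = f (x ℤ.- 0ℤ)
  shifted lower : ℕ → ℤ
  shifted i = ε (suc i) ℤ.* + (N C suc i) ℤ.* f (x ℤ.- + suc i)
  lower i = ε i ℤ.* + (N C i) ℤ.* f (x ℤ.- 1ℤ ℤ.- + i)
  nC0≡ : ∀ N → N C 0 ≡ suc N C 0
  nC0≡ N = trans (nC0≡1 N) (sym (nC0≡1 (suc N)))
    where
    nC0≡1 : ∀ n → n C 0 ≡ 1
    nC0≡1 n = trans (nCk≡nC[n∸k] {0} {n} z≤n) (nCn≡1 n)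
  regroup : ∀ x y z → x ℤ.+ y ℤ.- z ≡ x ℤ.+ (y ℤ.+ -1ℤ ℤ.* z)
  regroup = solve-∀
  pascal : ∀ i → shifted i ℤ.+ -1ℤ ℤ.* lower i ≡ ε (suc i) ℤ.* + (suc N C suc i) ℤ.* f (x ℤ.- + suc i)
  pascal i = begin
    shifted i ℤ.+ -1ℤ ℤ.* (ε i ℤ.* + (N C i) ℤ.* f (x ℤ.- 1ℤ ℤ.- + i))
      ≡⟨ cong (λ y → shifted i ℤ.+ -1ℤ ℤ.* (ε i ℤ.* + (N C i) ℤ.* f y)) (trans (step x (+ i)) (cong (λ y → x ℤ.- y) (sym (ℤₚ.pos-+ 1 i)))) ⟩
    shifted i ℤ.+ -1ℤ ℤ.* (ε i ℤ.* + (N C i) ℤ.* f (x ℤ.- + suc i))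
      ≡⟨ factor (ε i) (+ (N C i)) (+ (N C suc i)) (f (x ℤ.- + suc i)) ⟩
    -1ℤ ℤ.* ε i ℤ.* (+ (N C i) ℤ.+ + (N C suc i)) ℤ.* f (x ℤ.- + suc i)
      ≡⟨ cong (λ c → ε (suc i) ℤ.* c ℤ.* f (x ℤ.- + suc i)) (trans (sym (ℤₚ.pos-+ (N C i) (N C suc i))) (cong +_ (nCk+nC[k+1]≡[n+1]C[k+1] N i))) ⟩
    ε (suc i) ℤ.* + (suc N C suc i) ℤ.* f (x ℤ.- + suc i) ∎
    where
    step : ∀ x i → x ℤ.- 1ℤ ℤ.- i ≡ x ℤ.- (1ℤ ℤ.+ i)
    step = solve-∀
    factor : ∀ s a b y → -1ℤ ℤ.* s ℤ.* b ℤ.* y ℤ.+ -1ℤ ℤ.* (s ℤ.* a ℤ.* y) ≡ -1ℤ ℤ.* s ℤ.* (a ℤ.+ b) ℤ.* y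
    factor = solve-∀

-- The alternating sum of values of H as a difference at `half`

module AlternatingSum (e : ℕ) where

  d N half : ℕ
  d = suc e
  N = e * e
  half = N / 2

  u v : ℕ → ℤ
  u m = ε (half + m) ℤ.* + (N C (half ∸ m))
  v m = ε (half + m) ℤ.* (ε d ℤ.* + (N C (half + m + 1)))

  -- The number d + N = e (e + 1) + 1 is odd.
  ε-parity : ε d ℤ.* ε N ≡ -1ℤ
  ε-parity = trans (ℤₚ.*-assoc -1ℤ (ε e) (ε N)) (cong (-1ℤ ℤ.*_) (trans (sym (ℤₚ.^-distribˡ-+-* -1ℤ e N)) (even e)))
    where
    even : ∀ e → ε (e + e * e) ≡ 1ℤ
    even zero    = refl
    even (suc e) = trans (cong ε (step e)) (trans (ℤₚ.^-distribˡ-+-* -1ℤ (e + e * e) (suc e + suc e)) (cong₂ ℤ._*_ (even e) (ε-double (suc e))))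
      where
      step : ∀ e → suc e + suc e * suc e ≡ e + e * e + (suc e + suc e)
      step = ℕ-solve-∀

  N<2n+2 : N ℕ.< suc half + suc half
  N<2n+2 = subst (ℕ._< suc half + suc half) (sym (DivMod.m≡m%n+[m/n]*n N 2))
    (subst (suc (N ℕ.% 2 + half * 2) ℕ.≤_) (two half) (ℕₚ.+-monoˡ-≤ (half * 2) (DivMod.m%n<n N 2)))
    where
    two : ∀ half → 2 + half * 2 ≡ suc half + suc half
    two = ℕ-solve-∀

  -- The argument − (m + 1) of g corresponds to the binomial coefficient C(N , half + m + 1).
  ∇-central : ∀ g → ∇ N g (+ half) ≡ ∑ (suc half) (λ m → u m ℤ.* g (+ m)) ℤ.+ ∑ (suc half) (λ m → v m ℤ.* (ε N ℤ.* g (ℤ.- + suc m)))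
  ∇-central g = begin
    ∇ N g (+ half)
      ≡⟨ ∇-expand N (suc half + suc half) N<2n+2 g (+ half) ⟩
    ∑ (suc half + suc half) term
      ≡⟨ ∑-split (suc half) (suc half) term ⟩
    ∑ (suc half) term ℤ.+ ∑ (suc half) (λ i → term (suc half + i))
      ≡⟨ cong₂ ℤ._+_ (trans (∑-reverse half term) (Σℤ.sum-cong-≗ λ i → low (Fin.toℕ i) (ℕ.s≤s⁻¹ (Finₚ.toℕ<n i)))) (∑-cong (suc half) high) ⟩
    ∑ (suc half) (λ m → u m ℤ.* g (+ m)) ℤ.+ ∑ (suc half) (λ m → v m ℤ.* (ε N ℤ.* g (ℤ.- + suc m))) ∎
    where
    open ≡-Reasoning
    term : ℕ → ℤ
    term i = ε i ℤ.* + (N C i) ℤ.* g (+ half ℤ.- + i)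
    low : ∀ m → m ℕ.≤ half → term (half ∸ m) ≡ u m ℤ.* g (+ m)
    low m m≤half = cong₂ (λ s y → s ℤ.* + (N C (half ∸ m)) ℤ.* g y) sign argument
      where
      sign : ε (half ∸ m) ≡ ε (half + m)
      sign = sym (trans (cong ε (trans (cong (_+ m) (sym (ℕₚ.m∸n+n≡m m≤half))) (ℕₚ.+-assoc (half ∸ m) m m)))
        (trans (ℤₚ.^-distribˡ-+-* -1ℤ (half ∸ m) (m + m)) (trans (cong (ε (half ∸ m) ℤ.*_) (ε-double m)) (ℤₚ.*-identityʳ _))))
      argument : + half ℤ.- + (half ∸ m) ≡ + m
      argument = trans (ℤₚ.m-n≡m⊖n half (half ∸ m)) (trans (ℤₚ.⊖-≥ (ℕₚ.m∸n≤m half m)) (cong +_ (ℕₚ.m∸[m∸n]≡n m≤half)))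
    high : ∀ m → term (suc half + m) ≡ v m ℤ.* (ε N ℤ.* g (ℤ.- + suc m))
    high m = begin
      -1ℤ ℤ.* ε (half + m) ℤ.* + (N C suc (half + m)) ℤ.* g (+ half ℤ.- + suc (half + m))
        ≡⟨ cong₂ (λ c y → -1ℤ ℤ.* ε (half + m) ℤ.* + (N C c) ℤ.* g y) (ℕₚ.+-comm 1 (half + m)) argument ⟩
      -1ℤ ℤ.* ε (half + m) ℤ.* c ℤ.* y
        ≡⟨ cong (λ s → s ℤ.* ε (half + m) ℤ.* c ℤ.* y) ε-parity ⟨
      ε d ℤ.* ε N ℤ.* ε (half + m) ℤ.* c ℤ.* y
        ≡⟨ regroup (ε d) (ε N) (ε (half + m)) c y ⟩
      v m ℤ.* (ε N ℤ.* y) ∎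
      where
      c y : ℤ
      c = + (N C (half + m + 1))
      y = g (ℤ.- + suc m)
      argument : + half ℤ.- + suc (half + m) ≡ ℤ.- + suc m
      argument = trans (cong (λ z → + half ℤ.- z) (trans (cong +_ (sym (ℕₚ.+-suc half m))) (ℤₚ.pos-+ half (suc m)))) (cancel (+ half) (+ suc m))
        where
        cancel : ∀ x y → x ℤ.- (x ℤ.+ y) ≡ ℤ.- y
        cancel = solve-∀
      regroup : ∀ a b s c y → a ℤ.* b ℤ.* s ℤ.* c ℤ.* y ≡ s ℤ.* (a ℤ.* c) ℤ.* (b ℤ.* y)
      regroup = solve-∀

  -- With g y = rising N (d y - a), the counts for a at m d are the values g m. As a + b = N + 1,
  -- reflection turns the counts for b at (m + 1) d into (-1)^N g (- (m + 1)). Together these are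
  -- the values of g in its N-th difference at `half`, which is N! d^N for every pair. The factor N!
  -- avoids division.
  piece : ∀ {a b} → a + b ≡ suc N → b ≢ 0 →
          + (N !) ℤ.* (∑ (suc half) (λ m → u m ℤ.* + compositions (suc N) a (m * d)) ℤ.+
                       ∑ (suc half) (λ m → v m ℤ.* + compositions (suc N) b (m * d + d))) ≡ + (N !) ℤ.* (+ d) ℤ.^ N
  piece {a} {b} a+b≡1+N b≢0 = begin
    + (N !) ℤ.* (∑ (suc half) (λ m → u m ℤ.* F m) ℤ.+ ∑ (suc half) (λ m → v m ℤ.* G m))
      ≡⟨ ℤₚ.*-distribˡ-+ (+ (N !)) _ _ ⟩
    + (N !) ℤ.* ∑ (suc half) (λ m → u m ℤ.* F m) ℤ.+ + (N !) ℤ.* ∑ (suc half) (λ m → v m ℤ.* G m)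
      ≡⟨ cong₂ ℤ._+_ (trans (∑-* (suc half) (+ (N !)) (λ m → u m ℤ.* F m)) (∑-cong (suc half) low))
                     (trans (∑-* (suc half) (+ (N !)) (λ m → v m ℤ.* G m)) (∑-cong (suc half) high)) ⟩
    ∑ (suc half) (λ m → u m ℤ.* g (+ m)) ℤ.+ ∑ (suc half) (λ m → v m ℤ.* (ε N ℤ.* g (ℤ.- + suc m)))
      ≡⟨ ∇-central g ⟨
    ∇ N g (+ half)
      ≡⟨ ∇-rising N (+ d) (ℤ.- + a) (+ half) ⟩
    + (N !) ℤ.* (+ d) ℤ.^ N ∎
    where
    open ≡-Reasoning
    F G : ℕ → ℤ
    F m = + compositions (suc N) a (m * d)
    G m = + compositions (suc N) b (m * d + d)
    g : ℤ → ℤ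
    g y = rising N (+ d ℤ.* y ℤ.+ (ℤ.- + a))
    swap : ∀ f s c → f ℤ.* (s ℤ.* c) ≡ s ℤ.* (f ℤ.* c)
    swap = solve-∀
    a≤N : a ℕ.≤ N
    a≤N = ℕ.s≤s⁻¹ (subst (suc a ℕ.≤_) a+b≡1+N (subst (ℕ._≤ a + b) (ℕₚ.+-comm a 1) (ℕₚ.+-monoʳ-≤ a (ℕₚ.n≢0⇒n>0 b≢0))))
    low : ∀ m → + (N !) ℤ.* (u m ℤ.* F m) ≡ u m ℤ.* g (+ m)
    low m = trans (swap (+ (N !)) (u m) (F m)) (cong (u m ℤ.*_)
      (trans (compositions≡rising N a (m * d) (ℕₚ.≤-trans a≤N (ℕₚ.m≤m+n N (m * d))))
             (cong (λ z → rising N (z ℤ.- + a)) (trans (ℤₚ.pos-* m d) (ℤₚ.*-comm (+ m) (+ d))))))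
    b≤ : ∀ m → b ℕ.≤ N + (m * d + d)
    b≤ m = ℕₚ.≤-trans (ℕₚ.m≤n+m b a) (subst (ℕ._≤ N + (m * d + d)) (sym a+b≡1+N)
      (subst (ℕ._≤ N + (m * d + d)) (ℕₚ.+-comm N 1) (ℕₚ.+-monoʳ-≤ N (ℕₚ.≤-trans (s≤s z≤n) (ℕₚ.m≤n+m d (m * d))))))
    argument : ∀ m → + (m * d + d) ℤ.- + b ≡ ℤ.- (+ d ℤ.* (ℤ.- + suc m) ℤ.+ (ℤ.- + a)) ℤ.- + suc N
    argument m = begin
      + (m * d + d) ℤ.- + b
        ≡⟨ cong (ℤ._- + b) (trans (cong +_ (ℕₚ.+-comm (m * d) d)) (ℤₚ.pos-* (suc m) d)) ⟩
      + suc m ℤ.* + d ℤ.- + b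
        ≡⟨ identity (+ suc m) (+ d) (+ a) (+ b) ⟩
      ℤ.- (+ d ℤ.* (ℤ.- + suc m) ℤ.+ (ℤ.- + a)) ℤ.- (+ a ℤ.+ + b)
        ≡⟨ cong (λ z → ℤ.- (+ d ℤ.* (ℤ.- + suc m) ℤ.+ (ℤ.- + a)) ℤ.- z) (trans (sym (ℤₚ.pos-+ a b)) (cong +_ a+b≡1+N)) ⟩
      ℤ.- (+ d ℤ.* (ℤ.- + suc m) ℤ.+ (ℤ.- + a)) ℤ.- + suc N ∎
      where
      identity : ∀ m d a b → m ℤ.* d ℤ.- b ≡ ℤ.- (d ℤ.* (ℤ.- m) ℤ.+ (ℤ.- a)) ℤ.- (a ℤ.+ b)
      identity = solve-∀
    high : ∀ m → + (N !) ℤ.* (v m ℤ.* G m) ≡ v m ℤ.* (ε N ℤ.* g (ℤ.- + suc m))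
    high m = trans (swap (+ (N !)) (v m) (G m)) (cong (v m ℤ.*_)
      (trans (compositions≡rising N b (m * d + d) (b≤ m))
        (trans (cong (rising N) (argument m)) (rising-reflect N (+ d ℤ.* (ℤ.- + suc m) ℤ.+ (ℤ.- + a))))))

  module _ (series : HilbertSeries e) where

    open HilbertSeries series

    private
      F G : List (ℕ × ℕ) → ℕ → ℤ
      F ps m = + ∑∈ (λ p → compositions (suc N) (proj₁ p) (m * d)) ps
      G ps m = + ∑∈ (λ p → compositions (suc N) (proj₂ p) (m * d + d)) ps

      ∑-cons : ∀ (s : ℕ → ℤ) (h h′ : ℕ → ℕ) → ∑ (suc half) (λ m → s m ℤ.* + (h m + h′ m)) ≡
               ∑ (suc half) (λ m → s m ℤ.* + h m) ℤ.+ ∑ (suc half) (λ m → s m ℤ.* + h′ m)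
      ∑-cons s h h′ = trans (∑-cong (suc half) λ m → trans (cong (s m ℤ.*_) (ℤₚ.pos-+ (h m) (h′ m))) (ℤₚ.*-distribˡ-+ (s m) (+ h m) (+ h′ m)))
        (∑-+ (suc half) (λ m → s m ℤ.* + h m) (λ m → s m ℤ.* + h′ m))

      total′ : ∀ ps → ListAll.All (λ (a , b) → a + b ≡ suc N) ps → ListAll.All (λ (a , b) → b ≢ 0) ps →
               + (N !) ℤ.* (∑ (suc half) (λ m → u m ℤ.* F ps m) ℤ.+ ∑ (suc half) (λ m → v m ℤ.* G ps m)) ≡
               + (N !) ℤ.* (+ List.length ps ℤ.* (+ d) ℤ.^ N)
      total′ [] [] [] = cong (+ (N !) ℤ.*_) (trans
        (cong₂ ℤ._+_ (∑-zero (suc half) λ m → ℤₚ.*-zeroʳ (u m)) (∑-zero (suc half) λ m → ℤₚ.*-zeroʳ (v m)))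
        (sym (ℤₚ.*-zeroˡ ((+ d) ℤ.^ N))))
      total′ ((a , b) ∷ ps) (deg ∷ degs) (b≢0 ∷ props) = begin
        + (N !) ℤ.* (∑ (suc half) (λ m → u m ℤ.* F ((a , b) ∷ ps) m) ℤ.+ ∑ (suc half) (λ m → v m ℤ.* G ((a , b) ∷ ps) m))
          ≡⟨ cong₂ (λ x y → + (N !) ℤ.* (x ℤ.+ y))
               (∑-cons u (λ m → compositions (suc N) a (m * d)) (λ m → ∑∈ (λ p → compositions (suc N) (proj₁ p) (m * d)) ps))
               (∑-cons v (λ m → compositions (suc N) b (m * d + d)) (λ m → ∑∈ (λ p → compositions (suc N) (proj₂ p) (m * d + d)) ps)) ⟩
        + (N !) ℤ.* ((X ℤ.+ X′) ℤ.+ (Y ℤ.+ Y′))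
          ≡⟨ regroup (+ (N !)) X X′ Y Y′ ⟩
        + (N !) ℤ.* (X ℤ.+ Y) ℤ.+ + (N !) ℤ.* (X′ ℤ.+ Y′)
          ≡⟨ cong₂ ℤ._+_ (piece deg b≢0) (total′ ps degs props) ⟩
        + (N !) ℤ.* (+ d) ℤ.^ N ℤ.+ + (N !) ℤ.* (+ List.length ps ℤ.* (+ d) ℤ.^ N)
          ≡⟨ collect (+ (N !)) ((+ d) ℤ.^ N) (+ List.length ps) ⟩
        + (N !) ℤ.* ((1ℤ ℤ.+ + List.length ps) ℤ.* (+ d) ℤ.^ N)
          ≡⟨ cong (λ l → + (N !) ℤ.* (l ℤ.* (+ d) ℤ.^ N)) (ℤₚ.pos-+ 1 (List.length ps)) ⟨
        + (N !) ℤ.* (+ suc (List.length ps) ℤ.* (+ d) ℤ.^ N) ∎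
        where
        open ≡-Reasoning
        X X′ Y Y′ : ℤ
        X = ∑ (suc half) (λ m → u m ℤ.* + compositions (suc N) a (m * d))
        X′ = ∑ (suc half) (λ m → u m ℤ.* F ps m)
        Y = ∑ (suc half) (λ m → v m ℤ.* + compositions (suc N) b (m * d + d))
        Y′ = ∑ (suc half) (λ m → v m ℤ.* G ps m)
        regroup : ∀ f x x′ y y′ → f ℤ.* ((x ℤ.+ x′) ℤ.+ (y ℤ.+ y′)) ≡ f ℤ.* (x ℤ.+ y) ℤ.+ f ℤ.* (x′ ℤ.+ y′)
        regroup = solve-∀
        collect : ∀ f p l → f ℤ.* p ℤ.+ f ℤ.* (l ℤ.* p) ≡ f ℤ.* ((1ℤ ℤ.+ l) ℤ.* p)
        collect = solve-∀

    alternatingSum : ∑₀^ half (λ m → ε (half + m) ℤ.* (+ (N C (half ∸ m)) ℤ.+ ε d ℤ.* + (N C (half + m + 1))) ℤ.* + H d (m * d)) ≡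
                     + List.length pieces ℤ.* (+ d) ℤ.^ N
    alternatingSum = ℤₚ.*-cancelˡ-≡ (+ (N !)) _ _ {{ℤ.≢-nonZero (ℕ.≢-nonZero⁻¹ (N !) {{N ℕₚ.!≢0}} ∘ ℤₚ.+-injective)}}
      (trans (cong (+ (N !) ℤ.*_) (trans (∑-cong (suc half) λ m → split (ε (half + m)) (+ (N C (half ∸ m))) (ε d ℤ.* + (N C (half + m + 1))) (+ H d (m * d)))
        (trans (∑-+ (suc half) (λ m → u m ℤ.* + H d (m * d)) (λ m → v m ℤ.* + H d (m * d)))
          -- The same number H d (m d) is expanded by the exponents a against u and by the exponents
          -- b against v.
          (cong₂ ℤ._+_ (∑-cong (suc half) λ m → cong (λ h → u m ℤ.* + h) (H≡ (m * d)))
                       (∑-cong (suc half) λ m → cong (λ h → v m ℤ.* + h) (H≡′ (m * d)))))))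
        (total′ pieces degrees proper))
      where
      split : ∀ s a b h → s ℤ.* (a ℤ.+ b) ℤ.* h ≡ s ℤ.* a ℤ.* h ℤ.+ s ℤ.* b ℤ.* h
      split = solve-∀

-- The ring of real numbers

ℚ-ring : AlmostCommutativeRing 0ℓ 0ℓ
ℚ-ring = fromCommutativeRing ℚₚ.+-*-commutativeRing λ p → dec⇒maybe (0ℚ ℚₚ.≟ p)

ℤ→ℚ : ℤ → ℚ
ℤ→ℚ z = z ℚ./ 1

private
  /1≃ : ∀ z → ℚ.toℚᵘ (z ℚ./ 1) ℚᵘ.≃ ℚᵘ.mkℚᵘ z 0
  /1≃ z = ℚₚ.toℚᵘ-fromℚᵘ (ℚᵘ.mkℚᵘ z 0)

ℤ→ℚ-+ : ∀ a b → ℤ→ℚ (a ℤ.+ b) ≡ ℤ→ℚ a ℚ.+ ℤ→ℚ b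
ℤ→ℚ-+ a b = ℚₚ.toℚᵘ-injective (begin
  ℚ.toℚᵘ ((a ℤ.+ b) ℚ./ 1)  ≈⟨ /1≃ (a ℤ.+ b) ⟩
  ℚᵘ.mkℚᵘ (a ℤ.+ b) 0  ≈⟨ ℚᵘ.*≡* (identity a b) ⟩
  ℚᵘ.mkℚᵘ a 0 ℚᵘ.+ ℚᵘ.mkℚᵘ b 0  ≈⟨ ℚᵘₚ.+-cong (/1≃ a) (/1≃ b) ⟨
  ℚ.toℚᵘ (a ℚ./ 1) ℚᵘ.+ ℚ.toℚᵘ (b ℚ./ 1)  ≈⟨ ℚₚ.toℚᵘ-homo-+ (a ℚ./ 1) (b ℚ./ 1) ⟨
  ℚ.toℚᵘ (a ℚ./ 1 ℚ.+ b ℚ./ 1)  ∎)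
  where
  open ℚᵘₚ.≃-Reasoning
  identity : ∀ a b → (a ℤ.+ b) ℤ.* 1ℤ ≡ (a ℤ.* 1ℤ ℤ.+ b ℤ.* 1ℤ) ℤ.* 1ℤ
  identity = solve-∀

ℤ→ℚ-* : ∀ a b → ℤ→ℚ (a ℤ.* b) ≡ ℤ→ℚ a ℚ.* ℤ→ℚ b
ℤ→ℚ-* a b = ℚₚ.toℚᵘ-injective (begin
  ℚ.toℚᵘ ((a ℤ.* b) ℚ./ 1)  ≈⟨ /1≃ (a ℤ.* b) ⟩
  ℚᵘ.mkℚᵘ a 0 ℚᵘ.* ℚᵘ.mkℚᵘ b 0  ≈⟨ ℚᵘₚ.*-cong (/1≃ a) (/1≃ b) ⟨
  ℚ.toℚᵘ (a ℚ./ 1) ℚᵘ.* ℚ.toℚᵘ (b ℚ./ 1)  ≈⟨ ℚₚ.toℚᵘ-homo-* (a ℚ./ 1) (b ℚ./ 1) ⟨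
  ℚ.toℚᵘ ((a ℚ./ 1) ℚ.* (b ℚ./ 1))  ∎)
  where open ℚᵘₚ.≃-Reasoning

ℤ→ℚ-mono-≤ : ∀ {a b} → a ℤ.≤ b → ℤ→ℚ a ℚ.≤ ℤ→ℚ b
ℤ→ℚ-mono-≤ {a} {b} a≤b = ℚₚ.toℚᵘ-cancel-≤ (ℚᵘₚ.≤-respˡ-≃ (ℚᵘₚ.≃-sym (/1≃ a)) (ℚᵘₚ.≤-respʳ-≃ (ℚᵘₚ.≃-sym (/1≃ b))
  (ℚᵘ.*≤* (ℤₚ.*-monoʳ-≤-nonNeg 1ℤ a≤b))))

ℤ→ℚ-cancel-≤ : ∀ {a b} → ℤ→ℚ a ℚ.≤ ℤ→ℚ b → a ℤ.≤ b
ℤ→ℚ-cancel-≤ {a} {b} p = subst₂ ℤ._≤_ (ℤₚ.*-identityʳ a) (ℤₚ.*-identityʳ b) (ℚᵘₚ.drop-*≤*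
  (ℚᵘₚ.≤-respˡ-≃ (/1≃ a) (ℚᵘₚ.≤-respʳ-≃ (/1≃ b) (ℚₚ.toℚᵘ-mono-≤ p))))

ℤ→ℚ-injective : ∀ {a b} → ℤ→ℚ a ≡ ℤ→ℚ b → a ≡ b
ℤ→ℚ-injective eq = ℤₚ.≤-antisym (ℤ→ℚ-cancel-≤ (ℚₚ.≤-reflexive eq)) (ℤ→ℚ-cancel-≤ (ℚₚ.≤-reflexive (sym eq)))

eventually-× : ∀ {P Q : ℕ → Set} → Eventually P → Eventually Q → Eventually (λ n → P n × Q n)
eventually-× (M , p) (N , q) = M ℕ.⊔ N , λ n le → p n (ℕₚ.m⊔n≤o⇒m≤o M N le) , q n (ℕₚ.m⊔n≤o⇒n≤o M N le)

eventually-map : ∀ {P Q : ℕ → Set} → (∀ n → P n → Q n) → Eventually P → Eventually Q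
eventually-map f (N , p) = N , λ n le → f n (p n le)

-- The operations on ℝ act termwise, so ring identities of ℚ carry over through this without
-- estimates.
≗⇒≃ : ∀ {x y} → (∀ n → seq x n ≡ seq y n) → x ≃ y
≗⇒≃ {x} {y} eq ε 0<ε = 0 , λ n _ → subst (λ q → ℚ.∣ q ∣ ℚ.< ε)
  (sym (trans (cong (λ p → p ℚ.- seq y n) (eq n)) (ℚₚ.+-inverseʳ (seq y n)))) 0<ε

≃-refl : ∀ {x} → x ≃ x
≃-refl {x} = ≗⇒≃ {x} {x} λ _ → refl

≃-sym : ∀ {x y} → x ≃ y → y ≃ x
≃-sym {x} {y} x≃y ε 0<ε = eventually-map
  (λ n → subst (ℚ._< ε) (trans (sym (ℚₚ.∣-p∣≡∣p∣ (seq x n ℚ.- seq y n))) (cong ℚ.∣_∣ (flip (seq x n) (seq y n))))) (x≃y ε 0<ε)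
  where
  flip : ∀ p q → ℚ.- (p ℚ.- q) ≡ q ℚ.- p
  flip = ring-solve-∀ ℚ-ring

≃-trans : ∀ {x y z} → x ≃ y → y ≃ z → x ≃ z
≃-trans {x} {y} {z} x≃y y≃z ε 0<ε =
  let δ , 0<δ , δ+δ≡ε = halve ε 0<ε in
  eventually-map (λ n (p , q) → begin-strict
    ℚ.∣ seq x n ℚ.- seq z n ∣  ≡⟨ cong ℚ.∣_∣ (telescope (seq x n) (seq y n) (seq z n)) ⟩
    ℚ.∣ (seq x n ℚ.- seq y n) ℚ.+ (seq y n ℚ.- seq z n) ∣  ≤⟨ ℚₚ.∣p+q∣≤∣p∣+∣q∣ (seq x n ℚ.- seq y n) (seq y n ℚ.- seq z n) ⟩
    ℚ.∣ seq x n ℚ.- seq y n ∣ ℚ.+ ℚ.∣ seq y n ℚ.- seq z n ∣  <⟨ ℚₚ.+-mono-< p q ⟩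
    δ ℚ.+ δ  ≡⟨ δ+δ≡ε ⟩
    ε  ∎) (eventually-× (x≃y δ 0<δ) (y≃z δ 0<δ))
  where
  open ℚₚ.≤-Reasoning
  telescope : ∀ p q r → p ℚ.- r ≡ (p ℚ.- q) ℚ.+ (q ℚ.- r)
  telescope = ring-solve-∀ ℚ-ring

+ᴿ-cong : ∀ {x x′ y y′} → x ≃ x′ → y ≃ y′ → x +ᴿ y ≃ x′ +ᴿ y′
+ᴿ-cong {x} {x′} {y} {y′} x≃ y≃ ε 0<ε =
  let δ , 0<δ , δ+δ≡ε = halve ε 0<ε in
  eventually-map (λ n (p , q) → begin-strict
    ℚ.∣ (seq x n ℚ.+ seq y n) ℚ.- (seq x′ n ℚ.+ seq y′ n) ∣  ≡⟨ cong ℚ.∣_∣ (+-rearrange (seq x n) (seq y n) (seq x′ n) (seq y′ n)) ⟩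
    ℚ.∣ (seq x n ℚ.- seq x′ n) ℚ.+ (seq y n ℚ.- seq y′ n) ∣  ≤⟨ ℚₚ.∣p+q∣≤∣p∣+∣q∣ (seq x n ℚ.- seq x′ n) (seq y n ℚ.- seq y′ n) ⟩
    ℚ.∣ seq x n ℚ.- seq x′ n ∣ ℚ.+ ℚ.∣ seq y n ℚ.- seq y′ n ∣  <⟨ ℚₚ.+-mono-< p q ⟩
    δ ℚ.+ δ  ≡⟨ δ+δ≡ε ⟩
    ε  ∎) (eventually-× (x≃ δ 0<δ) (y≃ δ 0<δ))
  where open ℚₚ.≤-Reasoning

*ᴿ-cong : ∀ {x x′ y y′} → x ≃ x′ → y ≃ y′ → x *ᴿ y ≃ x′ *ᴿ y′
*ᴿ-cong {x} {x′} {y} {y′} x≃ y≃ ε 0<ε =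
  let δ , 0<δ , δ+δ≡ε = halve ε 0<ε
      A , 0<A , x≤A   = bounded x
      B , 0<B , y′≤B  = bounded y′
      α , 0<α , Aα≡δ  = divide A δ 0<A 0<δ
      β , 0<β , Bβ≡δ  = divide B δ 0<B 0<δ
  in eventually-map (λ n ((a , b) , (p , q)) → begin-strict
    ℚ.∣ seq x n ℚ.* seq y n ℚ.- seq x′ n ℚ.* seq y′ n ∣
      ≡⟨ cong ℚ.∣_∣ (*-rearrange (seq x n) (seq y n) (seq x′ n) (seq y′ n)) ⟩
    ℚ.∣ seq x n ℚ.* (seq y n ℚ.- seq y′ n) ℚ.+ seq y′ n ℚ.* (seq x n ℚ.- seq x′ n) ∣
      ≤⟨ ℚₚ.∣p+q∣≤∣p∣+∣q∣ (seq x n ℚ.* (seq y n ℚ.- seq y′ n)) (seq y′ n ℚ.* (seq x n ℚ.- seq x′ n)) ⟩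
    ℚ.∣ seq x n ℚ.* (seq y n ℚ.- seq y′ n) ∣ ℚ.+ ℚ.∣ seq y′ n ℚ.* (seq x n ℚ.- seq x′ n) ∣
      <⟨ ℚₚ.+-mono-< (product-< (seq x n) (seq y n ℚ.- seq y′ n) 0<A a q) (product-< (seq y′ n) (seq x n ℚ.- seq x′ n) 0<B b p) ⟩
    A ℚ.* α ℚ.+ B ℚ.* β
      ≡⟨ cong₂ ℚ._+_ Aα≡δ Bβ≡δ ⟩
    δ ℚ.+ δ
      ≡⟨ δ+δ≡ε ⟩
    ε ∎) (eventually-× (eventually-× x≤A y′≤B) (eventually-× (x≃ β 0<β) (y≃ α 0<α)))
  where open ℚₚ.≤-Reasoning

-- As a product with -1, it inherits the Cauchy property and the congruence from multiplication.
-ᴿ_ : ℝ → ℝ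
-ᴿ x = fromℚ (ℚ.- 1ℚ) *ᴿ x

ℝ-commutativeRing : CommutativeRing 0ℓ 0ℓ
ℝ-commutativeRing = record
  { Carrier = ℝ ; _≈_ = _≃_ ; _+_ = _+ᴿ_ ; _*_ = _*ᴿ_ ; -_ = -ᴿ_ ; 0# = 0ℝ ; 1# = 1ℝ
  ; isCommutativeRing = record
    { isRing = record
      { +-isAbelianGroup = record
        { isGroup = record
          { isMonoid = record
            { isSemigroup = record
              { isMagma = record
                { isEquivalence = record
                  { refl = λ {x} → ≃-refl {x} ; sym = λ {x} {y} → ≃-sym {x} {y} ; trans = λ {x} {y} {z} → ≃-trans {x} {y} {z} }
                ; ∙-cong = λ {x} {x′} {y} {y′} → +ᴿ-cong {x} {x′} {y} {y′} }
              ; assoc = λ x y z → ≗⇒≃ {(x +ᴿ y) +ᴿ z} {x +ᴿ (y +ᴿ z)} λ n → ℚₚ.+-assoc (seq x n) (seq y n) (seq z n) }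
            ; identity = (λ x → ≗⇒≃ {0ℝ +ᴿ x} {x} λ n → ℚₚ.+-identityˡ (seq x n))
                       , (λ x → ≗⇒≃ {x +ᴿ 0ℝ} {x} λ n → ℚₚ.+-identityʳ (seq x n)) }
          ; inverse = (λ x → ≗⇒≃ {(-ᴿ x) +ᴿ x} {0ℝ} λ n → inverseˡ (seq x n))
                    , (λ x → ≗⇒≃ {x +ᴿ (-ᴿ x)} {0ℝ} λ n → inverseʳ (seq x n))
          ; ⁻¹-cong = λ {x} {y} → *ᴿ-cong {fromℚ (ℚ.- 1ℚ)} {fromℚ (ℚ.- 1ℚ)} {x} {y} (≃-refl {fromℚ (ℚ.- 1ℚ)}) }
        ; comm = λ x y → ≗⇒≃ {x +ᴿ y} {y +ᴿ x} λ n → ℚₚ.+-comm (seq x n) (seq y n) }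
      ; *-cong = λ {x} {x′} {y} {y′} → *ᴿ-cong {x} {x′} {y} {y′}
      ; *-assoc = λ x y z → ≗⇒≃ {(x *ᴿ y) *ᴿ z} {x *ᴿ (y *ᴿ z)} λ n → ℚₚ.*-assoc (seq x n) (seq y n) (seq z n)
      ; *-identity = (λ x → ≗⇒≃ {1ℝ *ᴿ x} {x} λ n → ℚₚ.*-identityˡ (seq x n))
                   , (λ x → ≗⇒≃ {x *ᴿ 1ℝ} {x} λ n → ℚₚ.*-identityʳ (seq x n))
      ; distrib = (λ x y z → ≗⇒≃ {x *ᴿ (y +ᴿ z)} {(x *ᴿ y) +ᴿ (x *ᴿ z)} λ n → ℚₚ.*-distribˡ-+ (seq x n) (seq y n) (seq z n))
                , (λ x y z → ≗⇒≃ {(y +ᴿ z) *ᴿ x} {(y *ᴿ x) +ᴿ (z *ᴿ x)} λ n → ℚₚ.*-distribʳ-+ (seq x n) (seq y n) (seq z n)) }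
    ; *-comm = λ x y → ≗⇒≃ {x *ᴿ y} {y *ᴿ x} λ n → ℚₚ.*-comm (seq x n) (seq y n) } }
  where
  inverseˡ : ∀ p → ℚ.- 1ℚ ℚ.* p ℚ.+ p ≡ 0ℚ
  inverseˡ = ring-solve-∀ ℚ-ring
  inverseʳ : ∀ p → p ℚ.+ ℚ.- 1ℚ ℚ.* p ≡ 0ℚ
  inverseʳ = ring-solve-∀ ℚ-ring

fromℤ-+ : ∀ a b → fromℤ (a ℤ.+ b) ≃ fromℤ a +ᴿ fromℤ b
fromℤ-+ a b = ≗⇒≃ {fromℤ (a ℤ.+ b)} {fromℤ a +ᴿ fromℤ b} λ _ → ℤ→ℚ-+ a b

module ℚᴮ = BlockCoordinates ℚₚ.+-*-commutativeRing ℤ→ℚ ℤ→ℚ-+ refl refl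
module ℝᴮ = BlockCoordinates ℝ-commutativeRing fromℤ fromℤ-+ (≃-refl {0ℝ}) (≃-refl {1ℝ})

-- The chart of the affine hull of the Birkhoff polytope

ℤ→ℚ-mono-< : ∀ {a b} → a ℤ.< b → ℤ→ℚ a ℚ.< ℤ→ℚ b
ℤ→ℚ-mono-< {a} {b} a<b = ℚₚ.≰⇒> λ b≤a → ℤₚ.<⇒≱ a<b (ℤ→ℚ-cancel-≤ b≤a)

reciprocal : ∀ n → ∃[ κ ] 0ℚ ℚ.< κ × κ ℚ.* ℤ→ℚ (+ suc n) ≡ 1ℚ
reciprocal n = ℚ.1/ q , ℚₚ.positive⁻¹ (ℚ.1/ q) {{ℚₚ.1/pos⇒pos q}} , ℚₚ.*-inverseˡ q
  where
  q : ℚ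
  q = ℤ→ℚ (+ suc n)
  instance
    q>0 : ℚ.Positive q
    q>0 = ℚ.positive (ℤ→ℚ-mono-< {0ℤ} {+ suc n} (+<+ (s≤s z≤n)))
    q≢0 : ℚ.NonZero q
    q≢0 = ℚₚ.pos⇒nonZero q

seq-sum : ∀ {k} (f : Fin k → ℝ) n → seq (sum f) n ≡ ℚᴮ.S.sum (λ i → seq (f i) n)
seq-sum {zero}  f n = refl
seq-sum {suc k} f n = cong (ℚ._+_ (seq (f zero) n)) (seq-sum (f ∘ suc) n)

fromℚ-injective : ∀ {p q} → fromℚ p ≃ fromℚ q → p ≡ q
fromℚ-injective {p} {q} p≃q with p ℚₚ.≟ q
... | yes p≡q = p≡q
... | no  p≢q = contradiction (proj₂ close (proj₁ close) ℕₚ.≤-refl) (ℚₚ.<-irrefl refl)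
  where
  distinct : p ℚ.- q ≢ 0ℚ
  distinct eq = p≢q (trans (sym (restore p q)) (trans (cong (ℚ._+ q) eq) (ℚₚ.+-identityˡ q)))
    where
    restore : ∀ p q → p ℚ.- q ℚ.+ q ≡ p
    restore = ring-solve-∀ ℚ-ring
  0<ε : 0ℚ ℚ.< ℚ.∣ p ℚ.- q ∣
  0<ε = ℚₚ.≰⇒> λ ≤0 → distinct (ℚₚ.∣p∣≡0⇒p≡0 (p ℚ.- q) (ℚₚ.≤-antisym ≤0 (ℚₚ.0≤∣p∣ (p ℚ.- q))))
  close : Eventually (λ _ → ℚ.∣ p ℚ.- q ∣ ℚ.< ℚ.∣ p ℚ.- q ∣)
  close = p≃q ℚ.∣ p ℚ.- q ∣ 0<ε

fromℚ-mono : ∀ {p q} → p ℚ.≤ q → fromℚ p ≤ fromℚ q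
fromℚ-mono {p} {q} p≤q ε 0<ε = 0 , λ _ _ →
  subst (ℚ._< q ℚ.+ ε) (ℚₚ.+-identityʳ p) (ℚₚ.+-mono-≤-< p≤q 0<ε)

ℚ-line : ∀ {n k} (c : ℚ) (f : Fin n → ℤ) → sumℤ f ≡ k → ℚᴮ.S.sum (λ i → c ℚ.* ℤ→ℚ (f i)) ≡ c ℚ.* ℤ→ℚ k
ℚ-line c f refl = trans (sym (ℚᴮ.S.*-distribˡ-sum c (ℤ→ℚ ∘ f))) (cong (c ℚ.*_) (sym (ℚᴮ.ι-sum f)))

module _ {e : ℕ} where

  private
    d D : ℕ
    d = suc e
    D = e * e

  birkhoff-sums : ∀ {x} → Birkhoff d x → ℝᴮ.Sums 1ℝ x
  birkhoff-sums x∈B = Birkhoff.rows x∈B , Birkhoff.cols x∈B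

  hull-sums : ∀ {y} → AffineHull (Birkhoff d) y → ℝᴮ.Sums 1ℝ y
  hull-sums {y} h = ℝᴮ.affine-hull-sums coeffs points (λ k → birkhoff-sums (points∈ k)) affine {y} equal
    where open AffineHull h

  block-index : ∀ {C : Set} (f : Fin e → Fin e → C) a b →
                (let (a′ , b′) = Fin.remQuot {e} e (Fin.combine a b) in f a′ b′) ≡ f a b
  block-index f a b = cong (λ (a , b) → f a b) (Finₚ.remQuot-combine a b)

  ≡⇒≃ : ∀ {x y : ℝ} → x ≡ y → x ≃ y
  ≡⇒≃ {x} refl = ≃-refl {x}

  module Spanning (t : Fin D → ℝ) where

    r : ℚ
    r = proj₁ (reciprocal e)

    r≥0 : 0ℚ ℚ.≤ r
    r≥0 = ℚₚ.<⇒≤ (proj₁ (proj₂ (reciprocal e)))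

    r*d≡1 : r ℚ.* ℤ→ℚ (+ d) ≡ 1ℚ
    r*d≡1 = proj₂ (proj₂ (reciprocal e))

    -- The barycentre J / d and its translates by the basis vectors divided by d.
    numerator : Fin (suc D) → Fin d → Fin d → ℤ
    numerator zero    i j = 1ℤ
    numerator (suc x) i j = 1ℤ ℤ.+ basis {e} x i j

    points : Fin (suc D) → Fin d × Fin d → ℝ
    points k (i , j) = fromℚ (r ℚ.* ℤ→ℚ (numerator k i j))

    numerator-sums : ∀ k → LineSums (+ d) (numerator k)
    numerator-sums zero    = (λ _ → sumℤ-const d) , (λ _ → sumℤ-const d)
    numerator-sums (suc x) =
      (λ i → trans (Σℤ.∑-distrib-+ (λ _ → 1ℤ) (corner ab i)) (trans (cong₂ ℤ._+_ (sumℤ-const d) (proj₁ (corner-sums ab) i)) (ℤₚ.+-identityʳ (+ d)))) ,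
      (λ j → trans (Σℤ.∑-distrib-+ (λ _ → 1ℤ) (λ i → corner ab i j)) (trans (cong₂ ℤ._+_ (sumℤ-const d) (proj₂ (corner-sums ab) j)) (ℤₚ.+-identityʳ (+ d))))
      where
      ab : Fin e × Fin e
      ab = Fin.remQuot e x

    -- Entries of a corner matrix are products of two numbers among -1, 0 and 1, hence at least -1;
    -- adding the all-ones matrix suffices.
    numerator-nonneg : ∀ k i j → 0ℤ ℤ.≤ numerator k i j
    numerator-nonneg zero    i j = +≤+ z≤n
    numerator-nonneg (suc x) i j = trit-product (trit (proj₁ ab) i) (trit (proj₂ ab) j)
      where
      ab : Fin e × Fin e
      ab = Fin.remQuot e x
      trit : ∀ a i → Trit (coef {e} a i)
      trit a zero    = minus
      trit a (suc i) with a Finₚ.≟ i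
      ... | yes refl = subst Trit (sym (δ-refl a)) (unit₀ one)
      ... | no  a≢i  = subst Trit (sym (δ-≢ a≢i)) (unit₀ zero)

    points∈ : ∀ k → Birkhoff d (points k)
    points∈ k = record
      { nonneg = λ (i , j) → fromℚ-mono (ℚₚ.nonNegative⁻¹ (r ℚ.* ℤ→ℚ (numerator k i j))
          {{ℚₚ.nonNeg*nonNeg⇒nonNeg r {{ℚ.nonNegative r≥0}} (ℤ→ℚ (numerator k i j)) {{ℚ.nonNegative (ℤ→ℚ-mono-≤ (numerator-nonneg k i j))}}}})
      ; rows = λ i → line (numerator k i) (proj₁ (numerator-sums k) i)
      ; cols = λ j → line (λ i → numerator k i j) (proj₂ (numerator-sums k) j) }
      where
      line : ∀ (f : Fin d → ℤ) → sumℤ f ≡ + d → sum (λ j → fromℚ (r ℚ.* ℤ→ℚ (f j))) ≃ 1ℝ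
      line f eq = ≗⇒≃ {sum (λ j → fromℚ (r ℚ.* ℤ→ℚ (f j)))} {1ℝ} λ n →
        trans (seq-sum (λ j → fromℚ (r ℚ.* ℤ→ℚ (f j))) n) (trans (ℚ-line r f eq) r*d≡1)

    -- As the coefficients sum to 1, the block entry of the combination at x is (1 + `weight x`) /
    -- d, and this has to be `t x`.
    weight : Fin D → ℝ
    weight x = (fromℤ (+ d) *ᴿ t x) +ᴿ fromℤ -1ℤ

    coeffs : Fin (suc D) → ℝ
    coeffs zero    = 1ℝ +ᴿ (-ᴿ sum weight)
    coeffs (suc x) = weight x

    affine : sum coeffs ≃ 1ℝ
    affine = ≗⇒≃ {sum coeffs} {1ℝ} λ n → cancel (seq (sum weight) n)
      where
      cancel : ∀ w → (1ℚ ℚ.+ ℚ.- 1ℚ ℚ.* w) ℚ.+ w ≡ 1ℚ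
      cancel = ring-solve-∀ ℚ-ring

    combination : Fin d × Fin d → ℝ
    combination ij = sum (λ k → coeffs k *ᴿ points k ij)

    combination-block : ∀ a b → combination (suc a , suc b) ≃ t (Fin.combine a b)
    combination-block a b = ≗⇒≃ {combination (suc a , suc b)} {t ab} λ n → begin
      (1ℚ ℚ.+ ℚ.- 1ℚ ℚ.* seq (sum weight) n) ℚ.* (r ℚ.* 1ℚ) ℚ.+ seq (sum (λ x → weight x *ᴿ points (suc x) (suc a , suc b))) n
        ≡⟨ cong₂ (λ w s → (1ℚ ℚ.+ ℚ.- 1ℚ ℚ.* w) ℚ.* (r ℚ.* 1ℚ) ℚ.+ s) (seq-sum weight n)
             (trans (seq-sum (λ x → weight x *ᴿ points (suc x) (suc a , suc b)) n) (tail n)) ⟩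
      (1ℚ ℚ.+ ℚ.- 1ℚ ℚ.* W n) ℚ.* (r ℚ.* 1ℚ) ℚ.+ (r ℚ.* W n ℚ.+ r ℚ.* (ℤ→ℚ (+ d) ℚ.* seq (t ab) n ℚ.+ ℚ.- 1ℚ))
        ≡⟨ collect r (W n) (ℤ→ℚ (+ d)) (seq (t ab) n) ⟩
      r ℚ.* ℤ→ℚ (+ d) ℚ.* seq (t ab) n
        ≡⟨ cong (ℚ._* seq (t ab) n) r*d≡1 ⟩
      1ℚ ℚ.* seq (t ab) n
        ≡⟨ ℚₚ.*-identityˡ (seq (t ab) n) ⟩
      seq (t ab) n ∎
      where
      open ≡-Reasoning
      ab : Fin D
      ab = Fin.combine a b
      w : ℕ → Fin D → ℚ
      w n x = seq (weight x) n
      W : ℕ → ℚ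
      W n = ℚᴮ.S.sum (w n)
      c : Fin D → ℤ
      c x = basis {e} x (suc a) (suc b)
      collect : ∀ r w d t → (1ℚ ℚ.+ ℚ.- 1ℚ ℚ.* w) ℚ.* (r ℚ.* 1ℚ) ℚ.+ (r ℚ.* w ℚ.+ r ℚ.* (d ℚ.* t ℚ.+ ℚ.- 1ℚ)) ≡ r ℚ.* d ℚ.* t
      collect = ring-solve-∀ ℚ-ring
      expand : ∀ w r c → w ℚ.* (r ℚ.* (1ℚ ℚ.+ c)) ≡ r ℚ.* w ℚ.+ r ℚ.* (w ℚ.* c)
      expand = ring-solve-∀ ℚ-ring
      tail : ∀ n → ℚᴮ.S.sum (λ x → w n x ℚ.* (r ℚ.* ℤ→ℚ (1ℤ ℤ.+ c x))) ≡ r ℚ.* W n ℚ.+ r ℚ.* w n ab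
      tail n = begin
        ℚᴮ.S.sum (λ x → w n x ℚ.* (r ℚ.* ℤ→ℚ (1ℤ ℤ.+ c x)))
          ≡⟨ ℚᴮ.S.sum-cong-≗ (λ x → trans (cong (λ y → w n x ℚ.* (r ℚ.* y)) (ℤ→ℚ-+ 1ℤ (c x))) (expand (w n x) r (ℤ→ℚ (c x)))) ⟩
        ℚᴮ.S.sum (λ x → r ℚ.* w n x ℚ.+ r ℚ.* (w n x ℚ.* ℤ→ℚ (c x)))
          ≡⟨ ℚᴮ.S.∑-distrib-+ (λ x → r ℚ.* w n x) (λ x → r ℚ.* (w n x ℚ.* ℤ→ℚ (c x))) ⟩
        ℚᴮ.S.sum (λ x → r ℚ.* w n x) ℚ.+ ℚᴮ.S.sum (λ x → r ℚ.* (w n x ℚ.* ℤ→ℚ (c x)))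
          ≡⟨ cong₂ ℚ._+_ (ℚᴮ.S.*-distribˡ-sum r (w n)) (ℚᴮ.S.*-distribˡ-sum r (λ x → w n x ℚ.* ℤ→ℚ (c x))) ⟨
        r ℚ.* W n ℚ.+ r ℚ.* ℚᴮ.S.sum (λ x → w n x ℚ.* ℤ→ℚ (c x))
          ≡⟨ cong (λ y → r ℚ.* W n ℚ.+ r ℚ.* y) (ℚᴮ.linear-block (w n) a b) ⟩
        r ℚ.* W n ℚ.+ r ℚ.* w n ab ∎

    hull : AffineHull (Birkhoff d) (ℝᴮ.pointᴿ t)
    hull = record
      { points = points ; coeffs = coeffs ; points∈ = points∈ ; affine = affine
      ; equal = ℝᴮ.block-determines {k = 1ℝ} {ℝᴮ.pointᴿ t} {combination} (ℝᴮ.point-sums t)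
          (ℝᴮ.affine-hull-sums coeffs points (λ k → birkhoff-sums (points∈ k)) affine {combination} λ ij → ≃-refl {combination ij})
          λ a b → ≃-trans {ℝᴮ.pointᴿ t (suc a , suc b)} {t (Fin.combine a b)} {combination (suc a , suc b)}
            (ℝᴮ.point-block t a b) (≃-sym {combination (suc a , suc b)} {t (Fin.combine a b)} (combination-block a b)) }

  -- The lower right block supplies the coordinates: a matrix with line sums 1 is determined by it,
  -- over ℤ as over ℝ, and every block occurs.
  chart : LatticeChart D (Birkhoff d)
  chart = record
    { origin = λ (i , j) → origin i j
    ; basis  = λ x (i , j) → basis {e} x i j
    ; point∈hull  = Spanning.hull
    ; hull⊆points = λ y h → block y , ℝᴮ.block-determines {k = 1ℝ} {y} {ℝᴮ.pointᴿ (block y)} (hull-sums h) (ℝᴮ.point-sums (block y))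
        λ a b → ≃-sym {ℝᴮ.pointᴿ (block y) (suc a , suc b)} {y (suc a , suc b)}
          (≃-trans {ℝᴮ.pointᴿ (block y) (suc a , suc b)} {block y (Fin.combine a b)} {y (suc a , suc b)}
            (ℝᴮ.point-block (block y) a b) (≡⇒≃ (block-index (λ a b → y (suc a , suc b)) a b)))
    ; independent = λ t t≃0 x → subst (λ x → t x ≃ 0ℝ) (Finₚ.combine-remQuot {e} e x)
        (let a = proj₁ (Fin.remQuot {e} e x) ; b = proj₂ (Fin.remQuot {e} e x)
             s = sum (λ x → t x *ᴿ fromℤ (basis {e} x (suc a) (suc b)))
         in ≃-trans {t (Fin.combine a b)} {s} {0ℝ} (≃-sym {s} {t (Fin.combine a b)} (ℝᴮ.linear-block t a b)) (t≃0 (suc a , suc b)))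
    ; generating = λ z h → let c = λ x → let (a , b) = Fin.remQuot {e} e x in z (suc a , suc b) in
        c , ℤᴮ.block-determines {k = 1ℤ} {z} {ℤᴮ.pointᴿ c} (integral-sums z (hull-sums h)) (ℤᴮ.point-sums c)
          λ a b → sym (trans (ℤᴮ.point-block c a b) (block-index (λ a b → z (suc a , suc b)) a b)) }
    where
    block : (Fin d × Fin d → ℝ) → Fin D → ℝ
    block y x = let (a , b) = Fin.remQuot {e} e x in y (suc a , suc b)
    integral : ∀ (f : Fin d → ℤ) → sum (fromℤ ∘ f) ≃ 1ℝ → sumℤ f ≡ 1ℤ
    integral f eq = ℤ→ℚ-injective (fromℚ-injective {ℤ→ℚ (sumℤ f)} {1ℚ}
      (≃-trans {fromℤ (sumℤ f)} {sum (fromℤ ∘ f)} {1ℝ} (ℝᴮ.ι-sum f) eq))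
    integral-sums : ∀ z → ℝᴮ.Sums 1ℝ (fromℤ ∘ z) → ℤᴮ.Sums 1ℤ z
    integral-sums z (rows , cols) = (λ i → integral (λ j → z (i , j)) (rows i)) , (λ j → integral (λ i → z (i , j)) (cols j))

-- Order on the real numbers

p≤∣p∣ : ∀ p → p ℚ.≤ ℚ.∣ p ∣
p≤∣p∣ p with ℚₚ.≤-total 0ℚ p
... | inj₁ 0≤p = ℚₚ.≤-reflexive (sym (ℚₚ.0≤p⇒∣p∣≡p 0≤p))
... | inj₂ p≤0 = ℚₚ.≤-trans p≤0 (ℚₚ.0≤∣p∣ p)

≃⇒≤ : ∀ {x y} → x ≃ y → x ≤ y
≃⇒≤ {x} {y} x≃y ε 0<ε = eventually-map (λ n close → begin-strict
  seq x n  ≡⟨ restore (seq x n) (seq y n) ⟩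
  seq y n ℚ.+ (seq x n ℚ.- seq y n) ≤⟨ ℚₚ.+-monoʳ-≤ (seq y n) (p≤∣p∣ (seq x n ℚ.- seq y n)) ⟩
  seq y n ℚ.+ ℚ.∣ seq x n ℚ.- seq y n ∣ <⟨ ℚₚ.+-monoʳ-< (seq y n) close ⟩
  seq y n ℚ.+ ε  ∎) (x≃y ε 0<ε)
  where
  open ℚₚ.≤-Reasoning
  restore : ∀ p q → p ≡ q ℚ.+ (p ℚ.- q)
  restore = ring-solve-∀ ℚ-ring

≤-trans : ∀ {x y z} → x ≤ y → y ≤ z → x ≤ z
≤-trans {x} {y} {z} x≤y y≤z ε 0<ε =
  let δ , 0<δ , δ+δ≡ε = halve ε 0<ε in
  eventually-map (λ n (p , q) → begin-strict
    seq x n  <⟨ p ⟩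
    seq y n ℚ.+ δ  <⟨ ℚₚ.+-monoˡ-< δ q ⟩
    seq z n ℚ.+ δ ℚ.+ δ  ≡⟨ trans (ℚₚ.+-assoc (seq z n) δ δ) (cong (ℚ._+_ (seq z n)) δ+δ≡ε) ⟩
    seq z n ℚ.+ ε  ∎) (eventually-× (x≤y δ 0<δ) (y≤z δ 0<δ))
  where open ℚₚ.≤-Reasoning

+ᴿ-mono-≤ : ∀ {x x′ y y′} → x ≤ x′ → y ≤ y′ → x +ᴿ y ≤ x′ +ᴿ y′
+ᴿ-mono-≤ {x} {x′} {y} {y′} x≤ y≤ ε 0<ε =
  let δ , 0<δ , δ+δ≡ε = halve ε 0<ε in
  eventually-map (λ n (p , q) → begin-strict
    seq x n ℚ.+ seq y n  <⟨ ℚₚ.+-mono-< p q ⟩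
    (seq x′ n ℚ.+ δ) ℚ.+ (seq y′ n ℚ.+ δ)  ≡⟨ regroup (seq x′ n) (seq y′ n) δ ⟩
    (seq x′ n ℚ.+ seq y′ n) ℚ.+ (δ ℚ.+ δ)  ≡⟨ cong (ℚ._+_ (seq x′ n ℚ.+ seq y′ n)) δ+δ≡ε ⟩
    (seq x′ n ℚ.+ seq y′ n) ℚ.+ ε  ∎) (eventually-× (x≤ δ 0<δ) (y≤ δ 0<δ))
  where
  open ℚₚ.≤-Reasoning
  regroup : ∀ p q r → (p ℚ.+ r) ℚ.+ (q ℚ.+ r) ≡ (p ℚ.+ q) ℚ.+ (r ℚ.+ r)
  regroup = ring-solve-∀ ℚ-ring

<⇒≤ : ∀ {x y} → x < y → x ≤ y
<⇒≤ {x} {y} (δ , 0<δ , x+δ<y) ε 0<ε = eventually-map (λ n lt → begin-strict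
  seq x n  ≡⟨ ℚₚ.+-identityʳ (seq x n) ⟨
  seq x n ℚ.+ 0ℚ  <⟨ ℚₚ.+-monoʳ-< (seq x n) 0<δ ⟩
  seq x n ℚ.+ δ  <⟨ lt ⟩
  seq y n  ≡⟨ ℚₚ.+-identityʳ (seq y n) ⟨
  seq y n ℚ.+ 0ℚ  <⟨ ℚₚ.+-monoʳ-< (seq y n) 0<ε ⟩
  seq y n ℚ.+ ε  ∎) x+δ<y
  where open ℚₚ.≤-Reasoning

eventually-const : ∀ {A : Set} → Eventually (λ _ → A) → A
eventually-const (N , a) = a N ℕₚ.≤-refl

≤-<-fromℚ : ∀ {p q x} → fromℚ p ≤ x → x < fromℚ q → p ℚ.< q
≤-<-fromℚ {p} {q} {x} p≤x (ε , 0<ε , x+ε<q) =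
  eventually-const (eventually-map (λ n (l , u) → ℚₚ.<-trans l u) (eventually-× (p≤x ε 0<ε) x+ε<q))

fromℚ-cancel-≤ : ∀ {p q} → fromℚ p ≤ fromℚ q → p ℚ.≤ q
fromℚ-cancel-≤ {p} {q} p≤q = ℚₚ.≮⇒≥ λ q<p →
  let ε = p ℚ.- q
      0<ε = subst (ℚ._< ε) (ℚₚ.+-inverseʳ q) (ℚₚ.+-monoˡ-< (ℚ.- q) q<p)
  in ℚₚ.<-irrefl refl (subst (p ℚ.<_) (restore p q) (eventually-const (p≤q ε 0<ε)))
  where
  restore : ∀ p q → q ℚ.+ (p ℚ.- q) ≡ p
  restore = ring-solve-∀ ℚ-ring

-- One index n past N with seq x n + ε ≤ q would already give x < q: later terms stay within η = ε /
-- 4 of `seq x n`, so they are below q by more than η. The comparison at n is one of rationals,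
-- hence decidable.
≮⇒≥ : ∀ {x q} → ¬ (x < fromℚ q) → fromℚ q ≤ x
≮⇒≥ {x} {q} x≮q ε 0<ε =
  let δ , 0<δ , δ+δ≡ε = halve ε 0<ε
      η , 0<η , η+η≡δ = halve δ 0<δ
      N , close = cauchy x η 0<η
  in N , λ n N≤n → ℚₚ.≰⇒> λ xₙ+ε≤q → x≮q (η , 0<η , N , λ m N≤m → begin-strict
    seq x m ℚ.+ η  ≡⟨ expand (seq x m) (seq x n) η ⟩
    seq x n ℚ.+ (seq x m ℚ.- seq x n) ℚ.+ η  <⟨ ℚₚ.+-monoˡ-< η (ℚₚ.+-monoʳ-< (seq x n) (ℚₚ.≤-<-trans (p≤∣p∣ (seq x m ℚ.- seq x n)) (close m n N≤m N≤n))) ⟩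
    seq x n ℚ.+ η ℚ.+ η  ≡⟨ trans (ℚₚ.+-assoc (seq x n) η η) (cong (ℚ._+_ (seq x n)) η+η≡δ) ⟩
    seq x n ℚ.+ δ  ≡⟨ cong (ℚ._+_ (seq x n)) (ℚₚ.+-identityʳ δ) ⟨
    seq x n ℚ.+ (δ ℚ.+ 0ℚ)  <⟨ ℚₚ.+-monoʳ-< (seq x n) (ℚₚ.+-monoʳ-< δ 0<δ) ⟩
    seq x n ℚ.+ (δ ℚ.+ δ)  ≡⟨ cong (ℚ._+_ (seq x n)) δ+δ≡ε ⟩
    seq x n ℚ.+ ε  ≤⟨ xₙ+ε≤q ⟩
    q  ∎)
  where
  open ℚₚ.≤-Reasoning
  expand : ∀ p q r → p ℚ.+ r ≡ q ℚ.+ (p ℚ.- q) ℚ.+ r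
  expand = ring-solve-∀ ℚ-ring

≤-sum : ∀ {n} (q : Fin n → ℚ) (x : Fin n → ℝ) → (∀ i → fromℚ (q i) ≤ x i) → fromℚ (ℚᴮ.S.sum q) ≤ sum x
≤-sum {zero}  q x q≤x = fromℚ-mono ℚₚ.≤-refl
≤-sum {suc n} q x q≤x = +ᴿ-mono-≤ {fromℚ (q zero)} {x zero} {fromℚ (ℚᴮ.S.sum (q ∘ suc))} {sum (x ∘ suc)}
  (q≤x zero) (≤-sum (q ∘ suc) (x ∘ suc) (q≤x ∘ suc))

sum-≤ : ∀ {n} (q : Fin n → ℚ) (x : Fin n → ℝ) → (∀ i → x i ≤ fromℚ (q i)) → sum x ≤ fromℚ (ℚᴮ.S.sum q)
sum-≤ {zero}  q x x≤q = fromℚ-mono ℚₚ.≤-refl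
sum-≤ {suc n} q x x≤q = +ᴿ-mono-≤ {x zero} {fromℚ (q zero)} {sum (x ∘ suc)} {fromℚ (ℚᴮ.S.sum (q ∘ suc))}
  (x≤q zero) (sum-≤ (q ∘ suc) (x ∘ suc) (x≤q ∘ suc))

module _ {x y : ℝ} {c q : ℚ} (x+y≃c : x +ᴿ y ≃ fromℚ c) where

  open ℚₚ.≤-Reasoning

  private
    collect : ∀ a b p δ → (a ℚ.+ δ) ℚ.+ (b ℚ.+ δ) ℚ.- (p ℚ.+ b) ≡ (a ℚ.- p) ℚ.+ (δ ℚ.+ δ)
    collect = ring-solve-∀ ℚ-ring

  complement-≥ : y ≤ fromℚ q → fromℚ (c ℚ.- q) ≤ x
  complement-≥ y≤q ε 0<ε =
    let δ , 0<δ , δ+δ≡ε = halve ε 0<ε in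
    eventually-map (λ n (s , p) → begin-strict
      c ℚ.- q  ≡⟨ expand c q (seq y n) ⟩
      c ℚ.+ seq y n ℚ.- (seq y n ℚ.+ q)  <⟨ ℚₚ.+-monoˡ-< (ℚ.- (seq y n ℚ.+ q)) (ℚₚ.+-mono-< s p) ⟩
      (seq x n ℚ.+ seq y n ℚ.+ δ) ℚ.+ (q ℚ.+ δ) ℚ.- (seq y n ℚ.+ q)  ≡⟨ collect (seq x n ℚ.+ seq y n) q (seq y n) δ ⟩
      (seq x n ℚ.+ seq y n ℚ.- seq y n) ℚ.+ (δ ℚ.+ δ)  ≡⟨ cong₂ ℚ._+_ (cancel (seq x n) (seq y n)) δ+δ≡ε ⟩
      seq x n ℚ.+ ε  ∎) (eventually-× (≃⇒≤ {fromℚ c} {x +ᴿ y} (≃-sym {x +ᴿ y} {fromℚ c} x+y≃c) δ 0<δ) (y≤q δ 0<δ))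
    where
    expand : ∀ c q y → c ℚ.- q ≡ c ℚ.+ y ℚ.- (y ℚ.+ q)
    expand = ring-solve-∀ ℚ-ring
    cancel : ∀ x y → x ℚ.+ y ℚ.- y ≡ x
    cancel = ring-solve-∀ ℚ-ring

  complement-≤ : fromℚ q ≤ y → x ≤ fromℚ (c ℚ.- q)
  complement-≤ q≤y ε 0<ε =
    let δ , 0<δ , δ+δ≡ε = halve ε 0<ε in
    eventually-map (λ n (s , p) → begin-strict
      seq x n  ≡⟨ expand (seq x n) (seq y n) q ⟩
      seq x n ℚ.+ seq y n ℚ.+ q ℚ.- (q ℚ.+ seq y n)  <⟨ ℚₚ.+-monoˡ-< (ℚ.- (q ℚ.+ seq y n)) (ℚₚ.+-mono-< s p) ⟩
      (c ℚ.+ δ) ℚ.+ (seq y n ℚ.+ δ) ℚ.- (q ℚ.+ seq y n)  ≡⟨ collect c (seq y n) q δ ⟩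
      (c ℚ.- q) ℚ.+ (δ ℚ.+ δ)  ≡⟨ cong (ℚ._+_ (c ℚ.- q)) δ+δ≡ε ⟩
      (c ℚ.- q) ℚ.+ ε  ∎) (eventually-× (≃⇒≤ {x +ᴿ y} {fromℚ c} x+y≃c δ 0<δ) (q≤y δ 0<δ))
    where
    expand : ∀ x y q → x ≡ x ℚ.+ y ℚ.+ q ℚ.- (q ℚ.+ y)
    expand = ring-solve-∀ ℚ-ring

-- For a matrix p with line sums 1 and a block between l and u, non-negativity
-- of the remaining entries is a condition on the sums of the block.
module _ {e : ℕ} {p : Fin (suc e) × Fin (suc e) → ℝ} (sums : ℝᴮ.Sums 1ℝ p) where

  private
    flipped : ∀ {x y : ℝ} → x +ᴿ y ≃ 1ℝ → y +ᴿ x ≃ 1ℝ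
    flipped {x} {y} eq = ≃-trans {y +ᴿ x} {x +ᴿ y} {1ℝ} (≗⇒≃ {y +ᴿ x} {x +ᴿ y} λ n → ℚₚ.+-comm (seq y n) (seq x n)) eq

    row : Fin (suc e) → ℝ
    row i = sum (λ b → p (i , suc b))

    col : Fin (suc e) → ℝ
    col j = sum (λ a → p (suc a , j))

    column : (Fin e → Fin e → ℚ) → Fin e → ℚ
    column f b = ℚᴮ.S.sum (λ a → f a b)

  module _ {l u : Fin e → Fin e → ℚ}
           (l≤p : ∀ a b → fromℚ (l a b) ≤ p (suc a , suc b))
           (p≤u : ∀ a b → p (suc a , suc b) ≤ fromℚ (u a b)) where

    nonneg-entries : (∀ a b → 0ℚ ℚ.≤ l a b) → (∀ a → ℚᴮ.S.sum (u a) ℚ.≤ 1ℚ) → (∀ b → column u b ℚ.≤ 1ℚ) →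
                     ℚᴮ.S.sum (λ b → 1ℚ ℚ.- column l b) ℚ.≤ 1ℚ → ∀ ij → 0ℝ ≤ p ij
    nonneg-entries 0≤l rows≤1 cols≤1 total≤1 = entry-nonneg
      where
      0≤1- : ∀ {q} → q ℚ.≤ 1ℚ → 0ℝ ≤ fromℚ (1ℚ ℚ.- q)
      0≤1- {q} q≤1 = fromℚ-mono (subst (ℚ._≤ 1ℚ ℚ.- q) (ℚₚ.+-inverseʳ q) (ℚₚ.+-monoˡ-≤ (ℚ.- q) q≤1))
      entry-nonneg : ∀ ij → 0ℝ ≤ p ij
      entry-nonneg (suc a , suc b) = ≤-trans {0ℝ} {fromℚ (l a b)} {p (suc a , suc b)} (fromℚ-mono (0≤l a b)) (l≤p a b)
      entry-nonneg (suc a , zero) = ≤-trans {0ℝ} {fromℚ (1ℚ ℚ.- ℚᴮ.S.sum (u a))} {p (suc a , zero)} (0≤1- (rows≤1 a))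
        (complement-≥ {p (suc a , zero)} {row (suc a)} {1ℚ} {ℚᴮ.S.sum (u a)} (proj₁ sums (suc a)) (sum-≤ (u a) (λ b → p (suc a , suc b)) (p≤u a)))
      entry-nonneg (zero , suc b) = ≤-trans {0ℝ} {fromℚ (1ℚ ℚ.- column u b)} {p (zero , suc b)} (0≤1- (cols≤1 b))
        (complement-≥ {p (zero , suc b)} {col (suc b)} {1ℚ} {column u b} (proj₂ sums (suc b)) (sum-≤ (λ a → u a b) (λ a → p (suc a , suc b)) λ a → p≤u a b))
      -- The top left entry is 1 - Σ (1 - column sum of the block), so its lower bound comes from
      -- the lower bounds of the block, unlike that of the other border entries.
      entry-nonneg (zero , zero) = ≤-trans {0ℝ} {fromℚ (1ℚ ℚ.- ℚᴮ.S.sum (λ b → 1ℚ ℚ.- column l b))} {p (zero , zero)} (0≤1- total≤1)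
        (complement-≥ {p (zero , zero)} {row zero} {1ℚ} {ℚᴮ.S.sum (λ b → 1ℚ ℚ.- column l b)} (proj₁ sums zero) (sum-≤ (λ b → 1ℚ ℚ.- column l b) (λ b → p (zero , suc b)) λ b →
          complement-≤ {p (zero , suc b)} {col (suc b)} {1ℚ} {column l b} (proj₂ sums (suc b)) (≤-sum (λ a → l a b) (λ a → p (suc a , suc b)) λ a → l≤p a b)))

    module _ (0≤p : ∀ ij → 0ℝ ≤ p ij) where

      row≤1 : ∀ a → ℚᴮ.S.sum (l a) ℚ.≤ 1ℚ
      row≤1 a = fromℚ-cancel-≤ (≤-trans {fromℚ (ℚᴮ.S.sum (l a))} {row (suc a)} {1ℝ}
        (≤-sum (l a) (λ b → p (suc a , suc b)) (l≤p a))
        (complement-≤ {row (suc a)} {p (suc a , zero)} {1ℚ} {0ℚ} (flipped {p (suc a , zero)} {row (suc a)} (proj₁ sums (suc a))) (0≤p (suc a , zero))))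

      col≤1 : ∀ b → column l b ℚ.≤ 1ℚ
      col≤1 b = fromℚ-cancel-≤ (≤-trans {fromℚ (column l b)} {col (suc b)} {1ℝ}
        (≤-sum (λ a → l a b) (λ a → p (suc a , suc b)) λ a → l≤p a b)
        (complement-≤ {col (suc b)} {p (zero , suc b)} {1ℚ} {0ℚ} (flipped {p (zero , suc b)} {col (suc b)} (proj₂ sums (suc b))) (0≤p (zero , suc b))))

      total≤1 : ℚᴮ.S.sum (λ b → 1ℚ ℚ.- column u b) ℚ.≤ 1ℚ
      total≤1 = fromℚ-cancel-≤ (≤-trans {fromℚ (ℚᴮ.S.sum (λ b → 1ℚ ℚ.- column u b))} {row zero} {1ℝ}
        (≤-sum (λ b → 1ℚ ℚ.- column u b) (λ b → p (zero , suc b)) λ b →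
          complement-≥ {p (zero , suc b)} {col (suc b)} {1ℚ} {column u b} (proj₂ sums (suc b)) (sum-≤ (λ a → u a b) (λ a → p (suc a , suc b)) λ a → p≤u a b))
        (complement-≤ {row zero} {p (zero , zero)} {1ℚ} {0ℚ} (flipped {p (zero , zero)} {row zero} (proj₁ sums zero)) (0≤p (zero , zero))))

-- Comparison with a rational number is decidable only up to double negation.
¬¬-floor : ∀ κ x → 0ℝ ≤ x → ∀ M → x < fromℚ (κ ℚ.* ℤ→ℚ (+ M)) →
           ¬ ¬ (∃[ m ] fromℚ (κ ℚ.* ℤ→ℚ (+ m)) ≤ x × x < fromℚ (κ ℚ.* ℤ→ℚ (+ suc m)))
¬¬-floor κ x 0≤x zero    x<0 _ = ℚₚ.<-irrefl (sym (ℚₚ.*-zeroʳ κ)) (≤-<-fromℚ {x = x} 0≤x x<0)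
¬¬-floor κ x 0≤x (suc M) x<M ¬floor = ¬floor (M , ≮⇒≥ {x} (λ x<M′ → ¬¬-floor κ x 0≤x M x<M′ ¬floor) , x<M)

¬¬-Fin : ∀ {n} {P : Fin n → Set} → (∀ i → ¬ ¬ P i) → ¬ ¬ (∀ i → P i)
¬¬-Fin {zero}  ¬¬P ¬∀ = ¬∀ λ ()
¬¬-Fin {suc n} ¬¬P ¬∀ = ¬¬P zero λ P₀ → ¬¬-Fin (¬¬P ∘ suc) λ Pₛ → ¬∀ λ { zero → P₀ ; (suc i) → Pₛ i }

archimedean : ∀ q δ → 0ℚ ℚ.< δ → ∃[ n ] q ℚ.< δ ℚ.* ℤ→ℚ (+ n)
archimedean q (ℚ.mkℚ (+ zero) _ _)    (ℚ.*<* (+<+ ()))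
archimedean q (ℚ.mkℚ -[1+ _ ] _ _)    (ℚ.*<* ())
archimedean q@(ℚ.mkℚ a b-1 _) δ@(ℚ.mkℚ (+ suc c-1) g-1 _) _ = n , ℚₚ.toℚᵘ-cancel-<
  (ℚᵘₚ.<-respʳ-≃ (ℚᵘₚ.≃-sym (ℚᵘₚ.≃-trans (ℚₚ.toℚᵘ-homo-* δ (ℤ→ℚ (+ n))) (ℚᵘₚ.*-congˡ {ℚ.toℚᵘ δ} (ℚₚ.toℚᵘ-fromℚᵘ (ℚᵘ.mkℚᵘ (+ n) 0)))))
    (ℚᵘ.*<* (begin-strict
      a ℤ.* + (suc g-1 * 1)  ≡⟨ cong (λ g → a ℤ.* + g) (ℕₚ.*-identityʳ (suc g-1)) ⟩
      a ℤ.* + suc g-1  ≤⟨ ℤₚ.*-monoʳ-≤-nonNeg (+ suc g-1) (i≤∣i∣ a) ⟩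
      + ℤ.∣ a ∣ ℤ.* + suc g-1  ≡⟨ ℤₚ.pos-* ℤ.∣ a ∣ (suc g-1) ⟨
      + (ℤ.∣ a ∣ * suc g-1)  <⟨ +<+ (ℕₚ.n<1+n (ℤ.∣ a ∣ * suc g-1)) ⟩
      + n  ≤⟨ +≤+ (ℕₚ.≤-trans (ℕₚ.m≤n*m n (suc c-1)) (ℕₚ.m≤m*n (suc c-1 * n) (suc b-1))) ⟩
      + (suc c-1 * n * suc b-1)  ≡⟨ trans (ℤₚ.pos-* (suc c-1 * n) (suc b-1)) (cong (ℤ._* + suc b-1) (ℤₚ.pos-* (suc c-1) n)) ⟩
      + suc c-1 ℤ.* + n ℤ.* + suc b-1  ∎)))
  where
  open ℤₚ.≤-Reasoning
  -- For q with numerator a and δ with denominator g we have q ≤ ∣ a ∣ and δ ≥ 1 / g, so n > ∣ a ∣ g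
  -- is enough.
  n : ℕ
  n = suc (ℤ.∣ a ∣ * suc g-1)
  i≤∣i∣ : ∀ i → i ℤ.≤ + ℤ.∣ i ∣
  i≤∣i∣ (+ n)    = ℤₚ.≤-refl
  i≤∣i∣ -[1+ n ] = -≤+

bounded-above : ∀ κ → 0ℚ ℚ.< κ → ∀ x → ∃[ M ] x < fromℚ (κ ℚ.* ℤ→ℚ (+ M))
bounded-above κ 0<κ x =
  let B , _ , x≤B = bounded x
      M , B+1<M   = archimedean (B ℚ.+ 1ℚ) κ 0<κ
  in M , 1ℚ , ℚₚ.positive⁻¹ 1ℚ , eventually-map (λ n ∣x∣≤B →
       ℚₚ.≤-<-trans (ℚₚ.+-monoˡ-≤ 1ℚ (ℚₚ.≤-trans (p≤∣p∣ (seq x n)) ∣x∣≤B)) B+1<M) x≤B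

sumℤ-shift : ∀ {n} c (f : Fin n → ℤ) → sumℤ (λ i → f i ℤ.+ c) ≡ sumℤ f ℤ.+ + n ℤ.* c
sumℤ-shift {n} c f = begin
  sumℤ (λ i → f i ℤ.+ c)  ≡⟨ Σℤ.sum-cong-≗ (λ i → as-linear (f i) c) ⟩
  sumℤ (λ i → 1ℤ ℤ.* f i ℤ.+ c ℤ.* 1ℤ)  ≡⟨ sumℤ-linear 1ℤ c f (λ _ → 1ℤ) ⟩
  1ℤ ℤ.* sumℤ f ℤ.+ c ℤ.* sumℤ {n} (λ _ → 1ℤ)  ≡⟨ cong (λ z → 1ℤ ℤ.* sumℤ f ℤ.+ c ℤ.* z) (sumℤ-const n) ⟩
  1ℤ ℤ.* sumℤ f ℤ.+ c ℤ.* + n  ≡⟨ tidy (sumℤ f) c (+ n) ⟩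
  sumℤ f ℤ.+ + n ℤ.* c  ∎
  where
  open ≡-Reasoning
  as-linear : ∀ x c → x ℤ.+ c ≡ 1ℤ ℤ.* x ℤ.+ c ℤ.* 1ℤ
  as-linear = solve-∀
  tidy : ∀ s c n → 1ℤ ℤ.* s ℤ.+ c ℤ.* n ≡ s ℤ.+ n ℤ.* c
  tidy = solve-∀

-- Grids of boxes with side κ = 1 / k

module Grid {e : ℕ} {k : ℕ} {κ : ℚ} (0<κ : 0ℚ ℚ.< κ) (κ*k≡1 : κ ℚ.* ℤ→ℚ (+ k) ≡ 1ℚ) where

  private
    d D : ℕ
    d = suc e
    D = e * e

  κ≥0 : ℚ.NonNegative κ
  κ≥0 = ℚ.nonNegative (ℚₚ.<⇒≤ 0<κ)

  scale-mono : ∀ {a b} → a ℤ.≤ b → κ ℚ.* ℤ→ℚ a ℚ.≤ κ ℚ.* ℤ→ℚ b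
  scale-mono a≤b = ℚₚ.*-monoˡ-≤-nonNeg κ {{κ≥0}} (ℤ→ℚ-mono-≤ a≤b)

  scale≤1 : ∀ {a} → a ℤ.≤ + k → κ ℚ.* ℤ→ℚ a ℚ.≤ 1ℚ
  scale≤1 {a} a≤k = subst (κ ℚ.* ℤ→ℚ a ℚ.≤_) κ*k≡1 (scale-mono a≤k)

  scale≤1⁻ : ∀ {a} → κ ℚ.* ℤ→ℚ a ℚ.≤ 1ℚ → a ℤ.≤ + k
  scale≤1⁻ {a} le = ℤ→ℚ-cancel-≤ (ℚₚ.*-cancelˡ-≤-pos κ {{ℚ.positive 0<κ}} (subst (κ ℚ.* ℤ→ℚ a ℚ.≤_) (sym κ*k≡1) le))

  scale-< : ∀ {a b} → κ ℚ.* ℤ→ℚ a ℚ.< κ ℚ.* ℤ→ℚ b → a ℤ.< b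
  scale-< {a} {b} lt = ℤₚ.≰⇒> λ b≤a → ℚₚ.<-irrefl refl (ℚₚ.<-≤-trans lt (scale-mono b≤a))

  gridBox : (Fin e → Fin e → ℤ) → Box D
  gridBox Z = record
    { lower = λ x → κ ℚ.* ℤ→ℚ (cell x)
    ; upper = λ x → κ ℚ.* ℤ→ℚ (1ℤ ℤ.+ cell x)
    ; lower≤upper = λ x → scale-mono (ℤₚ.i≤suc[i] (cell x)) }
    where
    cell : Fin D → ℤ
    cell x = let (a , b) = Fin.remQuot {e} e x in Z a b

  InCell : ℤ → ℝ → Set
  InCell z x = fromℚ (κ ℚ.* ℤ→ℚ z) ≤ x × x < fromℚ (κ ℚ.* ℤ→ℚ (1ℤ ℤ.+ z))

  cell-unique : ∀ {y z x} → InCell y x → InCell z x → y ≡ z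
  cell-unique {x = x} (y≤x , x<y+1) (z≤x , x<z+1) = ℤₚ.≤-antisym (le y≤x x<z+1) (le z≤x x<y+1)
    where
    le : ∀ {y z} → fromℚ (κ ℚ.* ℤ→ℚ y) ≤ x → x < fromℚ (κ ℚ.* ℤ→ℚ (1ℤ ℤ.+ z)) → y ℤ.≤ z
    le {y} {z} y≤x x<z+1 = subst (y ℤ.≤_) (ℤₚ.pred-suc z) (ℤₚ.i<j⇒i≤pred[j] (scale-< {y} {1ℤ ℤ.+ z} (≤-<-fromℚ {x = x} y≤x x<z+1)))

  grid-entry : ∀ {Z t} → ⟦ gridBox Z ⟧ t → ∀ a b → InCell (Z a b) (t (Fin.combine a b))
  grid-entry {Z} {t} t∈ a b = subst (λ z → InCell z (t (Fin.combine a b))) (block-index Z a b) (t∈ (Fin.combine a b))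

  -- Cells are indexed by the blocks of magic squares. The shift s = e pushes the cells into the
  -- polytope, and s = - e spreads them until they cover it.
  shifted : ℤ → Matrix d → Fin e → Fin e → ℤ
  shifted s M a b = ⟪ M ⟫ (suc a) (suc b) ℤ.+ s

  boxes : ℤ → ℕ → List (Box D)
  boxes s K = List.map (gridBox ∘ shifted s) (magicSquares d K)

  -- Squares with the same line sum and the same block coincide, so different squares have different
  -- cells of one grid.
  boxes-disjoint : ∀ s K → AllPairs Disjoint (boxes s K)
  boxes-disjoint s K = AllPairsₚ.map⁺ (pairs (magicSquares-unique d K) (λ {M} → magicSquares-magic {d} {K} {M}))
    where
    disjoint : ∀ {M M′} → Magic K M → Magic K M′ → M ≢ M′ → Disjoint (gridBox (shifted s M)) (gridBox (shifted s M′))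
    disjoint {M} {M′} magic magic′ M≢M′ t (t∈ , t∈′) = M≢M′ (entry-injective λ i j → ℤₚ.+-injective
      (ℤᴮ.block-determines {f = λ (i , j) → ⟪ M ⟫ i j} {λ (i , j) → ⟪ M′ ⟫ i j} (magic⇒lineSums {k = K} {M} magic) (magic⇒lineSums {k = K} {M′} magic′)
        (λ a b → ∙-cancelʳ s _ _ (cell-unique {x = t (Fin.combine a b)} (grid-entry {shifted s M} {t} t∈ a b) (grid-entry {shifted s M′} {t} t∈′ a b))) (i , j)))
      where open Algebra.Properties.Group (AbelianGroup.group ℤₚ.+-0-abelianGroup) using (∙-cancelʳ)
    pairs : ∀ {Ms} → Unique Ms → (∀ {M} → M ∈ Ms → Magic K M) →
            AllPairs (λ M M′ → Disjoint (gridBox (shifted s M)) (gridBox (shifted s M′))) Ms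
    pairs []        _     = []
    pairs {M ∷ Ms} (M∉ ∷ u) magic = ListAll.tabulate (λ {M′} M′∈ → disjoint {M} {M′} (magic (here refl)) (magic (there M′∈)) (ListAll.lookup M∉ M′∈)) ∷
                         pairs u (λ M∈ → magic (there M∈))

  private
    complements : ∀ (f : Fin e → Fin e → ℤ) →
                  ℚᴮ.S.sum (λ b → 1ℚ ℚ.- ℚᴮ.S.sum (λ a → κ ℚ.* ℤ→ℚ (f a b))) ≡ κ ℚ.* ℤ→ℚ (sumℤ λ b → + k ℤ.- sumℤ λ a → f a b)
    complements f = trans (ℚᴮ.S.sum-cong-≗ complement) (ℚ-line κ (λ b → + k ℤ.- sumℤ λ a → f a b) refl)
      where
      complement : ∀ b → 1ℚ ℚ.- ℚᴮ.S.sum (λ a → κ ℚ.* ℤ→ℚ (f a b)) ≡ κ ℚ.* ℤ→ℚ (+ k ℤ.- sumℤ λ a → f a b)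
      complement b = begin
        1ℚ ℚ.- ℚᴮ.S.sum (λ a → κ ℚ.* ℤ→ℚ (f a b))  ≡⟨ cong₂ ℚ._-_ (sym κ*k≡1) (ℚ-line κ (λ a → f a b) refl) ⟩
        κ ℚ.* ℤ→ℚ (+ k) ℚ.- κ ℚ.* ℤ→ℚ s  ≡⟨ factor κ (ℤ→ℚ (+ k)) (ℤ→ℚ s) ⟩
        κ ℚ.* (ℤ→ℚ (+ k) ℚ.+ ℚ.- 1ℚ ℚ.* ℤ→ℚ s)  ≡⟨ cong (λ y → κ ℚ.* (ℤ→ℚ (+ k) ℚ.+ y)) (ℤ→ℚ-* -1ℤ s) ⟨
        κ ℚ.* (ℤ→ℚ (+ k) ℚ.+ ℤ→ℚ (-1ℤ ℤ.* s))  ≡⟨ cong (κ ℚ.*_) (ℤ→ℚ-+ (+ k) (-1ℤ ℤ.* s)) ⟨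
        κ ℚ.* ℤ→ℚ (+ k ℤ.+ -1ℤ ℤ.* s)  ≡⟨ cong (λ y → κ ℚ.* ℤ→ℚ (+ k ℤ.+ y)) (ℤₚ.-1*i≡-i s) ⟩
        κ ℚ.* ℤ→ℚ (+ k ℤ.- s)  ∎
        where
        open ≡-Reasoning
        s : ℤ
        s = sumℤ λ a → f a b
        factor : ∀ c x y → c ℚ.* x ℚ.- c ℚ.* y ≡ c ℚ.* (x ℚ.+ ℚ.- 1ℚ ℚ.* y)
        factor = ring-solve-∀ ℚ-ring

  module _ {Z : Fin e → Fin e → ℤ} {t : Fin D → ℝ} (t∈ : ⟦ gridBox Z ⟧ t) where

    lower-bound : ∀ a b → fromℚ (κ ℚ.* ℤ→ℚ (Z a b)) ≤ ℝᴮ.pointᴿ t (suc a , suc b)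
    lower-bound a b = ≤-trans {fromℚ (κ ℚ.* ℤ→ℚ (Z a b))} {t (Fin.combine a b)} {ℝᴮ.pointᴿ t (suc a , suc b)}
      (proj₁ (grid-entry {Z} {t} t∈ a b))
      (≃⇒≤ {t (Fin.combine a b)} {ℝᴮ.pointᴿ t (suc a , suc b)} (≃-sym {ℝᴮ.pointᴿ t (suc a , suc b)} {t (Fin.combine a b)} (ℝᴮ.point-block t a b)))

    upper-bound : ∀ a b → ℝᴮ.pointᴿ t (suc a , suc b) ≤ fromℚ (κ ℚ.* ℤ→ℚ (1ℤ ℤ.+ Z a b))
    upper-bound a b = ≤-trans {ℝᴮ.pointᴿ t (suc a , suc b)} {t (Fin.combine a b)} {fromℚ (κ ℚ.* ℤ→ℚ (1ℤ ℤ.+ Z a b))}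
      (≃⇒≤ {ℝᴮ.pointᴿ t (suc a , suc b)} {t (Fin.combine a b)} (ℝᴮ.point-block t a b))
      (<⇒≤ {t (Fin.combine a b)} {fromℚ (κ ℚ.* ℤ→ℚ (1ℤ ℤ.+ Z a b))} (proj₂ (grid-entry {Z} {t} t∈ a b)))

    inside : (∀ a b → 0ℤ ℤ.≤ Z a b) → (∀ a → sumℤ (λ b → 1ℤ ℤ.+ Z a b) ℤ.≤ + k) → (∀ b → sumℤ (λ a → 1ℤ ℤ.+ Z a b) ℤ.≤ + k) →
             sumℤ (λ b → + k ℤ.- sumℤ λ a → Z a b) ℤ.≤ + k → Birkhoff d (ℝᴮ.pointᴿ t)
    inside 0≤Z rows cols total = record
      { nonneg = nonneg-entries {p = ℝᴮ.pointᴿ t} (ℝᴮ.point-sums t)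
          {λ a b → κ ℚ.* ℤ→ℚ (Z a b)} {λ a b → κ ℚ.* ℤ→ℚ (1ℤ ℤ.+ Z a b)} lower-bound upper-bound
          (λ a b → subst (ℚ._≤ κ ℚ.* ℤ→ℚ (Z a b)) (ℚₚ.*-zeroʳ κ) (scale-mono (0≤Z a b)))
          (λ a → subst (ℚ._≤ 1ℚ) (sym (ℚ-line κ (λ b → 1ℤ ℤ.+ Z a b) refl)) (scale≤1 (rows a)))
          (λ b → subst (ℚ._≤ 1ℚ) (sym (ℚ-line κ (λ a → 1ℤ ℤ.+ Z a b) refl)) (scale≤1 (cols b)))
          (subst (ℚ._≤ 1ℚ) (sym (complements Z)) (scale≤1 total))
      ; rows = proj₁ (ℝᴮ.point-sums t) ; cols = proj₂ (ℝᴮ.point-sums t) }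

    module _ (inBirkhoff : Birkhoff d (ℝᴮ.pointᴿ t)) where

      private
        0≤p : ∀ ij → 0ℝ ≤ ℝᴮ.pointᴿ t ij
        0≤p = Birkhoff.nonneg inBirkhoff

      rows≤k : ∀ a → sumℤ (Z a) ℤ.≤ + k
      rows≤k a = scale≤1⁻ (subst (ℚ._≤ 1ℚ) (ℚ-line κ (Z a) refl)
        (row≤1 {p = ℝᴮ.pointᴿ t} (ℝᴮ.point-sums t)
          {λ a b → κ ℚ.* ℤ→ℚ (Z a b)} {λ a b → κ ℚ.* ℤ→ℚ (1ℤ ℤ.+ Z a b)} lower-bound upper-bound 0≤p a))

      cols≤k : ∀ b → sumℤ (λ a → Z a b) ℤ.≤ + k
      cols≤k b = scale≤1⁻ (subst (ℚ._≤ 1ℚ) (ℚ-line κ (λ a → Z a b) refl)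
        (col≤1 {p = ℝᴮ.pointᴿ t} (ℝᴮ.point-sums t)
          {λ a b → κ ℚ.* ℤ→ℚ (Z a b)} {λ a b → κ ℚ.* ℤ→ℚ (1ℤ ℤ.+ Z a b)} lower-bound upper-bound 0≤p b))

      total≤k : sumℤ (λ b → + k ℤ.- sumℤ λ a → 1ℤ ℤ.+ Z a b) ℤ.≤ + k
      total≤k = scale≤1⁻ (subst (ℚ._≤ 1ℚ) (complements λ a b → 1ℤ ℤ.+ Z a b)
        (total≤1 {p = ℝᴮ.pointᴿ t} (ℝᴮ.point-sums t)
          {λ a b → κ ℚ.* ℤ→ℚ (Z a b)} {λ a b → κ ℚ.* ℤ→ℚ (1ℤ ℤ.+ Z a b)} lower-bound upper-bound 0≤p))

  -- Shifting by e and passing to upper corners adds e + 1 to each of the e entries of a block line,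
  -- whence k = K + e (e + 1). With lower corners the complements in the top row are those of M plus
  -- e each; they sum to at most K + e², so the top left entry stays non-negative too.
  module Inner {K : ℕ} (k≡ : k ≡ K + e * suc e) where

    private
      k≡′ : + k ≡ + K ℤ.+ (+ e ℤ.* + e ℤ.+ + e)
      k≡′ = trans (cong +_ k≡) (trans (ℤₚ.pos-+ K (e * suc e)) (cong (ℤ._+_ (+ K)) (trans (cong +_ (expand e)) (trans (ℤₚ.pos-+ (e * e) e) (cong (ℤ._+ + e) (ℤₚ.pos-* e e))))))
        where
        expand : ∀ e → e * suc e ≡ e * e + e
        expand = ℕ-solve-∀

    module _ {M : Matrix d} (magic : Magic K M) where

      private
        m : Fin d → Fin d → ℤ
        m = ⟪ M ⟫

        sums : LineSums (+ K) m
        sums = magic⇒lineSums {k = K} {M} magic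

        Z : Fin e → Fin e → ℤ
        Z = shifted (+ e) M

        line-bound : ∀ {f : Fin d → ℤ} → 0ℤ ℤ.≤ f zero → sumℤ f ≡ + K → sumℤ (λ b → 1ℤ ℤ.+ (f (suc b) ℤ.+ + e)) ℤ.≤ + k
        line-bound {f} 0≤f₀ sum≡K = ℤₚ.0≤i-j⇒j≤i (subst (0ℤ ℤ.≤_) (begin
          f zero
            ≡⟨ identity (f zero) (sumℤ (f ∘ suc)) (+ e) ⟩
          f zero ℤ.+ sumℤ (f ∘ suc) ℤ.+ (+ e ℤ.* + e ℤ.+ + e) ℤ.- (sumℤ (f ∘ suc) ℤ.+ + e ℤ.* (+ e ℤ.+ 1ℤ))
            ≡⟨ cong₂ (λ x y → x ℤ.+ (+ e ℤ.* + e ℤ.+ + e) ℤ.- y) sum≡K (trans (sym (sumℤ-shift (+ e ℤ.+ 1ℤ) (f ∘ suc)))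
                 (Σℤ.sum-cong-≗ λ b → reorder (f (suc b)) (+ e))) ⟩
          + K ℤ.+ (+ e ℤ.* + e ℤ.+ + e) ℤ.- sumℤ (λ b → 1ℤ ℤ.+ (f (suc b) ℤ.+ + e))
            ≡⟨ cong (ℤ._- sumℤ (λ b → 1ℤ ℤ.+ (f (suc b) ℤ.+ + e))) k≡′ ⟨
          + k ℤ.- sumℤ (λ b → 1ℤ ℤ.+ (f (suc b) ℤ.+ + e)) ∎) 0≤f₀)
          where
          open ≡-Reasoning
          identity : ∀ f₀ s e → f₀ ≡ f₀ ℤ.+ s ℤ.+ (e ℤ.* e ℤ.+ e) ℤ.- (s ℤ.+ e ℤ.* (e ℤ.+ 1ℤ))
          identity = solve-∀
          reorder : ∀ x e → x ℤ.+ (e ℤ.+ 1ℤ) ≡ 1ℤ ℤ.+ (x ℤ.+ e)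
          reorder = solve-∀

        total : sumℤ (λ b → + k ℤ.- sumℤ λ a → Z a b) ℤ.≤ + k
        total = ℤₚ.0≤i-j⇒j≤i (subst (0ℤ ℤ.≤_) (begin
          m zero zero ℤ.+ + e
            ≡⟨ identity (m zero zero) (sumℤ (m zero ∘ suc)) (+ e) ⟩
          m zero zero ℤ.+ sumℤ (m zero ∘ suc) ℤ.+ (+ e ℤ.* + e ℤ.+ + e) ℤ.- (sumℤ (m zero ∘ suc) ℤ.+ + e ℤ.* + e)
            ≡⟨ cong₂ (λ x y → x ℤ.+ (+ e ℤ.* + e ℤ.+ + e) ℤ.- y) (proj₁ sums zero) (trans (sym (sumℤ-shift (+ e) (m zero ∘ suc)))
                 (Σℤ.sum-cong-≗ λ b → sym (column b))) ⟩
          + K ℤ.+ (+ e ℤ.* + e ℤ.+ + e) ℤ.- sumℤ (λ b → + k ℤ.- sumℤ λ a → Z a b)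
            ≡⟨ cong (ℤ._- sumℤ (λ b → + k ℤ.- sumℤ λ a → Z a b)) k≡′ ⟨
          + k ℤ.- sumℤ (λ b → + k ℤ.- sumℤ λ a → Z a b) ∎) (+≤+ z≤n))
          where
          open ≡-Reasoning
          identity : ∀ m s e → m ℤ.+ e ≡ m ℤ.+ s ℤ.+ (e ℤ.* e ℤ.+ e) ℤ.- (s ℤ.+ e ℤ.* e)
          identity = solve-∀
          cancel : ∀ f s e → f ℤ.+ s ℤ.+ (e ℤ.* e ℤ.+ e) ℤ.- (s ℤ.+ e ℤ.* e) ≡ f ℤ.+ e
          cancel = solve-∀
          column : ∀ b → + k ℤ.- (sumℤ λ a → Z a b) ≡ m zero (suc b) ℤ.+ + e
          column b = begin
            + k ℤ.- (sumℤ λ a → Z a b)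
              ≡⟨ cong₂ ℤ._-_ (trans k≡′ (cong (ℤ._+ (+ e ℤ.* + e ℤ.+ + e)) (sym (proj₂ sums (suc b))))) (sumℤ-shift (+ e) (λ a → m (suc a) (suc b))) ⟩
            m zero (suc b) ℤ.+ sumℤ (λ a → m (suc a) (suc b)) ℤ.+ (+ e ℤ.* + e ℤ.+ + e) ℤ.- (sumℤ (λ a → m (suc a) (suc b)) ℤ.+ + e ℤ.* + e)
              ≡⟨ cancel (m zero (suc b)) (sumℤ (λ a → m (suc a) (suc b))) (+ e) ⟩
            m zero (suc b) ℤ.+ + e ∎

      inner⊆ : ∀ {t} → ⟦ gridBox (shifted (+ e) M) ⟧ t → Birkhoff d (ℝᴮ.pointᴿ t)
      inner⊆ {t} t∈ = inside {Z} {t} t∈ (λ a b → +≤+ z≤n)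
        (λ a → line-bound {λ j → m (suc a) j} (+≤+ z≤n) (proj₁ sums (suc a)))
        (λ b → line-bound {λ i → m i (suc b)} (+≤+ z≤n) (proj₂ sums (suc b))) total

    inner-boxes : ListAll.All (λ b → ∀ {t} → ⟦ b ⟧ t → Birkhoff d (ℝᴮ.pointᴿ t)) (boxes (+ e) K)
    inner-boxes = ListAllₚ.map⁺ (ListAll.tabulate λ {M} M∈ {t} → inner⊆ {M} (magicSquares-magic {d} {K} M∈) {t})

  -- Adding e to the lower corners raises the sum of a block line by e², whence K = k + e². The
  -- complement of a column of lower corners exceeds that of the upper corners by e; over e columns
  -- this is again e², and K leaves room for it at the top left.
  module Outer {K : ℕ} (K≡ : K ≡ k + e * e) where

    private
      K≡′ : + K ≡ + k ℤ.+ + e ℤ.* + e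
      K≡′ = trans (cong +_ K≡) (trans (ℤₚ.pos-+ k (e * e)) (cong (ℤ._+_ (+ k)) (ℤₚ.pos-* e e)))

    module _ {t : Fin D → ℝ} (inBirkhoff : Birkhoff d (ℝᴮ.pointᴿ t))
             (z : Fin D → ℕ) (floor : ∀ x → InCell (+ z x) (t x)) where

      private
        Z m : Fin e → Fin e → ℤ
        Z a b = + z (Fin.combine a b)
        m a b = Z a b ℤ.+ + e

        t∈ : ⟦ gridBox Z ⟧ t
        t∈ x = subst (λ y → InCell (+ z y) (t x)) (sym (Finₚ.combine-remQuot {e} e x)) (floor x)

        -- The only completion of the block m to line sums K. All lines hold by construction except
        -- column 0, which rests on exchanging the two summations over the block.
        f : Fin d → Fin d → ℤ
        f (suc a) (suc b) = m a b
        f (suc a) zero    = + K ℤ.- sumℤ (m a)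
        f zero    (suc b) = + K ℤ.- sumℤ (λ a → m a b)
        f zero    zero    = + K ℤ.- sumℤ (λ b → + K ℤ.- sumℤ (λ a → m a b))

        restore : ∀ x y → x ℤ.- y ℤ.+ y ≡ x
        restore = solve-∀

        widen : ∀ k s e → k ℤ.- s ≡ k ℤ.+ e ℤ.* e ℤ.- (s ℤ.+ e ℤ.* e)
        widen = solve-∀

        complement-sum : ∀ (g : Fin e → ℤ) → sumℤ (λ b → + K ℤ.- g b) ≡ + e ℤ.* + K ℤ.- sumℤ g
        complement-sum g = begin
          sumℤ (λ b → + K ℤ.- g b)  ≡⟨ Σℤ.sum-cong-≗ (λ b → as-shift (+ K) (g b)) ⟩
          sumℤ (λ b → -1ℤ ℤ.* g b ℤ.+ + K)  ≡⟨ sumℤ-shift (+ K) (λ b → -1ℤ ℤ.* g b) ⟩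
          sumℤ (λ b → -1ℤ ℤ.* g b) ℤ.+ + e ℤ.* + K  ≡⟨ cong (ℤ._+ + e ℤ.* + K) (Σℤ.*-distribˡ-sum -1ℤ g) ⟨
          -1ℤ ℤ.* sumℤ g ℤ.+ + e ℤ.* + K  ≡⟨ as-shift (+ e ℤ.* + K) (sumℤ g) ⟨
          + e ℤ.* + K ℤ.- sumℤ g  ∎
          where
          open ≡-Reasoning
          as-shift : ∀ x y → x ℤ.- y ≡ -1ℤ ℤ.* y ℤ.+ x
          as-shift = solve-∀

        f-sums : LineSums (+ K) f
        f-sums = (λ { zero → restore (+ K) (sumℤ λ b → + K ℤ.- sumℤ λ a → m a b) ; (suc a) → restore (+ K) (sumℤ (m a)) }) ,
                 (λ { zero → first ; (suc b) → restore (+ K) (sumℤ λ a → m a b) })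
          where
          first : sumℤ (λ i → f i zero) ≡ + K
          first = trans (cong (ℤ._+_ (f zero zero)) (trans (complement-sum (λ a → sumℤ (m a)))
              (trans (cong (λ s → + e ℤ.* + K ℤ.- s) (Σℤ.∑-comm m)) (sym (complement-sum λ b → sumℤ λ a → m a b)))))
            (restore (+ K) (sumℤ λ b → + K ℤ.- sumℤ λ a → m a b))

        0≤K-line : ∀ (g : Fin e → ℤ) → sumℤ g ℤ.≤ + k → 0ℤ ℤ.≤ + K ℤ.- sumℤ (λ a → g a ℤ.+ + e)
        0≤K-line g g≤k = subst (0ℤ ℤ.≤_) (trans (widen (+ k) (sumℤ g) (+ e)) (cong₂ ℤ._-_ (sym K≡′) (sym (sumℤ-shift (+ e) g)))) (ℤₚ.i≤j⇒0≤j-i g≤k)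

        f-nonneg : ∀ i j → 0ℤ ℤ.≤ f i j
        f-nonneg (suc a) (suc b) = +≤+ z≤n
        f-nonneg (suc a) zero    = 0≤K-line (Z a) (rows≤k {Z} {t} t∈ inBirkhoff a)
        f-nonneg zero    (suc b) = 0≤K-line (λ a → Z a b) (cols≤k {Z} {t} t∈ inBirkhoff b)
        f-nonneg zero    zero    = subst (0ℤ ℤ.≤_) (begin
          + k ℤ.- sumℤ (λ b → + k ℤ.- sumℤ λ a → 1ℤ ℤ.+ Z a b)
            ≡⟨ widen (+ k) (sumℤ (λ b → + k ℤ.- sumℤ λ a → 1ℤ ℤ.+ Z a b)) (+ e) ⟩
          + k ℤ.+ + e ℤ.* + e ℤ.- (sumℤ (λ b → + k ℤ.- sumℤ λ a → 1ℤ ℤ.+ Z a b) ℤ.+ + e ℤ.* + e)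
            ≡⟨ cong₂ ℤ._-_ (sym K≡′) (trans (sym (sumℤ-shift (+ e) (λ b → + k ℤ.- sumℤ λ a → 1ℤ ℤ.+ Z a b))) (Σℤ.sum-cong-≗ column)) ⟩
          + K ℤ.- sumℤ (λ b → + K ℤ.- sumℤ (λ a → m a b)) ∎) (ℤₚ.i≤j⇒0≤j-i (total≤k {Z} {t} t∈ inBirkhoff))
          where
          open ≡-Reasoning
          shift : ∀ k s e → k ℤ.- (s ℤ.+ e ℤ.* 1ℤ) ℤ.+ e ≡ k ℤ.+ e ℤ.* e ℤ.- (s ℤ.+ e ℤ.* e)
          shift = solve-∀
          column : ∀ b → + k ℤ.- (sumℤ λ a → 1ℤ ℤ.+ Z a b) ℤ.+ + e ≡ + K ℤ.- sumℤ (λ a → m a b)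
          column b = begin
            + k ℤ.- (sumℤ λ a → 1ℤ ℤ.+ Z a b) ℤ.+ + e
              ≡⟨ cong (λ s → + k ℤ.- s ℤ.+ + e) (trans (Σℤ.sum-cong-≗ λ a → ℤₚ.+-comm 1ℤ (Z a b)) (sumℤ-shift 1ℤ (λ a → Z a b))) ⟩
            + k ℤ.- (sumℤ (λ a → Z a b) ℤ.+ + e ℤ.* 1ℤ) ℤ.+ + e
              ≡⟨ shift (+ k) (sumℤ λ a → Z a b) (+ e) ⟩
            + k ℤ.+ + e ℤ.* + e ℤ.- (sumℤ (λ a → Z a b) ℤ.+ + e ℤ.* + e)
              ≡⟨ cong₂ ℤ._-_ K≡′ (sumℤ-shift (+ e) (λ a → Z a b)) ⟨
            + K ℤ.- sumℤ (λ a → m a b) ∎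

        M : Matrix d
        M = fromEntries λ i j → ℤ.∣ f i j ∣

        ⟪M⟫≡f : ∀ i j → ⟪ M ⟫ i j ≡ f i j
        ⟪M⟫≡f i j = trans (cong +_ (entry-fromEntries (λ i j → ℤ.∣ f i j ∣) i j)) (ℤₚ.0≤i⇒+∣i∣≡i (f-nonneg i j))

        M-magic : Magic K M
        M-magic = lineSums⇒magic {k = K} (lineSums-cong refl (λ i j → sym (⟪M⟫≡f i j)) f-sums)

      covered : ListAny.Any (λ b → ⟦ b ⟧ t) (boxes (ℤ.- + e) K)
      covered = ListAnyₚ.map⁺ (lose (∈-magicSquares {k = K} M-magic) λ x →
        subst (λ y → InCell y (t x)) (trans (cong (λ y → + z y) (sym (Finₚ.combine-remQuot {e} e x))) (sym (cell x))) (floor x))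
        where
        cancel : ∀ x y → x ℤ.+ y ℤ.+ ℤ.- y ≡ x
        cancel = solve-∀
        cell : ∀ x → let (a , b) = Fin.remQuot {e} e x in shifted (ℤ.- + e) M a b ≡ Z a b
        cell x = let (a , b) = Fin.remQuot {e} e x in
          trans (cong (ℤ._+ ℤ.- + e) (⟪M⟫≡f (suc a) (suc b))) (cancel (Z a b) (+ e))

    cover : ∀ t → Birkhoff d (ℝᴮ.pointᴿ t) → ¬ ¬ ListAny.Any (λ b → ⟦ b ⟧ t) (boxes (ℤ.- + e) K)
    cover t inBirkhoff ¬covered = ¬¬-Fin floor λ floors → ¬covered (covered inBirkhoff (proj₁ ∘ floors) (proj₂ ∘ floors))
      where
      t≥0 : ∀ x → 0ℝ ≤ t x
      t≥0 x = subst (λ x → 0ℝ ≤ t x) (Finₚ.combine-remQuot {e} e x)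
        (let (a , b) = Fin.remQuot {e} e x in ≤-trans {0ℝ} {ℝᴮ.pointᴿ t (suc a , suc b)} {t (Fin.combine a b)}
          (Birkhoff.nonneg inBirkhoff (suc a , suc b)) (≃⇒≤ {ℝᴮ.pointᴿ t (suc a , suc b)} {t (Fin.combine a b)} (ℝᴮ.point-block t a b)))
      floor : ∀ x → ¬ ¬ (∃[ z ] InCell (+ z) (t x))
      floor x = let B , t<B = bounded-above κ 0<κ (t x) in ¬¬-floor κ (t x) (t≥0 x) B t<B

-- Volumes

ℕ→ℚ : ℕ → ℚ
ℕ→ℚ n = ℤ→ℚ (+ n)

ℕ→ℚ-+ : ∀ m n → ℕ→ℚ (m + n) ≡ ℕ→ℚ m ℚ.+ ℕ→ℚ n
ℕ→ℚ-+ m n = trans (cong ℤ→ℚ (ℤₚ.pos-+ m n)) (ℤ→ℚ-+ (+ m) (+ n))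

ℕ→ℚ-* : ∀ m n → ℕ→ℚ (m * n) ≡ ℕ→ℚ m ℚ.* ℕ→ℚ n
ℕ→ℚ-* m n = trans (cong ℤ→ℚ (ℤₚ.pos-* m n)) (ℤ→ℚ-* (+ m) (+ n))

ℕ→ℚ-mono : ∀ {m n} → m ℕ.≤ n → ℕ→ℚ m ℚ.≤ ℕ→ℚ n
ℕ→ℚ-mono m≤n = ℤ→ℚ-mono-≤ (+≤+ m≤n)

ℕ→ℚ-nonneg : ∀ n → 0ℚ ℚ.≤ ℕ→ℚ n
ℕ→ℚ-nonneg n = ℕ→ℚ-mono {0} {n} z≤n

pow : ℚ → ℕ → ℚ
pow q zero    = 1ℚ
pow q (suc n) = q ℚ.* pow q n

pow-* : ∀ p q n → pow (p ℚ.* q) n ≡ pow p n ℚ.* pow q n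
pow-* p q zero    = refl
pow-* p q (suc n) = trans (cong (p ℚ.* q ℚ.*_) (pow-* p q n)) (interchange p q (pow p n) (pow q n))
  where
  interchange : ∀ a b c d → a ℚ.* b ℚ.* (c ℚ.* d) ≡ a ℚ.* c ℚ.* (b ℚ.* d)
  interchange = ring-solve-∀ ℚ-ring

ℕ→ℚ-^ : ∀ m n → ℕ→ℚ (m ^ n) ≡ pow (ℕ→ℚ m) n
ℕ→ℚ-^ m zero    = refl
ℕ→ℚ-^ m (suc n) = trans (ℕ→ℚ-* m (m ^ n)) (cong (ℕ→ℚ m ℚ.*_) (ℕ→ℚ-^ m n))

product-nonneg : ∀ {p q} → 0ℚ ℚ.≤ p → 0ℚ ℚ.≤ q → 0ℚ ℚ.≤ p ℚ.* q
product-nonneg {p} {q} 0≤p 0≤q = subst (ℚ._≤ p ℚ.* q) (ℚₚ.*-zeroʳ p) (ℚₚ.*-monoˡ-≤-nonNeg p {{ℚ.nonNegative 0≤p}} 0≤q)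

pow-nonneg : ∀ {q} → 0ℚ ℚ.≤ q → ∀ n → 0ℚ ℚ.≤ pow q n
pow-nonneg     0≤q zero    = ℚₚ.<⇒≤ (ℚₚ.positive⁻¹ 1ℚ)
pow-nonneg {q} 0≤q (suc n) = product-nonneg 0≤q (pow-nonneg 0≤q n)

≤-by : ∀ {p q r} → q ≡ p ℚ.+ r → 0ℚ ℚ.≤ r → p ℚ.≤ q
≤-by {p} {q} {r} eq 0≤r = subst₂ ℚ._≤_ (ℚₚ.+-identityʳ p) (sym eq) (ℚₚ.+-monoʳ-≤ p 0≤r)

bernoulli : ∀ {q y} → q ≡ 1ℚ ℚ.- y → 0ℚ ℚ.≤ q → 0ℚ ℚ.≤ y → ∀ n → 1ℚ ℚ.- ℕ→ℚ n ℚ.* y ℚ.≤ pow q n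
bernoulli {y = y} _ _ _ zero = ℚₚ.≤-reflexive (simplify y)
  where
  simplify : ∀ y → 1ℚ ℚ.- 0ℚ ℚ.* y ≡ 1ℚ
  simplify = ring-solve-∀ ℚ-ring
bernoulli {q} {y} q≡ 0≤q 0≤y (suc n) = ℚₚ.≤-trans
  (≤-by (trans (cong (ℚ._* (1ℚ ℚ.- ℕ→ℚ n ℚ.* y)) q≡) (trans (expand (ℕ→ℚ n) y) (cong (λ m → 1ℚ ℚ.- m ℚ.* y ℚ.+ ℕ→ℚ n ℚ.* (y ℚ.* y)) (sym (ℕ→ℚ-+ 1 n)))))
        (product-nonneg (ℕ→ℚ-nonneg n) (product-nonneg 0≤y 0≤y)))
  (ℚₚ.*-monoˡ-≤-nonNeg q {{ℚ.nonNegative 0≤q}} (bernoulli q≡ 0≤q 0≤y n))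
  where
  expand : ∀ n y → (1ℚ ℚ.- y) ℚ.* (1ℚ ℚ.- n ℚ.* y) ≡ 1ℚ ℚ.- (1ℚ ℚ.+ n) ℚ.* y ℚ.+ n ℚ.* (y ℚ.* y)
  expand = ring-solve-∀ ℚ-ring

-- This is 2^n - 1, the slope of the chord of (1 + y)^n over the interval from 0 to 1; by convexity
-- the chord bounds the power from above.
mersenne : ℕ → ℕ
mersenne zero    = 0
mersenne (suc n) = suc (mersenne n + mersenne n)

pow-1+≤ : ∀ {q y} → q ≡ 1ℚ ℚ.+ y → 0ℚ ℚ.≤ q → 0ℚ ℚ.≤ y → 0ℚ ℚ.≤ (1ℚ ℚ.- y) →
          ∀ n → pow q n ℚ.≤ 1ℚ ℚ.+ ℕ→ℚ (mersenne n) ℚ.* y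
pow-1+≤ {y = y} _ _ _ _ zero = ℚₚ.≤-reflexive (simplify y)
  where
  simplify : ∀ y → 1ℚ ≡ 1ℚ ℚ.+ 0ℚ ℚ.* y
  simplify = ring-solve-∀ ℚ-ring
pow-1+≤ {q} {y} q≡ 0≤q 0≤y y≤1 (suc n) = ℚₚ.≤-trans (ℚₚ.*-monoˡ-≤-nonNeg q {{ℚ.nonNegative 0≤q}} (pow-1+≤ q≡ 0≤q 0≤y y≤1 n))
  (≤-by (trans (cong (λ m → 1ℚ ℚ.+ m ℚ.* y) (trans (ℕ→ℚ-+ 1 (mersenne n + mersenne n)) (cong (ℚ._+_ 1ℚ) (ℕ→ℚ-+ (mersenne n) (mersenne n)))))
          (trans (expand (ℕ→ℚ (mersenne n)) y) (cong (λ q → q ℚ.* (1ℚ ℚ.+ ℕ→ℚ (mersenne n) ℚ.* y) ℚ.+ ℕ→ℚ (mersenne n) ℚ.* (y ℚ.* (1ℚ ℚ.- y))) (sym q≡))))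
        (product-nonneg (ℕ→ℚ-nonneg (mersenne n)) (product-nonneg 0≤y y≤1)))
  where
  expand : ∀ t y → 1ℚ ℚ.+ (1ℚ ℚ.+ (t ℚ.+ t)) ℚ.* y ≡ (1ℚ ℚ.+ y) ℚ.* (1ℚ ℚ.+ t ℚ.* y) ℚ.+ t ℚ.* (y ℚ.* (1ℚ ℚ.- y))
  expand = ring-solve-∀ ℚ-ring

-- Explicit growth bounds for H

rising-bounds : ∀ N {x l h} → l ℕ.≤ x → x + N ℕ.≤ h → ∃[ r ] rising N (+ x) ≡ + r × l ^ N ℕ.≤ r × r ℕ.≤ h ^ N
rising-bounds zero    _   _   = 1 , refl , ℕₚ.≤-refl , ℕₚ.≤-refl
rising-bounds (suc N) {x} {l} {h} l≤x x+N≤h =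
  let r , eq , l≤r , r≤h = rising-bounds N l≤x (ℕₚ.≤-trans (ℕₚ.+-monoʳ-≤ x (ℕₚ.n≤1+n N)) x+N≤h) in
  (x + suc N) * r ,
  trans (cong₂ ℤ._*_ (sym (ℤₚ.pos-+ x (suc N))) eq) (sym (ℤₚ.pos-* (x + suc N) r)) ,
  ℕₚ.*-mono-≤ (ℕₚ.≤-trans l≤x (ℕₚ.m≤m+n x (suc N))) l≤r ,
  ℕₚ.*-mono-≤ x+N≤h r≤h

-- N! times the count is a product of N factors K - a + i with 1 ≤ i ≤ N, each between l and K + N.
compositions-bounds : ∀ N {a K l} → a ℕ.≤ N → l + N ℕ.≤ K →
                      l ^ N ℕ.≤ N ! * compositions (suc N) a K × N ! * compositions (suc N) a K ℕ.≤ (K + N) ^ N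
compositions-bounds N {a} {K} {l} a≤N l+N≤K =
  subst (λ s → l ^ N ℕ.≤ s × s ℕ.≤ (K + N) ^ N) (sym size) (proj₂ (proj₂ bounds))
  where
  a≤K : a ℕ.≤ K
  a≤K = ℕₚ.≤-trans a≤N (ℕₚ.≤-trans (ℕₚ.m≤n+m N l) l+N≤K)
  l≤ : l ℕ.≤ K ∸ a
  l≤ = ℕₚ.m+n≤o⇒m≤o∸n l (ℕₚ.≤-trans (ℕₚ.+-monoʳ-≤ l a≤N) l+N≤K)
  bounds : ∃[ r ] rising N (+ (K ∸ a)) ≡ + r × l ^ N ℕ.≤ r × r ℕ.≤ (K + N) ^ N
  bounds = rising-bounds N l≤ (ℕₚ.+-monoˡ-≤ N (ℕₚ.m∸n≤m K a))
  size : N ! * compositions (suc N) a K ≡ proj₁ bounds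
  size = ℤₚ.+-injective (begin
    + (N ! * compositions (suc N) a K)  ≡⟨ ℤₚ.pos-* (N !) _ ⟩
    + (N !) ℤ.* + compositions (suc N) a K  ≡⟨ compositions≡rising N a K (ℕₚ.≤-trans a≤N (ℕₚ.m≤m+n N K)) ⟩
    rising N (+ K ℤ.- + a)  ≡⟨ cong (rising N) (trans (ℤₚ.m-n≡m⊖n K a) (ℤₚ.⊖-≥ a≤K)) ⟩
    rising N (+ (K ∸ a))  ≡⟨ proj₁ (proj₂ bounds) ⟩
    + proj₁ bounds  ∎)
    where open ≡-Reasoning

∑∈-bounds : ∀ {f : ℕ × ℕ → ℕ} {c l h ps} → ListAll.All (λ p → l ℕ.≤ c * f p × c * f p ℕ.≤ h) ps →
            List.length ps * l ℕ.≤ c * ∑∈ f ps × c * ∑∈ f ps ℕ.≤ List.length ps * h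
∑∈-bounds {c = c} [] = z≤n , ℕₚ.≤-reflexive (ℕₚ.*-zeroʳ c)
∑∈-bounds {f} {c} {l} {h} {p ∷ ps} ((l≤ , ≤h) ∷ bounds) =
  let l≤′ , ≤h′ = ∑∈-bounds {f = f} {c} bounds
      split = ℕₚ.*-distribˡ-+ c (f p) (∑∈ f ps)
  in subst (l + List.length ps * l ℕ.≤_) (sym split) (ℕₚ.+-mono-≤ l≤ l≤′) ,
     subst (ℕ._≤ h + List.length ps * h) (sym split) (ℕₚ.+-mono-≤ ≤h ≤h′)

module _ {e : ℕ} (series : HilbertSeries e) where

  open HilbertSeries series

  private
    d N : ℕ
    d = suc e
    N = e * e

  -- Each pair contributes K^N / N! to leading order whatever its exponents, so only the number of
  -- pairs matters. The lower bound uses a ≤ N, which follows from b ≠ 0.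
  H-bounds : ∀ {K l} → l + N ℕ.≤ K →
             List.length pieces * l ^ N ℕ.≤ N ! * H d K × N ! * H d K ℕ.≤ List.length pieces * (K + N) ^ N
  H-bounds {K} {l} l+N≤K = subst (λ h → List.length pieces * l ^ N ℕ.≤ N ! * h × N ! * h ℕ.≤ List.length pieces * (K + N) ^ N) (sym (H≡ K))
    (∑∈-bounds {f = λ p → compositions (suc N) (proj₁ p) K} {N !}
      (ListAll.map (λ a≤N → compositions-bounds N a≤N l+N≤K) (ListAll.zipWith (λ (deg , b≢0) → a≤N deg b≢0) (degrees , proper))))
    where
    a≤N : ∀ {a b} → a + b ≡ suc N → b ≢ 0 → a ℕ.≤ N
    a≤N {a} {zero}  _   b≢0 = contradiction refl b≢0
    a≤N {a} {suc b} deg _   = subst (a ℕ.≤_) (ℕₚ.suc-injective (trans (sym (ℕₚ.+-suc a b)) deg)) (ℕₚ.m≤m+n a b)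

grid-volume : ∀ {e k κ} (0<κ : 0ℚ ℚ.< κ) (κ*k≡1 : κ ℚ.* ℤ→ℚ (+ k) ≡ 1ℚ) s K →
              totalVolume (Grid.boxes {e} {k} 0<κ κ*k≡1 s K) ≡ ℕ→ℚ (H (suc e) K) ℚ.* pow κ (e * e)
grid-volume {e} {k} {κ} 0<κ κ*k≡1 s K = total (magicSquares (suc e) K)
  where
  open Grid {e} {k} 0<κ κ*k≡1
  const : ∀ {n} (f : Fin n → ℚ) → (∀ i → f i ≡ κ) → Algebra.Definitions.RawMonoid.sum ℚ.*-1-rawMonoid f ≡ pow κ n
  const {zero}  f f≡κ = refl
  const {suc n} f f≡κ = cong₂ ℚ._*_ (f≡κ zero) (const (f ∘ suc) (f≡κ ∘ suc))
  side-length : ∀ z → κ ℚ.* ℤ→ℚ (1ℤ ℤ.+ z) ℚ.- κ ℚ.* ℤ→ℚ z ≡ κ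
  side-length z = trans (cong (λ y → κ ℚ.* y ℚ.- κ ℚ.* ℤ→ℚ z) (ℤ→ℚ-+ 1ℤ z)) (cancel κ (ℤ→ℚ z))
    where
    cancel : ∀ κ z → κ ℚ.* (1ℚ ℚ.+ z) ℚ.- κ ℚ.* z ≡ κ
    cancel = ring-solve-∀ ℚ-ring
  volume : ∀ Z → boxVolume (gridBox Z) ≡ pow κ (e * e)
  volume Z = const _ λ x → side-length (let (a , b) = Fin.remQuot {e} e x in Z a b)
  total : ∀ Ms → totalVolume (List.map (gridBox ∘ shifted s) Ms) ≡ ℕ→ℚ (List.length Ms) ℚ.* pow κ (e * e)
  total []       = sym (ℚₚ.*-zeroˡ (pow κ (e * e)))
  total (M ∷ Ms) = trans (cong₂ ℚ._+_ (volume (shifted s M)) (total Ms))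
    (trans (factor (pow κ (e * e)) (ℕ→ℚ (List.length Ms))) (cong (ℚ._* pow κ (e * e)) (sym (ℕ→ℚ-+ 1 (List.length Ms)))))
    where
    factor : ∀ p l → p ℚ.+ l ℚ.* p ≡ (1ℚ ℚ.+ l) ℚ.* p
    factor = ring-solve-∀ ℚ-ring

module Content {e : ℕ} (series : HilbertSeries e) {V : ℚ}
               (N!V≡ : ℕ→ℚ ((e * e) !) ℚ.* V ≡ ℕ→ℚ (List.length (HilbertSeries.pieces series))) where

  open HilbertSeries series

  private
    d N j : ℕ
    d = suc e
    N = e * e
    j = List.length pieces

    f : ℚ
    f = ℕ→ℚ (N !)

    1≤f : 1ℚ ℚ.≤ f
    1≤f = ℕ→ℚ-mono (ℕₚ.n≢0⇒n>0 (ℕ.≢-nonZero⁻¹ (N !) {{N ℕₚ.!≢0}}))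

    f>0 : ℚ.Positive f
    f>0 = ℚ.positive (ℚₚ.<-≤-trans (ℚₚ.positive⁻¹ 1ℚ) 1≤f)

    -- Since f ≥ 1, dividing by f does not enlarge the error.
    cancel-f : ∀ {p q ε} → 0ℚ ℚ.< ε → f ℚ.* p ℚ.≤ f ℚ.* q ℚ.+ ε → p ℚ.≤ q ℚ.+ ε
    cancel-f {p} {q} {ε} 0<ε le = ℚₚ.*-cancelˡ-≤-pos f {{f>0}} (begin
      f ℚ.* p  ≤⟨ le ⟩
      f ℚ.* q ℚ.+ ε  ≡⟨ cong (ℚ._+_ (f ℚ.* q)) (ℚₚ.*-identityˡ ε) ⟨
      f ℚ.* q ℚ.+ 1ℚ ℚ.* ε  ≤⟨ ℚₚ.+-monoʳ-≤ (f ℚ.* q) (ℚₚ.*-monoʳ-≤-nonNeg ε {{ℚ.nonNegative (ℚₚ.<⇒≤ 0<ε)}} 1≤f) ⟩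
      f ℚ.* q ℚ.+ f ℚ.* ε  ≡⟨ ℚₚ.*-distribˡ-+ f q ε ⟨
      f ℚ.* (q ℚ.+ ε)  ∎)
      where open ℚₚ.≤-Reasoning

    -- A fixed error is spread over a grid of mesh 1 / k with k ≥ n.
    small : ∀ {excess n k κ ε} → 0ℚ ℚ.< κ → κ ℚ.* ℕ→ℚ k ≡ 1ℚ → 0ℚ ℚ.< ε → ℕ→ℚ excess ℚ.< ε ℚ.* ℕ→ℚ n → n ℕ.≤ k → ℕ→ℚ excess ℚ.* κ ℚ.≤ ε
    small {excess} {n} {k} {κ} {ε} 0<κ κk≡1 0<ε A<εn n≤k = begin
      ℕ→ℚ excess ℚ.* κ  ≤⟨ ℚₚ.*-monoʳ-≤-nonNeg κ {{ℚ.nonNegative (ℚₚ.<⇒≤ 0<κ)}}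
                                    (ℚₚ.≤-trans (ℚₚ.<⇒≤ A<εn) (ℚₚ.*-monoˡ-≤-nonNeg ε {{ℚ.nonNegative (ℚₚ.<⇒≤ 0<ε)}} (ℕ→ℚ-mono n≤k))) ⟩
      ε ℚ.* ℕ→ℚ k ℚ.* κ  ≡⟨ trans (ℚₚ.*-assoc ε (ℕ→ℚ k) κ) (cong (ε ℚ.*_) (trans (ℚₚ.*-comm (ℕ→ℚ k) κ) κk≡1)) ⟩
      ε ℚ.* 1ℚ  ≡⟨ ℚₚ.*-identityʳ ε ⟩
      ε  ∎
      where open ℚₚ.≤-Reasoning

    scaled-power : ∀ a b κ → ℕ→ℚ (a * b ^ N) ℚ.* pow κ N ≡ ℕ→ℚ a ℚ.* pow (κ ℚ.* ℕ→ℚ b) N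
    scaled-power a b κ = trans (cong (ℚ._* pow κ N) (trans (ℕ→ℚ-* a (b ^ N)) (cong (ℕ→ℚ a ℚ.*_) (ℕ→ℚ-^ b N))))
      (trans (regroup (ℕ→ℚ a) (pow (ℕ→ℚ b) N) (pow κ N)) (cong (ℕ→ℚ a ℚ.*_) (sym (pow-* κ (ℕ→ℚ b) N))))
      where
      regroup : ∀ a b k → a ℚ.* b ℚ.* k ≡ a ℚ.* (k ℚ.* b)
      regroup = ring-solve-∀ ℚ-ring

    product₃ : ∀ a b c κ → ℕ→ℚ a ℚ.* (ℕ→ℚ b ℚ.* (κ ℚ.* ℕ→ℚ c)) ≡ ℕ→ℚ (a * b * c) ℚ.* κ
    product₃ a b c κ = trans (regroup (ℕ→ℚ a) (ℕ→ℚ b) (ℕ→ℚ c) κ)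
      (cong (ℚ._* κ) (trans (cong (ℚ._* ℕ→ℚ c) (sym (ℕ→ℚ-* a b))) (sym (ℕ→ℚ-* (a * b) c))))
      where
      regroup : ∀ a b c k → a ℚ.* (b ℚ.* (k ℚ.* c)) ≡ a ℚ.* b ℚ.* c ℚ.* k
      regroup = ring-solve-∀ ℚ-ring

  module InnerVolume {ε : ℚ} (0<ε : 0ℚ ℚ.< ε) where

    -- Here c = k - l, so κ l = 1 - κ c, and by Bernoulli's inequality (κ l)^N loses at most N c κ.
    -- For j pairs the loss is `excess` times κ, which n is chosen to bring below ε.
    c excess n l K k : ℕ
    c = N + e * suc e
    excess = j * N * c
    n = proj₁ (archimedean (ℕ→ℚ excess) ε 0<ε)
    l = suc n
    K = l + N
    k = K + e * suc e

    κ : ℚ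
    κ = proj₁ (reciprocal (n + N + e * suc e))

    0<κ : 0ℚ ℚ.< κ
    0<κ = proj₁ (proj₂ (reciprocal (n + N + e * suc e)))

    κ*k≡1 : κ ℚ.* ℕ→ℚ k ≡ 1ℚ
    κ*k≡1 = proj₂ (proj₂ (reciprocal (n + N + e * suc e)))

    y : ℚ
    y = κ ℚ.* ℕ→ℚ c

    κl≡1-y : κ ℚ.* ℕ→ℚ l ≡ 1ℚ ℚ.- y
    κl≡1-y = begin
      κ ℚ.* ℕ→ℚ l  ≡⟨ difference κ (ℕ→ℚ l) (ℕ→ℚ c) ⟩
      κ ℚ.* (ℕ→ℚ l ℚ.+ ℕ→ℚ c) ℚ.- y  ≡⟨ cong (λ z → κ ℚ.* z ℚ.- y) (trans (sym (ℕ→ℚ-+ l c)) (cong ℕ→ℚ (sym (ℕₚ.+-assoc l N (e * suc e))))) ⟩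
      κ ℚ.* ℕ→ℚ k ℚ.- y  ≡⟨ cong (ℚ._- y) κ*k≡1 ⟩
      1ℚ ℚ.- y  ∎
      where
      open ≡-Reasoning
      difference : ∀ k l c → k ℚ.* l ≡ k ℚ.* (l ℚ.+ c) ℚ.- k ℚ.* c
      difference = ring-solve-∀ ℚ-ring

    volume : V ℚ.≤ ℕ→ℚ (H d K) ℚ.* pow κ N ℚ.+ ε
    volume = cancel-f 0<ε (begin
      f ℚ.* V  ≡⟨ N!V≡ ⟩
      ℕ→ℚ j  ≡⟨ restore (ℕ→ℚ j) (ℕ→ℚ N ℚ.* y) ⟩
      ℕ→ℚ j ℚ.* (1ℚ ℚ.- ℕ→ℚ N ℚ.* y) ℚ.+ ℕ→ℚ j ℚ.* (ℕ→ℚ N ℚ.* y)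
        ≤⟨ ℚₚ.+-mono-≤ (ℚₚ.*-monoˡ-≤-nonNeg (ℕ→ℚ j) {{ℚ.nonNegative (ℕ→ℚ-nonneg j)}} (bernoulli κl≡1-y κl≥0 y≥0 N))
             (ℚₚ.≤-trans (ℚₚ.≤-reflexive (product₃ j N c κ)) (small {excess} {n} {k} 0<κ κ*k≡1 0<ε (proj₂ (archimedean (ℕ→ℚ excess) ε 0<ε)) n≤k)) ⟩
      ℕ→ℚ j ℚ.* pow (κ ℚ.* ℕ→ℚ l) N ℚ.+ ε  ≡⟨ cong (ℚ._+ ε) (scaled-power j l κ) ⟨
      ℕ→ℚ (j * l ^ N) ℚ.* pow κ N ℚ.+ ε
        ≤⟨ ℚₚ.+-monoˡ-≤ ε (ℚₚ.*-monoʳ-≤-nonNeg (pow κ N) {{ℚ.nonNegative (pow-nonneg (ℚₚ.<⇒≤ 0<κ) N)}} (ℕ→ℚ-mono (proj₁ (H-bounds series {K} {l} ℕₚ.≤-refl)))) ⟩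
      ℕ→ℚ (N ! * H d K) ℚ.* pow κ N ℚ.+ ε
        ≡⟨ cong (ℚ._+ ε) (trans (cong (ℚ._* pow κ N) (ℕ→ℚ-* (N !) (H d K))) (ℚₚ.*-assoc f (ℕ→ℚ (H d K)) (pow κ N))) ⟩
      f ℚ.* (ℕ→ℚ (H d K) ℚ.* pow κ N) ℚ.+ ε ∎)
      where
      open ℚₚ.≤-Reasoning
      κ≥0 : 0ℚ ℚ.≤ κ
      κ≥0 = ℚₚ.<⇒≤ 0<κ
      κl≥0 : 0ℚ ℚ.≤ κ ℚ.* ℕ→ℚ l
      κl≥0 = product-nonneg κ≥0 (ℕ→ℚ-nonneg l)
      y≥0 : 0ℚ ℚ.≤ y
      y≥0 = product-nonneg κ≥0 (ℕ→ℚ-nonneg c)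
      n≤k : n ℕ.≤ k
      n≤k = ℕₚ.≤-trans (ℕₚ.n≤1+n n) (ℕₚ.≤-trans (ℕₚ.m≤m+n l N) (ℕₚ.m≤m+n K (e * suc e)))
      restore : ∀ j z → j ≡ j ℚ.* (1ℚ ℚ.- z) ℚ.+ j ℚ.* z
      restore = ring-solve-∀ ℚ-ring

  module OuterVolume {ε : ℚ} (0<ε : 0ℚ ℚ.< ε) where

    -- Here c = K + N - k, so κ (K + N) = 1 + κ c, and the chord bound gains at most (2^N - 1) c κ
    -- for each of the j pairs. The summand c in k ensures κ c ≤ 1, which the chord bound requires.
    c excess n k K : ℕ
    c = e * e + N
    excess = j * mersenne N * c
    n = proj₁ (archimedean (ℕ→ℚ excess) ε 0<ε)
    k = suc (n + c)
    K = k + e * e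

    κ : ℚ
    κ = proj₁ (reciprocal (n + c))

    0<κ : 0ℚ ℚ.< κ
    0<κ = proj₁ (proj₂ (reciprocal (n + c)))

    κ*k≡1 : κ ℚ.* ℕ→ℚ k ≡ 1ℚ
    κ*k≡1 = proj₂ (proj₂ (reciprocal (n + c)))

    y : ℚ
    y = κ ℚ.* ℕ→ℚ c

    volume : ℕ→ℚ (H d K) ℚ.* pow κ N ℚ.≤ V ℚ.+ ε
    volume = cancel-f 0<ε (begin
      f ℚ.* (ℕ→ℚ (H d K) ℚ.* pow κ N)
        ≡⟨ trans (cong (ℚ._* pow κ N) (ℕ→ℚ-* (N !) (H d K))) (ℚₚ.*-assoc f (ℕ→ℚ (H d K)) (pow κ N)) ⟨
      ℕ→ℚ (N ! * H d K) ℚ.* pow κ N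
        ≤⟨ ℚₚ.*-monoʳ-≤-nonNeg (pow κ N) {{ℚ.nonNegative (pow-nonneg (ℚₚ.<⇒≤ 0<κ) N)}} (ℕ→ℚ-mono (proj₂ (H-bounds series {K} {0} (ℕₚ.m≤n+m N k)))) ⟩
      ℕ→ℚ (j * (K + N) ^ N) ℚ.* pow κ N
        ≡⟨ scaled-power j (K + N) κ ⟩
      ℕ→ℚ j ℚ.* pow (κ ℚ.* ℕ→ℚ (K + N)) N
        ≤⟨ ℚₚ.*-monoˡ-≤-nonNeg (ℕ→ℚ j) {{ℚ.nonNegative (ℕ→ℚ-nonneg j)}} (pow-1+≤ κh≡1+y κh≥0 y≥0 y≤1 N) ⟩
      ℕ→ℚ j ℚ.* (1ℚ ℚ.+ ℕ→ℚ (mersenne N) ℚ.* y)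
        ≡⟨ expand (ℕ→ℚ j) (ℕ→ℚ (mersenne N) ℚ.* y) ⟩
      ℕ→ℚ j ℚ.+ ℕ→ℚ j ℚ.* (ℕ→ℚ (mersenne N) ℚ.* y)
        ≤⟨ ℚₚ.+-monoʳ-≤ (ℕ→ℚ j) (ℚₚ.≤-trans (ℚₚ.≤-reflexive (product₃ j (mersenne N) c κ))
             (small {excess} {n} {k} 0<κ κ*k≡1 0<ε (proj₂ (archimedean (ℕ→ℚ excess) ε 0<ε)) (ℕₚ.≤-trans (ℕₚ.m≤m+n n c) (ℕₚ.n≤1+n (n + c))))) ⟩
      ℕ→ℚ j ℚ.+ ε
        ≡⟨ cong (ℚ._+ ε) N!V≡ ⟨
      f ℚ.* V ℚ.+ ε ∎)
      where
      open ℚₚ.≤-Reasoning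
      κ≥0 : 0ℚ ℚ.≤ κ
      κ≥0 = ℚₚ.<⇒≤ 0<κ
      κh≥0 : 0ℚ ℚ.≤ κ ℚ.* ℕ→ℚ (K + N)
      κh≥0 = product-nonneg κ≥0 (ℕ→ℚ-nonneg (K + N))
      y≥0 : 0ℚ ℚ.≤ y
      y≥0 = product-nonneg κ≥0 (ℕ→ℚ-nonneg c)
      expand : ∀ j z → j ℚ.* (1ℚ ℚ.+ z) ≡ j ℚ.+ j ℚ.* z
      expand = ring-solve-∀ ℚ-ring
      κh≡1+y : κ ℚ.* ℕ→ℚ (K + N) ≡ 1ℚ ℚ.+ y
      κh≡1+y = trans (cong (κ ℚ.*_) (trans (cong ℕ→ℚ (ℕₚ.+-assoc k (e * e) N)) (ℕ→ℚ-+ k c)))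
        (trans (ℚₚ.*-distribˡ-+ κ (ℕ→ℚ k) (ℕ→ℚ c)) (cong (ℚ._+ y) κ*k≡1))
      y≤1 : 0ℚ ℚ.≤ (1ℚ ℚ.- y)
      y≤1 = subst (0ℚ ℚ.≤_) (begin-equality
        κ ℚ.* ℕ→ℚ (suc n)  ≡⟨ difference κ (ℕ→ℚ (suc n)) (ℕ→ℚ c) ⟩
        κ ℚ.* (ℕ→ℚ (suc n) ℚ.+ ℕ→ℚ c) ℚ.- y  ≡⟨ cong (λ z → κ ℚ.* z ℚ.- y) (ℕ→ℚ-+ (suc n) c) ⟨
        κ ℚ.* ℕ→ℚ k ℚ.- y  ≡⟨ cong (ℚ._- y) κ*k≡1 ⟩
        1ℚ ℚ.- y  ∎) (product-nonneg κ≥0 (ℕ→ℚ-nonneg (suc n)))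
        where
        difference : ∀ k l c → k ℚ.* l ≡ k ℚ.* (l ℚ.+ c) ℚ.- k ℚ.* c
        difference = ring-solve-∀ ℚ-ring

  content : HasContent (λ t → Birkhoff d (LatticeChart.point (chart {e}) t)) (fromℚ V)
  content = record
    { inner = λ ε 0<ε → let open InnerVolume 0<ε in
        Grid.boxes {e} {k} 0<κ κ*k≡1 (+ e) K , Grid.boxes-disjoint {e} {k} 0<κ κ*k≡1 (+ e) K , Grid.Inner.inner-boxes {e} {k} 0<κ κ*k≡1 refl ,
        fromℚ-mono (subst (λ v → V ℚ.≤ v ℚ.+ ε) (sym (grid-volume {e} {k} 0<κ κ*k≡1 (+ e) K)) volume)
    ; outer = λ ε 0<ε → let open OuterVolume 0<ε in
        Grid.boxes {e} {k} 0<κ κ*k≡1 (ℤ.- + e) K , Grid.Outer.cover {e} {k} 0<κ κ*k≡1 refl ,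
        fromℚ-mono (subst (ℚ._≤ V ℚ.+ ε) (sym (grid-volume {e} {k} 0<κ κ*k≡1 (ℤ.- + e) K)) volume) }

-- From the number of pairs to the closed formula

1/n*n≡1 : ∀ n .{{_ : NonZero n}} → (1ℤ ℚ./ n) ℚ.* ℕ→ℚ n ≡ 1ℚ
1/n*n≡1 n@(suc n-1) = ℚₚ.toℚᵘ-injective (begin
  ℚ.toℚᵘ ((1ℤ ℚ./ n) ℚ.* ℕ→ℚ n)  ≈⟨ ℚₚ.toℚᵘ-homo-* (1ℤ ℚ./ n) (ℕ→ℚ n) ⟩
  ℚ.toℚᵘ (1ℤ ℚ./ n) ℚᵘ.* ℚ.toℚᵘ (ℕ→ℚ n)  ≈⟨ ℚᵘₚ.*-cong (ℚₚ.toℚᵘ-fromℚᵘ (ℚᵘ.mkℚᵘ 1ℤ n-1)) (ℚₚ.toℚᵘ-fromℚᵘ (ℚᵘ.mkℚᵘ (+ n) 0)) ⟩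
  ℚᵘ.mkℚᵘ 1ℤ n-1 ℚᵘ.* ℚᵘ.mkℚᵘ (+ n) 0  ≈⟨ ℚᵘ.*≡* (identity n) ⟩
  ℚᵘ.1ℚᵘ  ∎)
  where
  open ℚᵘₚ.≃-Reasoning
  identity : ∀ n → 1ℤ ℤ.* + n ℤ.* 1ℤ ≡ 1ℤ ℤ.* + (n * 1)
  identity n = trans (ℤₚ.*-identityʳ (1ℤ ℤ.* + n)) (cong (λ m → 1ℤ ℤ.* + m) (sym (ℕₚ.*-identityʳ n)))

pos-^ : ∀ m n → (+ m) ℤ.^ n ≡ + (m ^ n)
pos-^ m zero    = refl
pos-^ m (suc n) = trans (cong (+ m ℤ.*_) (pos-^ m n)) (sym (ℤₚ.pos-* m (m ^ n)))

-- The dimension is a variable with an equation because (d ∸ 1) ^ 2 computes to e * (e * 1) and not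
-- to e * e, the type on which the chart is built; matching on the equation transports the whole
-- statement.
volume-in-dimension : ∀ e N → N ≡ e * e → let d = suc e ; n = N / 2 in
  HasLatticeVolume N (Birkhoff d)
    (fromℚ ((1ℤ ℚ./ (N ! * d ^ N)) {{n!*d^n≢0 N d}} ℚ.*
      (∑₀^ n (λ m → -1ℤ ℤ.^ (n + m)
                    ℤ.* (+ (N C (n ∸ m)) ℤ.+ -1ℤ ℤ.^ d ℤ.* + (N C (n + m + 1)))
                    ℤ.* + (H d (m * d)))
       ℚ./ 1)))
volume-in-dimension e .(e * e) refl = chart , Content.content series (begin
  ℕ→ℚ (N !) ℚ.* (1/D ℚ.* ℤ→ℚ total)
    ≡⟨ cong (λ s → ℕ→ℚ (N !) ℚ.* (1/D ℚ.* s)) (trans (cong ℤ→ℚ (AlternatingSum.alternatingSum e series))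
         (trans (ℤ→ℚ-* (+ j) ((+ d) ℤ.^ N)) (cong (λ p → ℕ→ℚ j ℚ.* ℤ→ℚ p) (pos-^ d N)))) ⟩
  ℕ→ℚ (N !) ℚ.* (1/D ℚ.* (ℕ→ℚ j ℚ.* ℕ→ℚ (d ^ N)))
    ≡⟨ regroup (ℕ→ℚ (N !)) 1/D (ℕ→ℚ j) (ℕ→ℚ (d ^ N)) ⟩
  1/D ℚ.* (ℕ→ℚ (N !) ℚ.* ℕ→ℚ (d ^ N)) ℚ.* ℕ→ℚ j
    ≡⟨ cong (ℚ._* ℕ→ℚ j) (trans (cong (1/D ℚ.*_) (sym (ℕ→ℚ-* (N !) (d ^ N)))) (1/n*n≡1 (N ! * d ^ N) {{n!*d^n≢0 N d}})) ⟩
  1ℚ ℚ.* ℕ→ℚ j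
    ≡⟨ ℚₚ.*-identityˡ (ℕ→ℚ j) ⟩
  ℕ→ℚ j ∎)
  where
  open ≡-Reasoning
  series : HilbertSeries e
  series = hilbertSeries e
  d N j : ℕ
  d = suc e
  N = e * e
  j = List.length (HilbertSeries.pieces series)
  total : ℤ
  total = ∑₀^ (N / 2) λ m → -1ℤ ℤ.^ (N / 2 + m) ℤ.* (+ (N C (N / 2 ∸ m)) ℤ.+ -1ℤ ℤ.^ d ℤ.* + (N C (N / 2 + m + 1))) ℤ.* + H d (m * d)
  1/D : ℚ
  1/D = (1ℤ ℚ./ (N ! * d ^ N)) {{n!*d^n≢0 N d}}
  regroup : ∀ f u j p → f ℚ.* (u ℚ.* (j ℚ.* p)) ≡ u ℚ.* (f ℚ.* p) ℚ.* j
  regroup = ring-solve-∀ ℚ-ring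

corollary6p5 : (d : ℕ) → .{{_ : NonZero d}} →
    let N = (d ∸ 1) ^ 2
        n = N / 2
    in HasLatticeVolume N (Birkhoff d)
         (fromℚ ((1ℤ ℚ./ (N ! * d ^ N)) {{n!*d^n≢0 N d}} ℚ.*
           (∑₀^ n (λ m → -1ℤ ℤ.^ (n + m)
                         ℤ.* (+ (N C (n ∸ m)) ℤ.+ -1ℤ ℤ.^ d ℤ.* + (N C (n + m + 1)))
                         ℤ.* + (H d (m * d)))
            ℚ./ 1)))
corollary6p5 (suc e) = volume-in-dimension e (e ^ 2) (cong (e *_) (ℕₚ.*-identityʳ e))
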